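{- Let $G=(V,E)$ be a finite simple $k$-regular bipartite graph and let $M(G,k)$ be the (simplified) Markov chain on the edge $k$-colorings of $G$ defined in the context. Then the diameter of $M(G,k)$ is upper bounded by $3|E|$, and the inverse of the acceptance ratio in the Metropolis-Hastings algorithm applied to $M(G,k)$ with the uniform distribution (on the edge $k$-colorings of $G$) is upper bounded by $16|V|(|V|-1)$.
   Context: **Colorings.** An edge $k$-coloring of $G=(V,E)$ is a map $C:E\to\{c_1,\dots,c_k\}$ such that no two adjacent edges have the same color. For a map $C:E\to\{c_1,\dots,c_k\}$, a vertex $v$ has a $(+c-c')$-deficiency (and is called deficient) if exactly two $c$-colored edges are incident to $v$, all other edges incident to $v$ have different colors, and no $c'$-colored edge is incident to $v$. An almost edge $k$-coloring is a map $C:E\to\{c_1,\dots,c_k\}$ such that at most two vertices have deficiency and all other vertices have no two incident edges of the same color. Flipping the colors along an alternating path or cycle with colors $a,b$ means interchanging $a$ and $b$ on its edges. Eliminating a $(+a-b)$-deficiency at a vertex $v$ means: select uniformly one of the two $a$-edges at $v$ and flip the colors along the maximal alternating path with colors $a,b$ starting at $v$ with the selected edge. **The Markov chain $M(G,k)$ for $k$-regular graphs.** $G$ is a $k$-regular bipartite graph with equally large vertex classes. The states are the edge $k$-colorings of $G$. From the current coloring $C$, a random edge $k$-coloring is drawn as follows. (1) With probability $\frac12$, do nothing. (2) With probability $\frac14$, select two colors $c,c'$ uniformly among the $\binom{k}{2}$ unordered pairs. Let $H$ be the subgraph of $G$ formed by the edges of colors $c$ and $c'$; it consists of disjoint alternating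 cycles. Select one of the following: (a) with probability $\frac12$, do nothing; (b) with probability $\frac12$, uniformly select one of the possible connected subgraphs of $H$. Flip the colors in the selected subgraph. If there is any deficient vertex, select one of them uniformly, select uniformly one of the edges with the same color incident to the selected vertex, and change its color from $c$ to $c'$ or from $c'$ to $c$. Otherwise, with probability $\frac12$ select an edge uniformly from all edges of color $c$ or $c'$ and change its color to the opposite ($c'$ or $c$), and with probability $\frac12$ do nothing. Finally eliminate all deficiencies by flipping the colors on the appropriate alternating path, selecting uniformly from the two edges with the same color incident to deficient vertices. (3) With probability $\frac14$, select three colors uniformly from all $\binom{k}{3}$ unordered triples, and select uniformly one of the three as distinguished. Let $c''$ be the distinguished color and $c,c'$ the other two. Let $H$ be the subgraph consisting of the edges of colors $c$ and $c'$; its components are again cycles. Select one of the following: (a) with probability $\frac12$, do nothing; (b) with probability $\frac12$, uniformly select a sub-path of $H$ with even length (even number of edges). Flip the colors in the selected sub-path. The number of deficient vertices is then even. If there are two deficient vertices, select one of them uniformly. If there is no deficient vertex, select uniformly a non-deficient vertex. - If a deficient vertex $v$ is selected, let $\tilde c$ be its repeated color. Consider the maximal alternating cycle with colors $\tilde c$ and $c''$ that contains $v$, and flip the colors in this cycle. - If a non-deficient vertex is selected, let $e$ be its incident edge of color $c''$. Select uniformly from its incident edges of color $c$ or $c'$; let the selected edge be $f$ and its color $\tilde c$. Take the maximal alternating cycle with colors $c''$ and $\tilde c$ that contains $e$ and $f$, and flip the colors in this cycle. Finally eliminate all deficiencies by flipping the colors on the appropriate alternating path, selecting uniformly from the two edges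 with the same color incident to deficient vertices. **Diameter.** The diameter of $M(G,k)$ is the maximum, over pairs of states, of the minimum number of positive-probability transitions needed to get from one to the other. **Metropolis-Hastings algorithm (variant used).** A proposal $C_2$ is drawn from the current state $C_1$ by the primary chain via some way $w$; $P(C_2,w\mid C_1)$ is the probability that $C_2$ is proposed from $C_1$ via way $w$, and each way $w$ from $C_1$ to $C_2$ has a corresponding inverse way $w'$ from $C_2$ to $C_1$ (a one-to-one correspondence). For the uniform target distribution the proposal is accepted with probability $\min\left\{1,\frac{P(C_1,w'\mid C_2)}{P(C_2,w\mid C_1)}\right\}$, and otherwise the chain stays at $C_1$. A way $w$ in $M(G,k)$ consists of the selection of 2 or 3 colors (with the distinguished color if there are 3), followed by three consecutive transformations: $\varphi_1^{ -1}$ (flipping the colors on the selected subgraph, creating at most two deficient vertices), $f$ (the subsequent perturbation, i.e. the change of color of one edge, the flip along a cycle involving $c''$, or nothing), and $\varphi_2$ (elimination of all deficiencies); the inverse way $w'$ selects the same colors and applies $\varphi_2^{ -1}$, $f^{ -1}$, $\varphi_1$. If nothing is done, the ratio is $1$. The bound on the inverse of the acceptance ratio means that for all states $C_1,C_2$ and every way $w$ by which $C_2$ can be proposed from $C_1$ the inverse of the acceptance probability is at most the stated quantity.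
   Formalization: For a way of step (2) whose first flip is an entire cycle of H, the inverse way flips that cycle first again, then applies f⁻¹ and φ₂⁻¹, since the inverse as described would have probability 0. The vertex set V is assumed nonempty. -}

module Defs where

open import Data.Bool.Base using (Bool; true; false; _xor_; if_then_else_)
import Data.Bool.Properties as Bool
open import Data.Fin.Base using (Fin)
import Data.Fin.Permutation.Components as Perm
import Data.Fin.Properties as Fin
open import Data.Fin.Subset using (Subset; _∈_; _⊂_; ⊥; ⁅_⁆; ∣_∣; Nonempty; inside; outside)
open import Data.Fin.Subset.Properties using (_∈?_; _⊂?_; nonempty?; anySubset?)
open import Data.Integer.Base using (+_)
open import Data.List.Base using (List; []; _∷_; [_]; _++_; map; concatMap; filter; length; allFin; cartesianProduct)
open import Data.Nat.Base using (ℕ; zero; suc)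
import Data.Nat.Base as ℕ
open import Data.Nat.Divisibility using (_∣_; _∣?_)
import Data.Nat.Properties as ℕ
open import Data.Product.Base using (Σ-syntax; ∃; ∃-syntax; _×_; _,_; proj₁)
import Data.Product.Properties as Product
open import Data.Rational.Base using (ℚ; 0ℚ; 1ℚ; ½; _/_; _+_; _*_; _÷_; _⊓_; _≤_; 1/_; Positive; NonZero)
open import Data.Rational.Properties using (pos⇒nonZero)
open import Data.Sum.Base using (_⊎_)
open import Data.Vec.Base using (Vec; lookup; tabulate; zipWith)
import Data.Vec.Base as Vec
import Data.Vec.Properties as Vec
open import Relation.Binary.Definitions using (DecidableEquality)
open import Relation.Binary.PropositionalEquality.Core using (_≡_; _≢_; refl; cong)
open import Relation.Nullary.Decidable using (yes; no; does; ¬?; map′; _×-dec_; _⊎-dec_; _→-dec_)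
open import Relation.Nullary.Negation.Core using (¬_)
open import Relation.Unary using (Pred; Decidable)
open import Level using (0ℓ)

------------------------------------------------------------------------
-- Finite distributions: lists of weighted outcomes, repetitions allowed

Dist : Set → Set
Dist A = List (ℚ × A)

module _ {A : Set} where

  return : A → Dist A
  return a = [ (1ℚ , a) ]

  scale : ℚ → Dist A → Dist A
  scale q = map (λ (p , a) → (q * p , a))

  fair : Dist A → Dist A → Dist A
  fair d d′ = scale ½ d ++ scale ½ d′

  -- No mass at all on the empty list.
  uniform : List A → Dist A
  uniform []       = []
  uniform (x ∷ xs) = map (λ y → (+ 1 / suc (length xs) , y)) (x ∷ xs)

  Pr : {P : Pred A 0ℓ} → Decidable P → Dist A → ℚ
  Pr P? []            = 0ℚ
  Pr P? ((p , a) ∷ d) = (if does (P? a) then p else 0ℚ) + Pr P? d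

infixl 1 _>>=_
_>>=_ : {A B : Set} → Dist A → (A → Dist B) → Dist B
d >>= f = concatMap (λ (p , a) → scale p (f a)) d

uniformOr : {A B : Set} → Dist B → List A → (A → Dist B) → Dist B
uniformOr d []         f = d
uniformOr d xs@(_ ∷ _) f = uniform xs >>= f

------------------------------------------------------------------------
-- Subsets

subsets : ∀ n → List (Subset n)
subsets zero    = [ Vec.[] ]
subsets (suc n) = map (outside Vec.∷_) (subsets n) ++ map (inside Vec.∷_) (subsets n)

_△_ : ∀ {n} → Subset n → Subset n → Subset n
_△_ = zipWith _xor_

------------------------------------------------------------------------
-- Finite simple bipartite graphs.  Loops are excluded by the sides.

record BipartiteGraph : Set where
  field
    #V #E  : ℕ
    side   : Fin #V → Bool
    endˡ   : Fin #E → Fin #V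
    endʳ   : Fin #E → Fin #V
    side-ˡ : ∀ e → side (endˡ e) ≡ false
    side-ʳ : ∀ e → side (endʳ e) ≡ true
    simple : ∀ {e f} → endˡ e ≡ endˡ f → endʳ e ≡ endʳ f → e ≡ f

  Vertex Edge : Set
  Vertex = Fin #V
  Edge   = Fin #E

  Incident : Vertex → Edge → Set
  Incident v e = endˡ e ≡ v ⊎ endʳ e ≡ v

  incident? : ∀ v → Decidable (Incident v)
  incident? v e = (endˡ e Fin.≟ v) ⊎-dec (endʳ e Fin.≟ v)

  Adjacent : Edge → Edge → Set
  Adjacent e f = e ≢ f × ∃[ v ] (Incident v e × Incident v f)

  adjacent? : ∀ e → Decidable (Adjacent e)
  adjacent? e f = ¬? (e Fin.≟ f) ×-dec Fin.any? (λ v → incident? v e ×-dec incident? v f)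

  #edges : {P : Pred Edge 0ℓ} → Decidable P → ℕ
  #edges P? = length (filter P? (allFin #E))

  Regular : ℕ → Set
  Regular k = ∀ v → #edges (incident? v) ≡ k

  Balanced : Set
  Balanced = length (filter (λ v → side v Bool.≟ false) (allFin #V))
           ≡ length (filter (λ v → side v Bool.≟ true)  (allFin #V))

  -- Subgraphs without isolated vertices, given by their edge sets.

  Subgraph : Set
  Subgraph = Subset #E

  deg : Subgraph → Vertex → ℕ
  deg S v = #edges (λ e → incident? v e ×-dec (e ∈? S))

  -- Linked S i e f: at most i steps between adjacent edges lead from e
  -- to f, every edge after e lying in S.
  Linked : Subgraph → ℕ → Edge → Edge → Set
  Linked S zero    e f = e ≡ f
  Linked S (suc i) e f = Linked S i e f ⊎ (f ∈ S × ∃[ g ] (Linked S i e g × Adjacent g f))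

  linked? : ∀ S i e → Decidable (Linked S i e)
  linked? S zero    e f = e Fin.≟ f
  linked? S (suc i) e f =
    linked? S i e f ⊎-dec
    ((f ∈? S) ×-dec Fin.any? (λ g → linked? S i e g ×-dec adjacent? g f))

  -- A chain without repetitions has fewer than #E steps.
  Connected : Subgraph → Set
  Connected S = Nonempty S × (∀ e f → e ∈ S → f ∈ S → Linked S #E e f)

  connected? : Decidable Connected
  connected? S =
    nonempty? S ×-dec
    Fin.all? (λ e → Fin.all? (λ f → (e ∈? S) →-dec ((f ∈? S) →-dec linked? S #E e f)))

  -- Paths have at least one edge and two distinct end vertices.
  IsPath : Subgraph → Set
  IsPath S = Connected S × (∀ v → deg S v ℕ.≤ 2) × (∃[ v ] deg S v ≡ 1)

  isPath? : Decidable IsPath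
  isPath? S =
    connected? S ×-dec
    (Fin.all? (λ v → deg S v ℕ.≤? 2) ×-dec Fin.any? (λ v → deg S v ℕ.≟ 1))

  IsCycle : Subgraph → Set
  IsCycle S = Connected S × (∀ v → deg S v ≡ 0 ⊎ deg S v ≡ 2)

  isCycle? : Decidable IsCycle
  isCycle? S =
    connected? S ×-dec Fin.all? (λ v → (deg S v ℕ.≟ 0) ⊎-dec (deg S v ℕ.≟ 2))

------------------------------------------------------------------------
-- Edge k-colourings of G and the chain M(G,k)

module M (G : BipartiteGraph) (k : ℕ) where

  open BipartiteGraph G

  Colour : Set
  Colour = Fin k

  -- Arbitrary maps E → {c₁,…,c_k}.
  Assignment : Set
  Assignment = Vec Colour #E

  Proper : Assignment → Set
  Proper A = ∀ e f → Adjacent e f → lookup A e ≢ lookup A f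

  record EdgeColouring : Set where
    constructor colouring
    field
      assignment : Assignment
      proper     : Proper assignment
  open EdgeColouring public

  flip : Colour → Colour → Subgraph → Assignment → Assignment
  flip a b S A = tabulate λ e →
    if does (e ∈? S) then Perm.transpose a b (lookup A e) else lookup A e

  ----------------------------------------------------------------------
  -- Deficiencies

  #at : Assignment → Vertex → Colour → ℕ
  #at A v a = #edges (λ e → incident? v e ×-dec (lookup A e Fin.≟ a))

  -- v has a (+a-b)-deficiency.
  Deficiency : Assignment → Vertex → Colour → Colour → Set
  Deficiency A v a b =
    #at A v a ≡ 2 × #at A v b ≡ 0 × (∀ d → d ≢ a → #at A v d ℕ.≤ 1)

  deficiency? : ∀ A v a → Decidable (Deficiency A v a)
  deficiency? A v a b =
    (#at A v a ℕ.≟ 2) ×-dec ((#at A v b ℕ.≟ 0) ×-dec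
    Fin.all? (λ d → ¬? (d Fin.≟ a) →-dec (#at A v d ℕ.≤? 1)))

  Repeated : Assignment → Vertex → Colour → Set
  Repeated A v a = ∃[ b ] Deficiency A v a b

  repeated? : ∀ A v → Decidable (Repeated A v)
  repeated? A v a = Fin.any? (deficiency? A v a)

  Deficient : Assignment → Vertex → Set
  Deficient A v = ∃[ a ] Repeated A v a

  deficient? : ∀ A → Decidable (Deficient A)
  deficient? A v = Fin.any? (repeated? A v)

  deficientVertices : Assignment → List Vertex
  deficientVertices A = filter (deficient? A) (allFin #V)

  -- One entry at a deficient vertex, none elsewhere.
  repeatedColours : Assignment → Vertex → List Colour
  repeatedColours A v = filter (repeated? A v) (allFin k)

  -- The two edges of the repeated colour at a deficient vertex.
  repeatedEdges : Assignment → Vertex → List Edge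
  repeatedEdges A v =
    filter (λ e → incident? v e ×-dec repeated? A v (lookup A e)) (allFin #E)

  ----------------------------------------------------------------------
  -- Alternating paths and cycles

  HasColour : Assignment → Colour → Colour → Edge → Set
  HasColour A a b e = lookup A e ≡ a ⊎ lookup A e ≡ b

  hasColour? : ∀ A a b → Decidable (HasColour A a b)
  hasColour? A a b e = (lookup A e Fin.≟ a) ⊎-dec (lookup A e Fin.≟ b)

  Coloured : Assignment → Colour → Colour → Subgraph → Set
  Coloured A a b S = ∀ e → e ∈ S → HasColour A a b e

  coloured? : ∀ A a b → Decidable (Coloured A a b)
  coloured? A a b S = Fin.all? (λ e → (e ∈? S) →-dec hasColour? A a b e)

  Alternating : Assignment → Subgraph → Set
  Alternating A S = ∀ e f → e ∈ S → f ∈ S → Adjacent e f → lookup A e ≢ lookup A f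

  alternating? : ∀ A → Decidable (Alternating A)
  alternating? A S = Fin.all? λ e → Fin.all? λ f →
    (e ∈? S) →-dec ((f ∈? S) →-dec (adjacent? e f →-dec ¬? (lookup A e Fin.≟ lookup A f)))

  AlternatingCycle : Assignment → Colour → Colour → Subgraph → Set
  AlternatingCycle A a b S = IsCycle S × Coloured A a b S × Alternating A S

  alternatingCycle? : ∀ A a b → Decidable (AlternatingCycle A a b)
  alternatingCycle? A a b S = isCycle? S ×-dec (coloured? A a b S ×-dec alternating? A S)

  -- Alternating paths starting at v with the edge e.
  AlternatingPath : Assignment → Colour → Colour → Vertex → Edge → Subgraph → Set
  AlternatingPath A a b v e S =
    IsPath S × Coloured A a b S × Alternating A S ×
    (e ∈ S × Incident v e × deg S v ≡ 1)

  alternatingPath? : ∀ A a b v e → Decidable (AlternatingPath A a b v e)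
  alternatingPath? A a b v e S =
    isPath? S ×-dec (coloured? A a b S ×-dec (alternating? A S ×-dec
    ((e ∈? S) ×-dec (incident? v e ×-dec (deg S v ℕ.≟ 1)))))

  MaximalAlternatingPath : Assignment → Colour → Colour → Vertex → Edge → Subgraph → Set
  MaximalAlternatingPath A a b v e S =
    AlternatingPath A a b v e S × ¬ (∃[ T ] (AlternatingPath A a b v e T × S ⊂ T))

  maximalAlternatingPath? : ∀ A a b v e → Decidable (MaximalAlternatingPath A a b v e)
  maximalAlternatingPath? A a b v e S =
    alternatingPath? A a b v e S ×-dec
    ¬? (anySubset? (λ T → alternatingPath? A a b v e T ×-dec (S ⊂? T)))

  ----------------------------------------------------------------------
  -- Ways.  A way records the selected colours and the three consecutive
  -- transformations as the sets of edges on which colours are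
  -- interchanged; vertices selected along the way are not recorded.

  TwoWay : Set
  TwoWay = (Colour × Colour) × Subgraph × Subgraph × Subgraph

  -- Colours ((c , c′) , c″) with c″ distinguished.  The second
  -- transformation (c̃ , F) interchanges c̃ and c″ on F.
  ThreeWay : Set
  ThreeWay = ((Colour × Colour) × Colour) × Subgraph × (Colour × Subgraph) × Subgraph

  data Way : Set where
    idle  : Way
    two   : TwoWay → Way
    three : ThreeWay → Way

  _≟ˢ_ : DecidableEquality Subgraph
  _≟ˢ_ = Vec.≡-dec Bool._≟_

  _⊗_ : {A B : Set} → DecidableEquality A → DecidableEquality B → DecidableEquality (A × B)
  d ⊗ d′ = Product.≡-dec d d′

  _≟ᵃ_ : DecidableEquality Assignment
  _≟ᵃ_ = Vec.≡-dec Fin._≟_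

  _≟ʷ_ : DecidableEquality Way
  idle    ≟ʷ idle    = yes refl
  idle    ≟ʷ two _   = no λ ()
  idle    ≟ʷ three _ = no λ ()
  two _   ≟ʷ idle    = no λ ()
  two w   ≟ʷ two x   = map′ (cong two) (λ { refl → refl })
    (((Fin._≟_ ⊗ Fin._≟_) ⊗ (_≟ˢ_ ⊗ (_≟ˢ_ ⊗ _≟ˢ_))) w x)
  two _   ≟ʷ three _ = no λ ()
  three _ ≟ʷ idle    = no λ ()
  three _ ≟ʷ two _   = no λ ()
  three w ≟ʷ three x = map′ (cong three) (λ { refl → refl })
    ((((Fin._≟_ ⊗ Fin._≟_) ⊗ Fin._≟_) ⊗ (_≟ˢ_ ⊗ ((Fin._≟_ ⊗ _≟ˢ_) ⊗ _≟ˢ_))) w x)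

  ----------------------------------------------------------------------
  -- One step of the chain

  pairs : List (Colour × Colour)
  pairs = filter (λ (a , b) → a Fin.<? b) (cartesianProduct (allFin k) (allFin k))

  triples : List (Colour × Colour × Colour)
  triples = filter (λ (a , b , d) → (a Fin.<? b) ×-dec (b Fin.<? d))
    (cartesianProduct (allFin k) (cartesianProduct (allFin k) (allFin k)))

  distinguish : Colour × Colour × Colour → List ((Colour × Colour) × Colour)
  distinguish (a , b , d) = ((a , b) , d) ∷ ((a , d) , b) ∷ ((b , d) , a) ∷ []

  -- Connected subgraphs of H with at least one edge; entire cycles of H
  -- are among them.
  connectedSubgraphs : Assignment → Colour → Colour → List Subgraph
  connectedSubgraphs A c c′ =
    filter (λ S → connected? S ×-dec coloured? A c c′ S) (subsets #E)

  evenPaths : Assignment → Colour → Colour → List Subgraph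
  evenPaths A c c′ =
    filter (λ S → (isPath? S ×-dec (2 ∣? ∣ S ∣)) ×-dec coloured? A c c′ S) (subsets #E)

  -- Eliminates the deficiency at each of the given vertices that is
  -- deficient when its turn comes; the result is the set of edges on which
  -- c and c′ have been interchanged in total.  In the chain, the deficiencies
  -- are of types (+c-c′) and (+c′-c), and the alternating path from one
  -- deficient vertex ends at the other, so one elimination removes both and
  -- the order of the vertices is immaterial.
  eliminateAt : Colour → Colour → List Vertex → Assignment → Dist Subgraph
  eliminateAt c c′ []       A = return ⊥
  eliminateAt c c′ (v ∷ vs) A =
    if does (deficient? A v)
    then (uniform (repeatedEdges A v) >>= λ e →
          uniform (filter (maximalAlternatingPath? A c c′ v e) (subsets #E)) >>= λ S →
          eliminateAt c c′ vs (flip c c′ S A) >>= λ T →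
          return (S △ T))
    else eliminateAt c c′ vs A

  eliminate : Colour → Colour → Assignment → Dist Subgraph
  eliminate c c′ = eliminateAt c c′ (allFin #V)

  perturb₂ : Colour → Colour → Assignment → Dist Subgraph
  perturb₂ c c′ A with deficientVertices A
  ... | []         = fair (uniform (filter (hasColour? A c c′) (allFin #E)) >>= λ e →
                           return ⁅ e ⁆)
                          (return ⊥)
  ... | vs@(_ ∷ _) = uniform vs >>= λ v →
                     uniform (repeatedEdges A v) >>= λ e →
                     return ⁅ e ⁆

  -- The lists of cycles have exactly one entry each.
  perturb₃ : Colour → Colour → Colour → Assignment → Dist (Colour × Subgraph)
  perturb₃ c c′ c″ A with deficientVertices A
  ... | []         = uniform (allFin #V) >>= λ v →
                     uniform (filter (λ e → incident? v e ×-dec (lookup A e Fin.≟ c″))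
                                     (allFin #E)) >>= λ e →
                     uniform (filter (λ f → incident? v f ×-dec hasColour? A c c′ f)
                                     (allFin #E)) >>= λ f →
                     uniform (filter (λ F → alternatingCycle? A c″ (lookup A f) F ×-dec
                                            ((e ∈? F) ×-dec (f ∈? F)))
                                     (subsets #E)) >>= λ F →
                     return (lookup A f , F)
  ... | vs@(_ ∷ _) = uniform vs >>= λ v →
                     uniform (repeatedColours A v) >>= λ c̃ →
                     uniform (filter (λ F → alternatingCycle? A c̃ c″ F ×-dec
                                            Fin.any? (λ e → incident? v e ×-dec (e ∈? F)))
                                     (subsets #E)) >>= λ F →
                     return (c̃ , F)

  apply : Assignment → Way → Assignment
  apply C idle = C
  apply C (two ((c , c′) , S₁ , F , S₂)) =
    flip c c′ S₂ (flip c c′ F (flip c c′ S₁ C))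
  apply C (three (((c , c′) , c″) , S₁ , (c̃ , F) , S₂)) =
    flip c c′ S₂ (flip c̃ c″ F (flip c c′ S₁ C))

  twoColours : Assignment → Colour × Colour → Dist Way
  twoColours C (c , c′) =
    fair (return ⊥) (uniform (connectedSubgraphs C c c′)) >>= λ S₁ →
    perturb₂ c c′ (flip c c′ S₁ C) >>= λ F →
    eliminate c c′ (flip c c′ F (flip c c′ S₁ C)) >>= λ S₂ →
    return (two ((c , c′) , S₁ , F , S₂))

  threeColours : Assignment → (Colour × Colour) × Colour → Dist Way
  threeColours C ((c , c′) , c″) =
    fair (return ⊥) (uniform (evenPaths C c c′)) >>= λ S₁ →
    perturb₃ c c′ c″ (flip c c′ S₁ C) >>= λ (c̃ , F) →
    eliminate c c′ (flip c̃ c″ F (flip c c′ S₁ C)) >>= λ S₂ →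
    return (three (((c , c′) , c″) , S₁ , (c̃ , F) , S₂))

  -- With fewer than two (three) colours there is no pair (triple) to
  -- select, and nothing is done.
  draw : Assignment → Dist Way
  draw C =
    scale ½         (return idle) ++
    scale (+ 1 / 4) (uniformOr (return idle) pairs (twoColours C)) ++
    scale (+ 1 / 4) (uniformOr (return idle) triples λ t →
                     uniform (distinguish t) >>= threeColours C)

  propose : Assignment → Dist (Assignment × Way)
  propose C = draw C >>= λ w → return (apply C w , w)

  ----------------------------------------------------------------------
  -- Diameter

  -- P(C₂ | C₁) > 0.
  Transition : EdgeColouring → EdgeColouring → Set
  Transition C₁ C₂ =
    Positive (Pr (λ x → proj₁ x ≟ᵃ assignment C₂) (propose (assignment C₁)))

  Transitions : ℕ → EdgeColouring → EdgeColouring → Set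
  Transitions zero    C₁ C₂ = assignment C₁ ≡ assignment C₂
  Transitions (suc d) C₁ C₂ = ∃[ C ] (Transition C₁ C × Transitions d C C₂)

  Distance : EdgeColouring → EdgeColouring → ℕ → Set
  Distance C₁ C₂ d =
    Transitions d C₁ C₂ × (∀ d′ → Transitions d′ C₁ C₂ → d ℕ.≤ d′)

  Diameter≤ : ℕ → Set
  Diameter≤ D = ∀ C₁ C₂ → ∃[ d ] (Distance C₁ C₂ d × d ℕ.≤ D)

  ----------------------------------------------------------------------
  -- Metropolis–Hastings with the uniform target distribution

  P⟨_,_∣_⟩ : EdgeColouring → Way → EdgeColouring → ℚ
  P⟨ C₂ , w ∣ C₁ ⟩ =
    Pr (λ x → (_≟ᵃ_ ⊗ _≟ʷ_) x (assignment C₂ , w)) (propose (assignment C₁))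

  -- The inverse way selects the same colours and undoes the transformations
  -- in reverse order; each of them is its own inverse.  The one exception:
  -- flipping an entire cycle of H leaves no deficiency and hence never occurs
  -- as an elimination, so it has to be undone in the first step again.  It
  -- commutes with the other two flips, which use the same two colours.
  inverse : Way → Way
  inverse idle = idle
  inverse (two (cs , S₁ , F , S₂)) =
    if does (isCycle? S₁) then two (cs , S₁ , F , S₂) else two (cs , S₂ , F , S₁)
  inverse (three (cs , S₁ , F , S₂)) = three (cs , S₂ , F , S₁)

  acceptance : ∀ C₁ C₂ w → .{{Positive P⟨ C₂ , w ∣ C₁ ⟩}} → ℚ
  acceptance C₁ C₂ w =
    1ℚ ⊓ (_÷_ P⟨ C₁ , inverse w ∣ C₂ ⟩ P⟨ C₂ , w ∣ C₁ ⟩ {{pos⇒nonZero P⟨ C₂ , w ∣ C₁ ⟩}})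

  InverseAcceptance≤ : ℚ → Set
  InverseAcceptance≤ B = ∀ C₁ C₂ w → {{_ : Positive P⟨ C₂ , w ∣ C₁ ⟩}} →
    Σ[ nz ∈ NonZero (acceptance C₁ C₂ w) ] (1/ acceptance C₁ C₂ w) {{nz}} ≤ B

{-# OPTIONS --safe #-}

-- Fix two colours c and c′.  In every assignment met while these colours are
-- changed, each vertex has exactly two edges of colour c or c′, and it is
-- deficient if and only if these two have the same colour.  A walk that leaves
-- a deficient vertex and alternates between c and c′ traverses edges of either
-- colour in one direction only, since the graph is bipartite; hence it never
-- meets itself and stops at another deficient vertex.  Local comparison of
-- edges at a common vertex then shows that maximal alternating paths are
-- determined by their first edge, so that an elimination undoes the flip of
-- any given path with probability 1/2.
--
-- Diameter: the colour classes are made equal to those of the target one after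
-- the other.  If an edge should have colour t but has colour o, recolour it;
-- now both of its ends repeat t.  At one of them recolour the other edge of
-- colour t to o, which moves the deficiency to a vertex x that repeats o.  The
-- target prescribes t for some edge at x; a swap of its colour with o along a
-- cycle gives it colour o, and recolouring it corrects a further edge.  So
-- three transitions are spent on each corrected edge.
--
-- Acceptance: a connected subgraph of the two-coloured edges is determined by
-- two vertices and a colour, so there are at most 2|V|² of them, and there are
-- at most 2|V| edges of two given colours.  All other factors of the ratio are
-- bounded by constants, and 8|V|² ≤ 16|V|(|V|-1) for |V| ≥ 2.

module Submission where

open import Defs
open import Data.Bool.Base using (true; false; Bool; not; if_then_else_)
import Data.Bool.Properties as Bool
open import Data.Empty using (⊥-elim)
open import Data.Fin.Base using (Fin; zero; suc; toℕ; fromℕ<)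
import Data.Fin.Base as Fin
import Data.Fin.Permutation.Components as Perm
import Data.Fin.Properties as Fin
open import Data.Fin.Subset using (Subset; _∈_; _∉_; ⊥; ⁅_⁆; ∣_∣; inside; outside; _⊂_)
open import Data.Fin.Subset.Properties using (_∈?_)
import Data.Fin.Subset.Properties as Subset
open import Data.Integer.Base using (+_)
import Data.Integer.Base as ℤ
import Data.Integer.Properties as ℤ
open import Data.List.Base using (List; []; _∷_; _++_; map; length; filter; allFin; tabulate; cartesianProduct)
import Data.List.Membership.DecPropositional as DecMembership
open import Data.List.Membership.Propositional using () renaming (_∈_ to _∈ˡ_; _∉_ to _∉ˡ_)
import Data.List.Membership.Propositional.Properties as ∈ˡ
import Data.List.Properties as List
open import Data.List.Relation.Unary.All as All using (All)
import Data.List.Relation.Unary.All.Properties as All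
open import Data.List.Relation.Unary.AllPairs using (AllPairs)
open import Data.List.Relation.Unary.Any as Any using (here; there)
open import Data.List.Relation.Unary.Unique.Propositional using (Unique)
import Data.List.Relation.Unary.Unique.Propositional.Properties as Unique
open import Data.Nat.Base using (ℕ; zero; suc; _*_; _∸_; NonZero)
import Data.Nat.Base as ℕ
open import Data.Nat.Divisibility using (_∣_; divides; ∣m+n∣m⇒∣n; ∣1⇒≡1; _∣?_)
import Data.Nat.Properties as ℕ
open import Data.Product.Base using (_×_; _,_; proj₁; proj₂; ∃; ∃-syntax; Σ-syntax; map₂)
open import Data.Rational.Base using (ℚ; 0ℚ; 1ℚ; ½; _/_; Positive; toℚᵘ) renaming (_+_ to _+ℚ_; _*_ to _*ℚ_; _≤_ to _≤ℚ_; NonZero to NonZeroℚ)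
import Data.Rational.Base as ℚ
import Data.Rational.Properties as ℚ
import Data.Rational.Unnormalised.Base as ℚᵘ
import Data.Rational.Unnormalised.Properties as ℚᵘ
open import Data.Sum.Base using (_⊎_; inj₁; inj₂; swap; [_,_]′)
open import Data.Vec.Base using (lookup; Vec)
import Data.Vec.Base as Vec
import Data.Vec.Properties as Vec
open import Function.Base using (_∘_; id; case_of_)
open import Level using (0ℓ)
open import Relation.Binary.Definitions using (tri<; tri≈; tri>)
open import Relation.Binary.PropositionalEquality using (_≡_; _≢_; refl; sym; trans; cong; cong₂; subst; module ≡-Reasoning)
open import Relation.Nullary.Decidable using (Dec; yes; no; does; dec-true; dec-false; ¬?; _×-dec_; _⊎-dec_; map′; _→-dec_)
open import Relation.Nullary.Negation using (¬_; contradiction)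
open import Relation.Unary using (Pred; Decidable)

-- Expectations

-- The chain moves between proper colourings, the recolouring argument between almost colourings.
-- Both bounds rest on one remedy: the path flipped by an elimination can be drawn again as the
-- first flip of the next transition, which restores the almost colouring exactly. With two colours
-- any connected subgraph can be drawn, with three only even paths; so there the deficient vertices
-- must lie on one side and repeat different colours, which also makes the swap with the third
-- colour run along a closed cycle. In the diameter argument one of the two deficient vertices stays
-- put for a whole round, every correction lowers the number of wrong edges, and the round ends when
-- one edge joins both vertices. For the ratio, upper bounds use that a way determines its first
-- flip, and lower bounds multiply along the steps. With two colours the list of subgraphs is the
-- same at both ends of a way, so its length cancels where both directions draw from it; elsewhere
-- the forward probability is merely estimated by a factor 1/2 that the inverse shares. The constant
-- 8 is 2 from the count of subgraphs times 4 from two binary choices.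

⟦_⟧ : ℕ → ℚ
⟦ m ⟧ = + m / 1

0≤⟦⟧ : ∀ m → 0ℚ ≤ℚ ⟦ m ⟧
0≤⟦⟧ m = ℚ.nonNegative⁻¹ ⟦ m ⟧ {{ℚ.normalize-nonNeg m 1}}

⟦⟧-* : ∀ m n → ⟦ m * n ⟧ ≡ ⟦ m ⟧ *ℚ ⟦ n ⟧
⟦⟧-* m n = ℚ.toℚᵘ-injective (begin
  toℚᵘ ⟦ m * n ⟧                                      ≈⟨ ℚ.toℚᵘ-fromℚᵘ (ℚᵘ.mkℚᵘ (+ (m * n)) 0) ⟩
  ℚᵘ.mkℚᵘ (+ (m * n)) 0                               ≈⟨ ℚᵘ.*≡* (cong (ℤ._* + 1) (ℤ.pos-* m n)) ⟩
  ℚᵘ.mkℚᵘ (+ m) 0 ℚᵘ.* ℚᵘ.mkℚᵘ (+ n) 0                ≈⟨ ℚᵘ.*-cong (ℚ.toℚᵘ-fromℚᵘ (ℚᵘ.mkℚᵘ (+ m) 0))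
      (ℚ.toℚᵘ-fromℚᵘ (ℚᵘ.mkℚᵘ (+ n) 0)) ⟨
  toℚᵘ ⟦ m ⟧ ℚᵘ.* toℚᵘ ⟦ n ⟧                          ≈⟨ ℚ.toℚᵘ-homo-* ⟦ m ⟧ ⟦ n ⟧ ⟨
  toℚᵘ (⟦ m ⟧ *ℚ ⟦ n ⟧)                               ∎)
  where open ℚᵘ.≃-Reasoning

⟦⟧-mono : ∀ {m n} → m ℕ.≤ n → ⟦ m ⟧ ≤ℚ ⟦ n ⟧
⟦⟧-mono {m} {n} m≤n = ℚ.toℚᵘ-cancel-≤ (begin
  toℚᵘ ⟦ m ⟧       ≃⟨ ℚ.toℚᵘ-fromℚᵘ (ℚᵘ.mkℚᵘ (+ m) 0) ⟩
  ℚᵘ.mkℚᵘ (+ m) 0  ≤⟨ ℚᵘ.*≤* (ℤ.*-monoʳ-≤-nonNeg (+ 1) (ℤ.+≤+ m≤n)) ⟩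
  ℚᵘ.mkℚᵘ (+ n) 0  ≃⟨ ℚ.toℚᵘ-fromℚᵘ (ℚᵘ.mkℚᵘ (+ n) 0) ⟨
  toℚᵘ ⟦ n ⟧       ∎)
  where open ℚᵘ.≤-Reasoning

⟦⟧-inverse : ∀ n → ⟦ suc n ⟧ *ℚ (+ 1 / suc n) ≡ 1ℚ
⟦⟧-inverse n = ℚ.toℚᵘ-injective (begin
  toℚᵘ (⟦ suc n ⟧ *ℚ (+ 1 / suc n))             ≈⟨ ℚ.toℚᵘ-homo-* ⟦ suc n ⟧ (+ 1 / suc n) ⟩
  toℚᵘ ⟦ suc n ⟧ ℚᵘ.* toℚᵘ (+ 1 / suc n)        ≈⟨ ℚᵘ.*-cong (ℚ.toℚᵘ-fromℚᵘ (ℚᵘ.mkℚᵘ (+ suc n) 0))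
      (ℚ.toℚᵘ-fromℚᵘ (ℚᵘ.mkℚᵘ (+ 1) n)) ⟩
  ℚᵘ.mkℚᵘ (+ suc n) 0 ℚᵘ.* ℚᵘ.mkℚᵘ (+ 1)
      n      ≈⟨ ℚᵘ.*≡* (cong +_ (trans (ℕ.*-identityʳ _) (trans (ℕ.*-identityʳ _)
      (sym (trans (ℕ.*-identityˡ _) (ℕ.*-identityˡ _)))))) ⟩
  ℚᵘ.1ℚᵘ                                        ∎)
  where open ℚᵘ.≃-Reasoning

*ℚ-monoˡ : ∀ {p q r} → 0ℚ ≤ℚ p → q ≤ℚ r → p *ℚ q ≤ℚ p *ℚ r
*ℚ-monoˡ {p} 0≤p = ℚ.*-monoˡ-≤-nonNeg p {{ℚ.nonNegative 0≤p}}

*ℚ-monoʳ : ∀ {p q r} → 0ℚ ≤ℚ p → q ≤ℚ r → q *ℚ p ≤ℚ r *ℚ p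
*ℚ-monoʳ {p} 0≤p = ℚ.*-monoʳ-≤-nonNeg p {{ℚ.nonNegative 0≤p}}

0≤*ℚ : ∀ {p q} → 0ℚ ≤ℚ p → 0ℚ ≤ℚ q → 0ℚ ≤ℚ p *ℚ q
0≤*ℚ {p} {q} 0≤p 0≤q = subst (_≤ℚ p *ℚ q) (ℚ.*-zeroʳ p) (*ℚ-monoˡ 0≤p 0≤q)

p≤p+q : ∀ p {q} → 0ℚ ≤ℚ q → p ≤ℚ p +ℚ q
p≤p+q p {q} 0≤q = subst (_≤ℚ p +ℚ q) (ℚ.+-identityʳ p) (ℚ.+-mono-≤ (ℚ.≤-refl {p}) 0≤q)

q≤p+q : ∀ {p} q → 0ℚ ≤ℚ p → q ≤ℚ p +ℚ q
q≤p+q {p} q 0≤p = subst (_≤ℚ p +ℚ q) (ℚ.+-identityˡ q) (ℚ.+-mono-≤ 0≤p (ℚ.≤-refl {q}))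

0≤½ : 0ℚ ≤ℚ ½
0≤½ = ℚ.nonNegative⁻¹ ½

0≤¼ : 0ℚ ≤ℚ (+ 1 / 4)
0≤¼ = ℚ.nonNegative⁻¹ (+ 1 / 4)

0≤1 : 0ℚ ≤ℚ 1ℚ
0≤1 = ℚ.nonNegative⁻¹ 1ℚ

0≤1/ : ∀ n → 0ℚ ≤ℚ (+ 1 / suc n)
0≤1/ n = ℚ.nonNegative⁻¹ (+ 1 / suc n) {{ℚ.normalize-nonNeg 1 (suc n)}}

-- Masses are expressed as expectations of indicators: `>>=` then becomes nesting of expectations,
-- and outcomes that occur several times in a list need not be collected.
E : {A : Set} → Dist A → (A → ℚ) → ℚ
E []            φ = 0ℚ
E ((p , a) ∷ d) φ = p *ℚ φ a +ℚ E d φ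

module _ {A : Set} where

  E-++ : ∀ (d d′ : Dist A) φ → E (d ++ d′) φ ≡ E d φ +ℚ E d′ φ
  E-++ []            d′ φ = sym (ℚ.+-identityˡ _)
  E-++ ((p , a) ∷ d) d′ φ = trans (cong (p *ℚ φ a +ℚ_) (E-++ d d′ φ)) (sym (ℚ.+-assoc (p *ℚ φ a) _ _))

  E-scale : ∀ q (d : Dist A) φ → E (scale q d) φ ≡ q *ℚ E d φ
  E-scale q []            φ = sym (ℚ.*-zeroʳ q)
  E-scale q ((p , a) ∷ d) φ = trans (cong₂ _+ℚ_ (ℚ.*-assoc q p (φ a)) (E-scale q d φ)) (sym (ℚ.*-distribˡ-+ q _ _))

  E-return : ∀ (a : A) φ → E (return a) φ ≡ φ a
  E-return a φ = trans (ℚ.+-identityʳ _) (ℚ.*-identityˡ _)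

  E-fair : ∀ (d d′ : Dist A) φ → E (fair d d′) φ ≡ ½ *ℚ E d φ +ℚ ½ *ℚ E d′ φ
  E-fair d d′ φ = trans (E-++ (scale ½ d) _ φ) (cong₂ _+ℚ_ (E-scale ½ d φ) (E-scale ½ d′ φ))

  E-cong : ∀ (d : Dist A) {φ ψ} → (∀ a → φ a ≡ ψ a) → E d φ ≡ E d ψ
  E-cong []            eq = refl
  E-cong ((p , a) ∷ d) eq = cong₂ (λ x y → p *ℚ x +ℚ y) (eq a) (E-cong d eq)

E->>= : {A B : Set} (d : Dist A) (f : A → Dist B) (φ : B → ℚ) →
        E (d >>= f) φ ≡ E d (λ a → E (f a) φ)
E->>= []            f φ = refl
E->>= ((p , a) ∷ d) f φ = trans (E-++ (scale p (f a)) _ φ) (cong₂ _+ℚ_ (E-scale p (f a) φ) (E->>= d f φ))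

E-return> : {A B : Set} (d : Dist A) (f : A → B) (φ : B → ℚ) →
            E (d >>= λ a → return (f a)) φ ≡ E d (φ ∘ f)
E-return> d f φ = trans (E->>= d (λ a → return (f a)) φ) (E-cong d (λ a → E-return (f a) φ))

-- Nonnegative weights and support

Nonneg : {A : Set} → Dist A → Set
Nonneg = All (λ x → 0ℚ ≤ℚ proj₁ x)

-- Every listed outcome counts, whatever its weight. This may exceed the true support but suffices
-- for `E-mono` and `E-vanish`.
Supp : {A : Set} → Dist A → A → Set
Supp d a = a ∈ˡ map proj₂ d

module _ {A : Set} where

  nonneg-return : (a : A) → Nonneg (return a)
  nonneg-return a = 0≤1 All.∷ All.[]

  nonneg-scale : ∀ {q} {d : Dist A} → 0ℚ ≤ℚ q → Nonneg d → Nonneg (scale q d)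
  nonneg-scale 0≤q nn = All.map⁺ (All.map (0≤*ℚ 0≤q) nn)

  nonneg-fair : {d d′ : Dist A} → Nonneg d → Nonneg d′ → Nonneg (fair d d′)
  nonneg-fair nn nn′ = All.++⁺ (nonneg-scale 0≤½ nn) (nonneg-scale 0≤½ nn′)

  nonneg-uniform : (xs : List A) → Nonneg (uniform xs)
  nonneg-uniform []       = All.[]
  nonneg-uniform (x ∷ xs) = All.map⁺ (All.universal (λ _ → 0≤1/ (length xs)) (x ∷ xs))

  nonneg->>= : {B : Set} {d : Dist B} {f : B → Dist A} → Nonneg d → (∀ b → Nonneg (f b)) → Nonneg (d >>= f)
  nonneg->>= All.[]         nnf = All.[]
  nonneg->>= (0≤p All.∷ nn) nnf = All.++⁺ (nonneg-scale 0≤p (nnf _)) (nonneg->>= nn nnf)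

  E-mono : ∀ {d : Dist A} {φ ψ} → Nonneg d → (∀ a → Supp d a → φ a ≤ℚ ψ a) → E d φ ≤ℚ E d ψ
  E-mono All.[]         le = ℚ.≤-refl
  E-mono (0≤p All.∷ nn) le =
    ℚ.+-mono-≤ (*ℚ-monoˡ 0≤p (le _ (here refl))) (E-mono nn (λ a a∈ → le a (there a∈)))

  E-nonneg : ∀ {d : Dist A} {φ} → Nonneg d → (∀ a → 0ℚ ≤ℚ φ a) → 0ℚ ≤ℚ E d φ
  E-nonneg All.[]         0≤φ = ℚ.≤-refl
  E-nonneg (0≤p All.∷ nn) 0≤φ = ℚ.+-mono-≤ (0≤*ℚ 0≤p (0≤φ _)) (E-nonneg nn 0≤φ)

  E-vanish : ∀ (d : Dist A) {φ} → (∀ a → Supp d a → φ a ≡ 0ℚ) → E d φ ≡ 0ℚ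
  E-vanish []            z = refl
  E-vanish ((p , a) ∷ d) z =
    cong₂ _+ℚ_ (trans (cong (p *ℚ_) (z a (here refl))) (ℚ.*-zeroʳ p)) (E-vanish d (λ b b∈ → z b (there b∈)))

  E-*ˡ : ∀ (d : Dist A) q φ → E d (λ a → q *ℚ φ a) ≡ q *ℚ E d φ
  E-*ˡ []            q φ = sym (ℚ.*-zeroʳ q)
  E-*ˡ ((p , a) ∷ d) q φ = trans (cong₂ _+ℚ_ lemma (E-*ˡ d q φ)) (sym (ℚ.*-distribˡ-+ q _ _))
    where
    lemma : p *ℚ (q *ℚ φ a) ≡ q *ℚ (p *ℚ φ a)
    lemma = trans (sym (ℚ.*-assoc p q _)) (trans (cong (_*ℚ φ a) (ℚ.*-comm p q)) (ℚ.*-assoc q p _))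

  map-weights : ∀ (f : ℚ → ℚ) (d : Dist A) → map proj₂ (map (λ x → (f (proj₁ x) , proj₂ x)) d) ≡ map proj₂ d
  map-weights f []      = refl
  map-weights f (x ∷ d) = cong (proj₂ x ∷_) (map-weights f d)

  supp-scale : ∀ {q} {d : Dist A} {a} → Supp (scale q d) a → Supp d a
  supp-scale {q} {d} = subst (_ ∈ˡ_) (map-weights (q *ℚ_) d)

  supp-++ : ∀ (d : Dist A) {d′ a} → Supp (d ++ d′) a → Supp d a ⊎ Supp d′ a
  supp-++ d {d′} {a} a∈ = ∈ˡ.∈-++⁻ (map proj₂ d) (subst (a ∈ˡ_) (List.map-++ proj₂ d d′) a∈)

  supp-return : ∀ {a b : A} → Supp (return a) b → b ≡ a
  supp-return (here eq) = eq

  supp-fair : ∀ {d d′ : Dist A} {a} → Supp (fair d d′) a → Supp d a ⊎ Supp d′ a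
  supp-fair {d} a∈ with supp-++ (scale ½ d) a∈
  ... | inj₁ l = inj₁ (supp-scale {½} {d} l)
  ... | inj₂ r = inj₂ (supp-scale {½} r)

  supp-uniform : ∀ {xs : List A} {a} → Supp (uniform xs) a → a ∈ˡ xs
  supp-uniform {xs = x ∷ xs} {a} = subst (a ∈ˡ_) (lemma (x ∷ xs))
    where
    lemma : ∀ {q} (ys : List A) → map proj₂ (map (λ y → (q , y)) ys) ≡ ys
    lemma []       = refl
    lemma (y ∷ ys) = cong (y ∷_) (lemma ys)

supp->>= : {A B : Set} {d : Dist A} {f : A → Dist B} {b : B} →
           Supp (d >>= f) b → ∃[ a ] (Supp d a × Supp (f a) b)
supp->>= {d = (p , a) ∷ d} {f} b∈ with supp-++ (scale p (f a)) b∈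
... | inj₁ l = a , here refl , supp-scale {q = p} {d = f a} l
... | inj₂ r with supp->>= {d = d} r
...   | a′ , a′∈ , b∈′ = a′ , there a′∈ , b∈′

-- Lower bounds of the mass of a single outcome

record Low {A : Set} (d : Dist A) (a : A) (m : ℕ) : Set where
  constructor low
  field
    -- The mass of `a` is at least 1 / `m`. Testing against all nonnegative `φ`, not just the
    -- indicator of `a`, lets such bounds be multiplied along `>>=`.
    bound : ∀ φ → (∀ x → 0ℚ ≤ℚ φ x) → φ a ≤ℚ ⟦ m ⟧ *ℚ E d φ
open Low public

E-uniform : {A : Set} (x : A) (xs : List A) (φ : A → ℚ) → E (uniform (x ∷ xs)) φ ≡
            (+ 1 / suc (length xs)) *ℚ E (map (λ y → (1ℚ , y)) (x ∷ xs)) φ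
E-uniform {A} x xs φ = lemma (x ∷ xs)
  where
  q = + 1 / suc (length xs)
  lemma : (ys : List A) → E (map (λ y → (q , y)) ys) φ ≡ q *ℚ E (map (λ y → (1ℚ , y)) ys) φ
  lemma []       = sym (ℚ.*-zeroʳ q)
  lemma (y ∷ ys) = trans (cong₂ _+ℚ_ (cong (q *ℚ_) (sym (ℚ.*-identityˡ (φ y)))) (lemma ys)) (sym (ℚ.*-distribˡ-+ q _ _))

module _ {A : Set} where

  low-return : ∀ (a : A) → Low (return a) a 1
  low-return a = low λ φ 0≤φ → ℚ.≤-reflexive (sym (trans (ℚ.*-identityˡ _) (E-return a φ)))

  low->>= : ∀ {B : Set} {d : Dist B} {f : B → Dist A} {b a m n} → (∀ b → Nonneg (f b)) →
            Low d b m → Low (f b) a n → Low (d >>= f) a (m * n)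
  low->>= {d = d} {f} {b} {a} {m} {n} nnf l l′ = low λ φ 0≤φ → begin
    φ a                                      ≤⟨ bound l′ φ 0≤φ ⟩
    -- The bound for `d` is applied to the function that continues with `f` and takes the
    -- expectation there.
    ⟦ n ⟧ *ℚ E (f b) φ                       ≤⟨ *ℚ-monoˡ (0≤⟦⟧ n) (bound l (λ b → E (f b) φ)
        (λ b → E-nonneg (nnf b) 0≤φ)) ⟩
    ⟦ n ⟧ *ℚ (⟦ m ⟧ *ℚ E d (λ b → E (f b) φ)) ≡⟨ ℚ.*-assoc ⟦ n ⟧ ⟦ m ⟧ _ ⟨
    ⟦ n ⟧ *ℚ ⟦ m ⟧ *ℚ E d (λ b → E (f b) φ)  ≡⟨ cong₂ _*ℚ_ (trans (ℚ.*-comm ⟦ n ⟧ ⟦ m ⟧) (sym (⟦⟧-* m n)))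
        (sym (E->>= d f φ)) ⟩
    ⟦ m * n ⟧ *ℚ E (d >>= f) φ               ∎
    where open ℚ.≤-Reasoning

  E-weight : ∀ {d : Dist A} {φ p a} → Nonneg d → (∀ x → 0ℚ ≤ℚ φ x) → (p , a) ∈ˡ d → p *ℚ φ a ≤ℚ E d φ
  E-weight {φ = φ} {p} {a} (_ All.∷ nn) 0≤φ (here refl) =
    p≤p+q (p *ℚ φ a) (E-nonneg nn 0≤φ)
  E-weight {φ = φ} {p} {a} (0≤q All.∷ nn) 0≤φ (there a∈) =
    ℚ.≤-trans (E-weight nn 0≤φ a∈) (q≤p+q _ (0≤*ℚ 0≤q (0≤φ _)))

  uniform-weight : ∀ {y : A} {x xs} {φ} → y ∈ˡ x ∷ xs → (∀ x → 0ℚ ≤ℚ φ x) →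
                   (+ 1 / suc (length xs)) *ℚ φ y ≤ℚ E (uniform (x ∷ xs)) φ
  uniform-weight {y} {x} {xs} y∈ 0≤φ = E-weight (nonneg-uniform (x ∷ xs)) 0≤φ (∈ˡ.∈-map⁺ _ y∈)

  low-uniform : ∀ {xs} {a : A} → a ∈ˡ xs → Low (uniform xs) a (length xs)
  low-uniform {x ∷ xs} {a} a∈ = low λ φ 0≤φ → begin
    φ a                                                    ≡⟨ ℚ.*-identityˡ (φ a) ⟨
    1ℚ *ℚ φ a                                              ≡⟨ cong (_*ℚ φ a) (⟦⟧-inverse (length xs)) ⟨
    ⟦ suc (length xs) ⟧ *ℚ (+ 1 / suc (length xs)) *ℚ φ a  ≡⟨ ℚ.*-assoc ⟦ suc (length xs) ⟧
        (+ 1 / suc (length xs)) (φ a) ⟩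
    ⟦ suc (length xs) ⟧ *ℚ ((+ 1 / suc (length xs)) *ℚ φ a) ≤⟨ *ℚ-monoˡ (0≤⟦⟧ (suc (length xs)))
        (uniform-weight a∈ 0≤φ) ⟩
    ⟦ suc (length xs) ⟧ *ℚ E (uniform (x ∷ xs)) φ          ∎
    where open ℚ.≤-Reasoning

  low-scale : ∀ {q} {d : Dist A} {a m} n → ⟦ n ⟧ *ℚ q ≡ 1ℚ → Low d a m → Low (scale q d) a (m * n)
  low-scale {q} {d} {a} {m} n nq l = low λ φ 0≤φ → begin
    φ a                                   ≤⟨ bound l φ 0≤φ ⟩
    ⟦ m ⟧ *ℚ E d φ                        ≡⟨ cong (⟦ m ⟧ *ℚ_) (ℚ.*-identityˡ (E d φ)) ⟨
    ⟦ m ⟧ *ℚ (1ℚ *ℚ E d φ)                ≡⟨ cong (λ x → ⟦ m ⟧ *ℚ (x *ℚ E d φ)) nq ⟨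
    ⟦ m ⟧ *ℚ (⟦ n ⟧ *ℚ q *ℚ E d φ)        ≡⟨ cong (⟦ m ⟧ *ℚ_) (ℚ.*-assoc ⟦ n ⟧ q _) ⟩
    ⟦ m ⟧ *ℚ (⟦ n ⟧ *ℚ (q *ℚ E d φ))      ≡⟨ ℚ.*-assoc ⟦ m ⟧ ⟦ n ⟧ _ ⟨
    ⟦ m ⟧ *ℚ ⟦ n ⟧ *ℚ (q *ℚ E d φ)        ≡⟨ cong₂ _*ℚ_ (⟦⟧-* m n) (E-scale q d φ) ⟨
    ⟦ m * n ⟧ *ℚ E (scale q d) φ          ∎
    where open ℚ.≤-Reasoning

  low-++ˡ : ∀ {d d′ : Dist A} {a m} → Nonneg d′ → Low d a m → Low (d ++ d′) a m
  low-++ˡ {d} {d′} {a} {m} nn l = low λ φ 0≤φ → ℚ.≤-trans (bound l φ 0≤φ) (*ℚ-monoˡ (0≤⟦⟧ m)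
    (subst (E d φ ≤ℚ_) (sym (E-++ d d′ φ)) (p≤p+q (E d φ) (E-nonneg nn 0≤φ))))

  low-++ʳ : ∀ {d d′ : Dist A} {a m} → Nonneg d → Low d′ a m → Low (d ++ d′) a m
  low-++ʳ {d} {d′} {a} {m} nn l = low λ φ 0≤φ → ℚ.≤-trans (bound l φ 0≤φ) (*ℚ-monoˡ (0≤⟦⟧ m)
    (subst (E d′ φ ≤ℚ_) (sym (E-++ d d′ φ)) (q≤p+q (E d′ φ) (E-nonneg nn 0≤φ))))

  low-fairˡ : ∀ {d d′ : Dist A} {a m} → Nonneg d′ → Low d a m → Low (fair d d′) a (m * 2)
  low-fairˡ {d} {d′} {a = a} {m} nn l = low-++ˡ {d = scale ½ d} {scale ½ d′} {m = m * 2} (nonneg-scale 0≤½ nn)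
      (low-scale {½} {d} {a} {m} 2 refl l)

  low-fairʳ : ∀ {d d′ : Dist A} {a m} → Nonneg d → Low d′ a m → Low (fair d d′) a (m * 2)
  low-fairʳ {d} {d′ = d′} {a} {m} nn l = low-++ʳ {scale ½ d} {d′ = scale ½ d′} {m = m * 2} (nonneg-scale 0≤½ nn)
      (low-scale {½} {d′} {a} {m} 2 refl l)

-- Upper bounds of the total mass

record Sub {A : Set} (d : Dist A) : Set where
  constructor sub
  field
    nonneg : Nonneg d
    -- Not an equation, since `uniform []` has no mass.
    mass   : E d (λ _ → 1ℚ) ≤ℚ 1ℚ
open Sub public

sub-≤1 : {A : Set} {d : Dist A} {φ : A → ℚ} → Sub d → (∀ a → φ a ≤ℚ 1ℚ) → E d φ ≤ℚ 1ℚ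
sub-≤1 s φ≤1 = ℚ.≤-trans (E-mono (nonneg s) (λ a _ → φ≤1 a)) (mass s)

module _ {A : Set} where

  sub-return : (a : A) → Sub (return a)
  sub-return a = sub (nonneg-return a) (ℚ.≤-reflexive (E-return a _))

  sub-[] : Sub {A} []
  sub-[] = sub All.[] 0≤1

  sub-fair : {d d′ : Dist A} → Sub d → Sub d′ → Sub (fair d d′)
  sub-fair {d} {d′} s s′ = sub (nonneg-fair (nonneg s) (nonneg s′))
    (subst (_≤ℚ 1ℚ) (sym (E-fair d d′ _)) (ℚ.+-mono-≤ {½ *ℚ E d _} {½} {½ *ℚ E d′ _} {½} (*ℚ-monoˡ 0≤½ (mass s))
        (*ℚ-monoˡ 0≤½ (mass s′))))

  sub-uniform : (xs : List A) → Sub (uniform xs)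
  sub-uniform []       = sub-[]
  sub-uniform (x ∷ xs) = sub (nonneg-uniform (x ∷ xs))
    (ℚ.≤-reflexive (trans (E-uniform x xs _) (trans (cong ((+ 1 / suc (length xs)) *ℚ_) (count (x ∷ xs)))
      (trans (ℚ.*-comm (+ 1 / suc (length xs)) ⟦ suc (length xs) ⟧) (⟦⟧-inverse (length xs))))))
    where
    ⟦⟧-suc : ∀ n → 1ℚ +ℚ ⟦ n ⟧ ≡ ⟦ suc n ⟧
    ⟦⟧-suc n = ℚ.toℚᵘ-injective (begin
      toℚᵘ (1ℚ +ℚ ⟦ n ⟧)                   ≈⟨ ℚ.toℚᵘ-homo-+ 1ℚ ⟦ n ⟧ ⟩
      ℚᵘ.1ℚᵘ ℚᵘ.+ toℚᵘ ⟦ n ⟧               ≈⟨ ℚᵘ.+-cong {ℚᵘ.1ℚᵘ} ℚᵘ.≃-refl (ℚ.toℚᵘ-fromℚᵘ (ℚᵘ.mkℚᵘ (+ n) 0)) ⟩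
      ℚᵘ.1ℚᵘ ℚᵘ.+ ℚᵘ.mkℚᵘ (+ n) 0          ≈⟨ ℚᵘ.*≡* (cong (ℤ._* + 1) (cong (λ z → + 1 ℤ.+ z) (ℤ.*-identityʳ (+ n)))) ⟩
      ℚᵘ.mkℚᵘ (+ suc n) 0                  ≈⟨ ℚ.toℚᵘ-fromℚᵘ (ℚᵘ.mkℚᵘ (+ suc n) 0) ⟨
      toℚᵘ ⟦ suc n ⟧                       ∎)
      where open ℚᵘ.≃-Reasoning
    count : (ys : List A) → E (map (λ y → (1ℚ , y)) ys) (λ _ → 1ℚ) ≡ ⟦ length ys ⟧
    count []       = refl
    count (y ∷ ys) = trans (cong (1ℚ +ℚ_) (count ys)) (⟦⟧-suc (length ys))

  sub->>= : {B : Set} {d : Dist B} {f : B → Dist A} → Sub d → (∀ b → Sub (f b)) → Sub (d >>= f)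
  sub->>= {d = d} {f} s sf = sub (nonneg->>= (nonneg s) (λ b → nonneg (sf b)))
    (subst (_≤ℚ 1ℚ) (sym (E->>= d f _)) (sub-≤1 s (λ b → mass (sf b))))

  -- The common factor 1 / length xs cancels.
  uniform-compare : ∀ {xs : List A} {α β x y m} → (∀ z → Dec (z ≡ x)) → Unique xs → (∀ z → α z ≤ℚ 1ℚ) →
      (∀ z → z ≢ x → α z ≡ 0ℚ) →
                    (∀ z → 0ℚ ≤ℚ β z) → y ∈ˡ xs → 1ℚ ≤ℚ ⟦ m ⟧ *ℚ β y →
                    E (uniform xs) α ≤ℚ ⟦ m ⟧ *ℚ E (uniform xs) β
  uniform-compare {z ∷ zs} {α} {β} {x} {y} {m} ≟x u α≤1 α≡0 0≤β y∈ 1≤ = begin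
    E (uniform (z ∷ zs)) α                              ≡⟨ E-uniform z zs α ⟩
    q *ℚ E (map (λ y → (1ℚ , y)) (z ∷ zs)) α            ≤⟨ *ℚ-monoˡ (0≤1/ (length zs)) (once u) ⟩
    q *ℚ 1ℚ                                             ≤⟨ *ℚ-monoˡ (0≤1/ (length zs)) 1≤ ⟩
    q *ℚ (⟦ m ⟧ *ℚ β y)                                 ≡⟨ ℚ.*-assoc q ⟦ m ⟧ (β y) ⟨
    q *ℚ ⟦ m ⟧ *ℚ β y                                   ≡⟨ cong (_*ℚ β y) (ℚ.*-comm q ⟦ m ⟧) ⟩
    ⟦ m ⟧ *ℚ q *ℚ β y                                   ≡⟨ ℚ.*-assoc ⟦ m ⟧ q (β y) ⟩
    ⟦ m ⟧ *ℚ (q *ℚ β y)                                 ≤⟨ *ℚ-monoˡ (0≤⟦⟧ m) (uniform-weight y∈ 0≤β) ⟩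
    ⟦ m ⟧ *ℚ E (uniform (z ∷ zs)) β                     ∎
    where
    open ℚ.≤-Reasoning
    q = + 1 / suc (length zs)
    none : ∀ {ys} → All (x ≢_) ys → E (map (λ y → (1ℚ , y)) ys) α ≡ 0ℚ
    none {ys} ne = E-vanish (map (λ y → (1ℚ , y)) ys) λ a a∈ → α≡0 a λ { refl → All.lookup ne (lemma ys a∈) refl }
      where
      lemma : ∀ {a} ys → a ∈ˡ map proj₂ (map (λ y → (1ℚ , y)) ys) → a ∈ˡ ys
      lemma (_ ∷ _)  (here eq)  = here eq
      lemma (_ ∷ ys) (there a∈) = there (lemma ys a∈)
    -- Without repetitions in `ys`, `α` can be nonzero at one entry only, so its unweighted sum is
    -- at most 1.
    once : ∀ {ys} → Unique ys → E (map (λ y → (1ℚ , y)) ys) α ≤ℚ 1ℚ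
    once AllPairs.[] = 0≤1
    once {y ∷ ys} (ne AllPairs.∷ u′) with ≟x y
    ... | yes refl = begin
      1ℚ *ℚ α y +ℚ E (map (λ y → (1ℚ , y)) ys) α  ≡⟨ cong₂ _+ℚ_ (ℚ.*-identityˡ (α y)) (none ne) ⟩
      α y +ℚ 0ℚ                                   ≡⟨ ℚ.+-identityʳ (α y) ⟩
      α y                                         ≤⟨ α≤1 y ⟩
      1ℚ                                          ∎
    ... | no y≢x = begin
      1ℚ *ℚ α y +ℚ E (map (λ y → (1ℚ , y)) ys) α  ≡⟨ cong (_+ℚ E (map (λ y → (1ℚ , y)) ys) α)
          (trans (ℚ.*-identityˡ (α y)) (α≡0 y y≢x)) ⟩
      0ℚ +ℚ E (map (λ y → (1ℚ , y)) ys) α         ≡⟨ ℚ.+-identityˡ _ ⟩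
      E (map (λ y → (1ℚ , y)) ys) α               ≤⟨ once u′ ⟩
      1ℚ                                          ∎

-- Counting

module _ {A : Set} where

  unique-singleton : ∀ {xs} {x : A} → Unique xs → x ∈ˡ xs → (∀ y → y ∈ˡ xs → y ≡ x) → xs ≡ x ∷ []
  unique-singleton {y ∷ []}     u x∈ all≡ = cong (_∷ []) (all≡ y (here refl))
  unique-singleton {y ∷ z ∷ xs} (ne AllPairs.∷ _) x∈ all≡ =
    contradiction (trans (all≡ y (here refl)) (sym (all≡ z (there (here refl))))) (All.lookup ne (here refl))

  -- Pigeonhole for an injective relation instead of a function, so that images may be given by mere
  -- existence, as for the codes of subgraphs. The image of the head is removed from `ys`; by
  -- injectivity no later element relies on it.
  unique-length : ∀ {B : Set} {xs : List A} {ys : List B} (R : A → B → Set) → Unique xs →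
                  (∀ {x} → x ∈ˡ xs → ∃[ y ] (y ∈ˡ ys × R x y)) →
                  (∀ {x x′ y} → x ∈ˡ xs → x′ ∈ˡ xs → R x y → R x′ y → x ≡ x′) →
                  length xs ℕ.≤ length ys
  unique-length {xs = []}     R u total inj = ℕ.z≤n
  unique-length {B} {x ∷ xs} {ys} R (ne AllPairs.∷ u) total inj with total (here refl)
  ... | y , y∈ , r with ∈ˡ.∈-∃++ y∈
  ... | as , bs , refl = subst (suc (length xs) ℕ.≤_) (sym (List.length-++-sucʳ as y bs))
    (ℕ.s≤s (unique-length R u total′ (λ p q → inj (there p) (there q))))
    where
    total′ : ∀ {x′} → x′ ∈ˡ xs → ∃[ y′ ] (y′ ∈ˡ as ++ bs × R x′ y′)
    total′ {x′} x′∈ with total (there x′∈)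
    ... | y′ , y′∈ , r′ with ∈ˡ.∈-++⁻ as y′∈
    ... | inj₁ p = y′ , ∈ˡ.∈-++⁺ˡ p , r′
    ... | inj₂ (there p) = y′ , ∈ˡ.∈-++⁺ʳ as p , r′
    ... | inj₂ (here refl) = contradiction (inj (here refl) (there x′∈) r r′) (All.lookup ne x′∈)

  unique-pair : ∀ {xs} {x y : A} → Unique xs → x ∈ˡ xs → y ∈ˡ xs → x ≢ y →
                (∀ z → z ∈ˡ xs → z ≡ x ⊎ z ≡ y) → length xs ≡ 2
  unique-pair {xs} {x} {y} u x∈ y∈ x≢y only = ℕ.≤-antisym
    (unique-length {ys = x ∷ y ∷ []} _≡_ u
      (λ {z} z∈ → z , (case only z z∈ of λ { (inj₁ e) → here e ; (inj₂ e) → there (here e) }) , refl)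
      (λ { _ _ refl refl → refl }))
    (unique-length {xs = x ∷ y ∷ []} {xs} _≡_ ((x≢y All.∷ All.[]) AllPairs.∷ (All.[] AllPairs.∷ AllPairs.[]))
      (λ { (here refl) → x , x∈ , refl ; (there (here refl)) → y , y∈ , refl })
      (λ { _ _ refl refl → refl }))

length-allFin : ∀ n → length (allFin n) ≡ n
length-allFin n = List.length-tabulate id

module _ {n : ℕ} where

  count : {P : Pred (Fin n) 0ℓ} → Decidable P → ℕ
  count P? = length (filter P? (allFin n))

  module _ {P : Pred (Fin n) 0ℓ} (P? : Decidable P) where

    filter-unique : Unique (filter P? (allFin n))
    filter-unique = Unique.filter⁺ P? (Unique.allFin⁺ n)

    ∈-filter : ∀ {x} → P x → x ∈ˡ filter P? (allFin n)
    ∈-filter {x} Px = ∈ˡ.∈-filter⁺ P? (∈ˡ.∈-allFin x) Px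

    ∈-filter⁻ : ∀ {x} → x ∈ˡ filter P? (allFin n) → P x
    ∈-filter⁻ x∈ = proj₂ (∈ˡ.∈-filter⁻ P? {xs = allFin n} x∈)

    count-0 : (∀ x → ¬ P x) → count P? ≡ 0
    count-0 none = cong length (List.filter-none P? (All.universal none (allFin n)))

    count-1 : ∀ {x} → P x → (∀ y → P y → y ≡ x) → count P? ≡ 1
    count-1 Px only = cong length (unique-singleton filter-unique (∈-filter Px) (λ y y∈ → only y (∈-filter⁻ y∈)))

    count-2 : ∀ {x y} → P x → P y → x ≢ y → (∀ z → P z → z ≡ x ⊎ z ≡ y) → count P? ≡ 2
    count-2 Px Py x≢y only = unique-pair filter-unique (∈-filter Px) (∈-filter Py) x≢y (λ z z∈ → only z (∈-filter⁻ z∈))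

    count-0⁻ : count P? ≡ 0 → ∀ x → ¬ P x
    count-0⁻ eq x Px with filter P? (allFin n) | ∈-filter Px
    ... | _ ∷ _ | _ = contradiction eq λ ()

    count-≤1⁻ : count P? ℕ.≤ 1 → ∀ {x y} → P x → P y → x ≡ y
    count-≤1⁻ le Px Py with filter P? (allFin n) | ∈-filter Px | ∈-filter Py
    ... | z ∷ []    | here refl | here refl = refl
    ... | _ ∷ _ ∷ _ | _         | _         = contradiction le λ { (ℕ.s≤s ()) }

    count-≤1 : (∀ {x y} → P x → P y → x ≡ y) → count P? ℕ.≤ 1
    count-≤1 same with filter P? (allFin n) | filter-unique | (λ {x} → ∈-filter⁻ {x})
    ... | []        | _ | _ = ℕ.z≤n
    ... | _ ∷ []    | _ | _ = ℕ.s≤s ℕ.z≤n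
    ... | x ∷ y ∷ _ | ne AllPairs.∷ _ | P∈ =
      contradiction (same (P∈ (here refl)) (P∈ (there (here refl)))) (All.lookup ne (here refl))

    count-1⁻ : count P? ≡ 1 → ∃[ x ] (P x × ∀ y → P y → y ≡ x)
    count-1⁻ eq with filter P? (allFin n) in f≡ | (λ {x} → ∈-filter⁻ {x})
    ... | x ∷ [] | P∈ = x , P∈ (here refl) , λ y Py → count-≤1⁻ (ℕ.≤-reflexive (trans (cong length f≡) eq)) Py
            (P∈ (here refl))

    count-2⁻ : count P? ≡ 2 → ∃[ x ] ∃[ y ] (x ≢ y × P x × P y × ∀ z → P z → z ≡ x ⊎ z ≡ y)
    count-2⁻ eq with filter P? (allFin n) | filter-unique | (λ {x} → ∈-filter⁻ {x}) | (λ {x} → ∈-filter {x})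
    ... | x ∷ y ∷ [] | ne AllPairs.∷ _ | P∈ | ∈P =
      x , y , All.lookup ne (here refl) , P∈ (here refl) , P∈ (there (here refl)) ,
      λ z Pz → case ∈P Pz of λ { (here e) → inj₁ e ; (there (here e)) → inj₂ e }

  module _ {P Q : Pred (Fin n) 0ℓ} (P? : Decidable P) (Q? : Decidable Q) where

    count-cong : (∀ x → P x → Q x) → (∀ x → Q x → P x) → count P? ≡ count Q?
    count-cong P⊆Q Q⊆P = cong length (List.filter-≐ P? Q? ((λ {x} → P⊆Q x) , (λ {x} → Q⊆P x)) (allFin n))

    count-inj : (σ : Fin n → Fin n) → (∀ {x y} → σ x ≡ σ y → x ≡ y) → (∀ x → P x → Q (σ x)) → count P? ℕ.≤ count Q?
    count-inj σ inj P⊆Q = unique-length (λ x y → σ x ≡ y) (filter-unique P?)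
      (λ {x} x∈ → σ x , ∈-filter Q? (P⊆Q x (∈-filter⁻ P? x∈)) , refl)
      (λ { _ _ e e′ → inj (trans e (sym e′)) })

    count-mono : (∀ x → P x → Q x) → count P? ℕ.≤ count Q?
    count-mono = count-inj id id

-- Subsets

subset : ∀ {n} {P : Pred (Fin n) 0ℓ} → Decidable P → Subset n
subset P? = Vec.tabulate (does ∘ P?)

module _ {n : ℕ} {P : Pred (Fin n) 0ℓ} (P? : Decidable P) where

  ∈-subset : ∀ {e} → P e → e ∈ subset P?
  ∈-subset {e} Pe = Vec.lookup⇒[]= e _ (trans (Vec.lookup∘tabulate _ e) (dec-true (P? e) Pe))

  ∈-subset⁻ : ∀ {e} → e ∈ subset P? → P e
  ∈-subset⁻ {e} e∈ with P? e | trans (sym (Vec.lookup∘tabulate (does ∘ P?) e)) (Vec.[]=⇒lookup e∈)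
  ... | yes Pe | _  = Pe
  ... | no _   | ()

∈-subsets : ∀ {n} (S : Subset n) → S ∈ˡ subsets n
∈-subsets Vec.[]            = here refl
∈-subsets (outside Vec.∷ S) = ∈ˡ.∈-++⁺ˡ (∈ˡ.∈-map⁺ (outside Vec.∷_) (∈-subsets S))
∈-subsets (inside Vec.∷ S)  = ∈ˡ.∈-++⁺ʳ _ (∈ˡ.∈-map⁺ (inside Vec.∷_) (∈-subsets S))

subsets-unique : ∀ n → Unique (subsets n)
subsets-unique zero    = All.[] AllPairs.∷ AllPairs.[]
subsets-unique (suc n) = Unique.++⁺ (Unique.map⁺ Vec.∷-injectiveʳ (subsets-unique n))
    (Unique.map⁺ Vec.∷-injectiveʳ (subsets-unique n)) disjoint
  where
  disjoint : ∀ {S} → ¬ (S ∈ˡ map (outside Vec.∷_) (subsets n) × S ∈ˡ map (inside Vec.∷_) (subsets n))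
  disjoint (p , q) with ∈ˡ.∈-map⁻ _ p | ∈ˡ.∈-map⁻ _ q
  ... | _ , _ , refl | _ , _ , ()

subsets-filter-unique : ∀ {n} {P : Pred (Subset n) 0ℓ} (P? : Decidable P) → Unique (filter P? (subsets n))
subsets-filter-unique {n} P? = Unique.filter⁺ P? (subsets-unique n)

∈-subsets-filter : ∀ {n} {P : Pred (Subset n) 0ℓ} (P? : Decidable P) {S} → P S → S ∈ˡ filter P? (subsets n)
∈-subsets-filter P? {S} PS = ∈ˡ.∈-filter⁺ P? (∈-subsets S) PS

∈-subsets-filter⁻ : ∀ {n} {P : Pred (Subset n) 0ℓ} (P? : Decidable P) {S} → S ∈ˡ filter P? (subsets n) → P S
∈-subsets-filter⁻ {n} P? S∈ = proj₂ (∈ˡ.∈-filter⁻ P? {xs = subsets n} S∈)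

count-there : ∀ {n} s (S : Subset n) → length (filter (_∈? (s Vec.∷ S)) (tabulate {n = n} suc)) ≡ count (_∈? S)
count-there {n} s S = begin
  length (filter (_∈? (s Vec.∷ S)) (tabulate suc))        ≡⟨ cong (length ∘ filter (_∈? (s Vec.∷ S)))
      (List.map-tabulate id suc) ⟨
  length (filter (_∈? (s Vec.∷ S)) (map suc (allFin n)))  ≡⟨ cong length (lemma (allFin n)) ⟩
  length (map suc (filter (_∈? S) (allFin n)))            ≡⟨ List.length-map suc (filter (_∈? S) (allFin n)) ⟩
  count (_∈? S)                                           ∎
  where
  open ≡-Reasoning
  lemma : ∀ xs → filter (_∈? (s Vec.∷ S)) (map suc xs) ≡ map suc (filter (_∈? S) xs)
  lemma []       = refl
  lemma (x ∷ xs) with does (x ∈? S)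
  ... | true  = cong (suc x ∷_) (lemma xs)
  ... | false = lemma xs

∣∣≡count : ∀ {n} (S : Subset n) → ∣ S ∣ ≡ count (_∈? S)
∣∣≡count Vec.[]            = refl
∣∣≡count (outside Vec.∷ S) = trans (∣∣≡count S) (sym (count-there outside S))
∣∣≡count (inside Vec.∷ S)  = cong suc (trans (∣∣≡count S) (sym (count-there inside S)))

subset-≡ : ∀ {n} {S T : Subset n} → (∀ e → e ∈ S → e ∈ T) → (∀ e → e ∈ T → e ∈ S) → S ≡ T
subset-≡ p q = Subset.⊆-antisym (λ {e} → p e) (λ {e} → q e)

△-⊥ : ∀ {n} (S : Subset n) → S △ ⊥ ≡ S
△-⊥ Vec.[]      = refl
△-⊥ (s Vec.∷ S) = cong₂ Vec._∷_ (Bool.xor-identityʳ s) (△-⊥ S)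

-- Transpositions of two colours

transposeˡ : ∀ {n} (a b : Fin n) → Perm.transpose a b a ≡ b
transposeˡ a b rewrite dec-true (a Fin.≟ a) refl = refl

transposeʳ : ∀ {n} (a b : Fin n) → Perm.transpose a b b ≡ a
transposeʳ a b with b Fin.≟ a
... | yes refl = refl
... | no _ rewrite dec-true (b Fin.≟ b) refl = refl

transpose-fix : ∀ {n} (a b : Fin n) {x} → x ≢ a → x ≢ b → Perm.transpose a b x ≡ x
transpose-fix a b {x} x≢a x≢b rewrite dec-false (x Fin.≟ a) x≢a | dec-false (x Fin.≟ b) x≢b = refl

transpose-comm : ∀ {n} (a b x : Fin n) → Perm.transpose a b x ≡ Perm.transpose b a x
transpose-comm a b x = lemma (x Fin.≟ a) (x Fin.≟ b)
  where
  lemma : Dec (x ≡ a) → Dec (x ≡ b) → Perm.transpose a b x ≡ Perm.transpose b a x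
  lemma (yes refl) _          = trans (transposeˡ x b) (sym (transposeʳ b x))
  lemma (no _)     (yes refl) = trans (transposeʳ a x) (sym (transposeˡ x a))
  lemma (no x≢a)   (no x≢b)   = trans (transpose-fix a b x≢a x≢b) (sym (transpose-fix b a x≢b x≢a))

transpose-involutive : ∀ {n} (a b x : Fin n) → Perm.transpose a b (Perm.transpose a b x) ≡ x
transpose-involutive a b x = trans (cong (Perm.transpose a b) (transpose-comm a b x)) (Perm.transpose-inverse a b)

transpose-injective : ∀ {n} (a b : Fin n) {x y} → Perm.transpose a b x ≡ Perm.transpose a b y → x ≡ y
transpose-injective a b {x} {y} eq = trans (sym (transpose-involutive a b x))
    (trans (cong (Perm.transpose a b) eq) (transpose-involutive a b y))

-- Sides, ends and connectivity in bipartite graphs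

module Graph (G : BipartiteGraph) where

  open BipartiteGraph G

  end : Bool → Edge → Vertex
  end false = endˡ
  end true  = endʳ

  side-end : ∀ s e → side (end s e) ≡ s
  side-end false = side-ˡ
  side-end true  = side-ʳ

  end-incident : ∀ s e → Incident (end s e) e
  end-incident false e = inj₁ refl
  end-incident true  e = inj₂ refl

  incident⇒end : ∀ {v e} → Incident v e → end (side v) e ≡ v
  incident⇒end {v} {e} (inj₁ refl) rewrite side-ˡ e = refl
  incident⇒end {v} {e} (inj₂ refl) rewrite side-ʳ e = refl

  incident-same : ∀ {u v e} → Incident u e → Incident v e → side u ≡ side v → u ≡ v
  incident-same {u} {v} {e} iu iv eq = trans (sym (incident⇒end iu)) (trans (cong (λ s → end s e) eq) (incident⇒end iv))

  incident-end : ∀ {v e s} → Incident v e → side v ≡ s → end s e ≡ v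
  incident-end i refl = incident⇒end i

  end-≢ : ∀ s e → end s e ≢ end (not s) e
  end-≢ s e eq = Bool.not-¬ refl (trans (sym (side-end s e)) (trans (cong side eq) (side-end (not s) e)))

  adjacent-sym : ∀ {e f} → Adjacent e f → Adjacent f e
  adjacent-sym (e≢f , v , i , j) = (λ eq → e≢f (sym eq)) , v , j , i

  linked-mono : ∀ {S i j e f} → i ℕ.≤ j → Linked S i e f → Linked S j e f
  linked-mono {S} {i} {j} {e} {f} i≤j l = lemma (ℕ.≤⇒≤′ i≤j)
    where
    lemma : ∀ {j} → i ℕ.≤′ j → Linked S j e f
    lemma (ℕ.≤′-reflexive refl) = l
    lemma (ℕ.≤′-step le)        = inj₁ (lemma le)

  linked-prepend : ∀ {S} i {e g f} → Adjacent e g → g ∈ S → Linked S i g f → Linked S (suc i) e f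
  linked-prepend zero    adj g∈ refl = inj₂ (g∈ , _ , refl , adj)
  linked-prepend (suc i) adj g∈ (inj₁ l) = inj₁ (linked-prepend i adj g∈ l)
  linked-prepend (suc i) adj g∈ (inj₂ (f∈ , h , l , adj′)) = inj₂ (f∈ , h , linked-prepend i adj g∈ l , adj′)

  linked-closed : ∀ {S} (Q : Edge → Set) → (∀ {g f} → Q g → f ∈ S → Adjacent g f → Q f) →
                  ∀ i {e f} → Q e → Linked S i e f → Q f
  linked-closed Q step zero    q refl     = q
  linked-closed Q step (suc i) q (inj₁ l) = linked-closed Q step i q l
  linked-closed Q step (suc i) q (inj₂ (f∈ , g , l , adj)) = step (linked-closed Q step i q l) f∈ adj

  -- A property handed on between adjacent edges of `S` spreads along the linking chains. Most
  -- inclusions between subgraphs below are instances in which `Q` is membership in the larger one.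
  connected-⊆ : ∀ {S e} (Q : Edge → Set) → Connected S → e ∈ S → Q e →
                (∀ {g f} → g ∈ S → Q g → f ∈ S → Adjacent g f → Q f) → ∀ f → f ∈ S → Q f
  connected-⊆ {S} {e} Q (_ , linked) e∈ q step f f∈ =
    proj₂ (linked-closed (λ g → g ∈ S × Q g) (λ (g∈ , qg) f∈ adj → f∈ , step g∈ qg f∈ adj) #E (e∈ , q)
        (linked e f e∈ f∈))

-- Colour counts at a vertex, and flips

module Colourings (G : BipartiteGraph) (k : ℕ) (regular : BipartiteGraph.Regular G k) where

  open BipartiteGraph G public
  open M G k public
  open Graph G public

  NoDef : Assignment → Set
  NoDef A = ∀ u → ¬ Deficient A u

  -- This is where regularity enters: the degree equals the number of colours, so no colour can be
  -- missing at a vertex of a proper colouring.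
  #at-1 : ∀ A → Proper A → ∀ u d → #at A u d ≡ 1
  #at-1 A proper u d = ℕ.≤-antisym (count-≤1 at? same) (ℕ.n≢0⇒n>0 λ eq → ℕ.<-irrefl refl (fewer eq))
    where
    at? = λ e → incident? u e ×-dec (lookup A e Fin.≟ d)
    same′ : ∀ {e f} → Incident u e → Incident u f → lookup A e ≡ lookup A f → e ≡ f
    same′ {e} {f} i j eq with e Fin.≟ f
    ... | yes p = p
    ... | no e≢f = contradiction eq (proper e f (e≢f , u , i , j))
    same : ∀ {e f} → Incident u e × lookup A e ≡ d → Incident u f × lookup A f ≡ d → e ≡ f
    same (i , p) (j , q) = same′ i j (trans p (sym q))
    d? = λ (x : Colour) → ¬? (x Fin.≟ d)
    -- The k edges at u inject into the remaining k - 1 colours.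
    fewer : #at A u d ≡ 0 → length (allFin k) ℕ.< length (allFin k)
    fewer eq = begin-strict
      length (allFin k)  ≡⟨ List.length-tabulate id ⟩
      k                  ≡⟨ regular u ⟨
      count (incident? u) ≤⟨ unique-length (λ e x → lookup A e ≡ x) (filter-unique (incident? u))
                             (λ {e} e∈ → lookup A e , ∈-filter d? (λ p → count-0⁻ at? eq e
                                 (∈-filter⁻ (incident? u) e∈ , p)) , refl)
                             (λ e∈ f∈ p q → same′ (∈-filter⁻ (incident? u) e∈) (∈-filter⁻ (incident? u) f∈)
                                 (trans p (sym q))) ⟩
      length (filter d? (allFin k)) <⟨ List.filter-notAll d? (allFin k) (Any.map (λ { refl n → n refl })
          (∈ˡ.∈-allFin d)) ⟩
      length (allFin k)  ∎
      where open ℕ.≤-Reasoning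

  flip-∈ : ∀ {a b S} A {e} → e ∈ S → lookup (flip a b S A) e ≡ Perm.transpose a b (lookup A e)
  flip-∈ {a} {b} {S} A {e} e∈ rewrite Vec.lookup∘tabulate (λ e → if does (e ∈? S) then Perm.transpose a b
      (lookup A e) else lookup A e) e | dec-true (e ∈? S) e∈ = refl

  flip-∉ : ∀ {a b S} A {e} → e ∉ S → lookup (flip a b S A) e ≡ lookup A e
  flip-∉ {a} {b} {S} A {e} e∉ rewrite Vec.lookup∘tabulate (λ e → if does (e ∈? S) then Perm.transpose a b
      (lookup A e) else lookup A e) e | dec-false (e ∈? S) e∉ = refl

  lookup-ext : ∀ {A B : Assignment} → (∀ e → lookup A e ≡ lookup B e) → A ≡ B
  lookup-ext {A} {B} eq = trans (sym (Vec.tabulate∘lookup A)) (trans (Vec.tabulate-cong eq) (Vec.tabulate∘lookup B))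

  flip-⊥ : ∀ {a b} A → flip a b ⊥ A ≡ A
  flip-⊥ A = lookup-ext (λ e → flip-∉ A Subset.∉⊥)

  flip-involutive : ∀ {a b} S A → flip a b S (flip a b S A) ≡ A
  flip-involutive {a} {b} S A = lookup-ext lemma
    where
    lemma : ∀ e → lookup (flip a b S (flip a b S A)) e ≡ lookup A e
    lemma e with e ∈? S
    ... | yes e∈ = trans (flip-∈ (flip a b S A) e∈) (trans (cong (Perm.transpose a b) (flip-∈ A e∈))
            (transpose-involutive a b _))
    ... | no e∉  = trans (flip-∉ (flip a b S A) e∉) (flip-∉ A e∉)

  flip-comm : ∀ {a b} S T A → flip a b S (flip a b T A) ≡ flip a b T (flip a b S A)
  flip-comm {a} {b} S T A = lookup-ext lemma
    where
    lemma : ∀ e → lookup (flip a b S (flip a b T A)) e ≡ lookup (flip a b T (flip a b S A)) e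
    lemma e with e ∈? S | e ∈? T
    ... | yes p | yes q = trans (flip-∈ (flip a b T A) p)
            (trans (cong (Perm.transpose a b) (trans (flip-∈ A q) (sym (flip-∈ A p)))) (sym (flip-∈ (flip a b S A) q)))
    ... | yes p | no q  = trans (flip-∈ (flip a b T A) p) (trans (cong (Perm.transpose a b) (flip-∉ A q))
            (trans (sym (flip-∈ A p)) (sym (flip-∉ (flip a b S A) q))))
    ... | no p  | yes q = trans (flip-∉ (flip a b T A) p)
            (trans (flip-∈ A q) (trans (cong (Perm.transpose a b) (sym (flip-∉ A p))) (sym (flip-∈ (flip a b S A) q))))
    ... | no p  | no q  = trans (flip-∉ (flip a b T A) p) (trans (flip-∉ A q) (trans (sym (flip-∉ A p))
            (sym (flip-∉ (flip a b S A) q))))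

-- The two-factor formed by the edges of colours c and c′

module TwoFactor (G : BipartiteGraph) (k : ℕ) (regular : BipartiteGraph.Regular G k)
                 (c c′ : Fin k) (c≢c′ : c ≢ c′) where

  open Colourings G k regular public

  In : Colour → Set
  In x = x ≡ c ⊎ x ≡ c′

  in? : ∀ x → Dec (In x)
  in? x = (x Fin.≟ c) ⊎-dec (x Fin.≟ c′)

  τ : Colour → Colour
  τ = Perm.transpose c c′

  τ-in : ∀ {x} → In x → In (τ x)
  τ-in (inj₁ refl) = inj₂ (transposeˡ c c′)
  τ-in (inj₂ refl) = inj₁ (transposeʳ c c′)

  τ-≢ : ∀ {x} → In x → τ x ≢ x
  τ-≢ (inj₁ refl) eq = c≢c′ (trans (sym eq) (transposeˡ c c′))
  τ-≢ (inj₂ refl) eq = c≢c′ (trans (sym (transposeʳ c c′)) eq)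

  τ-out : ∀ {x} → ¬ In x → τ x ≡ x
  τ-out ∉ = transpose-fix c c′ (λ e → ∉ (inj₁ e)) (λ e → ∉ (inj₂ e))

  in-third : ∀ {x y z} → In x → In y → In z → x ≢ y → x ≢ z → y ≡ z
  in-third (inj₁ refl) (inj₁ refl) _           x≢y _   = contradiction refl x≢y
  in-third (inj₁ refl) (inj₂ refl) (inj₁ refl) _   x≢z = contradiction refl x≢z
  in-third (inj₁ refl) (inj₂ refl) (inj₂ refl) _   _   = refl
  in-third (inj₂ refl) (inj₂ refl) _           x≢y _   = contradiction refl x≢y
  in-third (inj₂ refl) (inj₁ refl) (inj₂ refl) _   x≢z = contradiction refl x≢z
  in-third (inj₂ refl) (inj₁ refl) (inj₁ refl) _   _   = refl

  τ-other : ∀ {x y} → In x → In y → x ≢ y → τ x ≡ y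
  τ-other ix iy x≢y = in-third ix (τ-in ix) iy (λ eq → τ-≢ ix (sym eq)) x≢y

  OnH : Assignment → Edge → Set
  OnH A e = HasColour A c c′ e

  -- The local picture of an almost colouring: how `c` and `c′` are distributed over the two edges
  -- is left open, and `u` is deficient exactly when they agree. The picture survives every flip of
  -- `c` and `c′` (`flip-two`).
  record TwoAt (A : Assignment) (u : Vertex) (g h : Edge) : Set where
    constructor twoAt
    field
      distinct : g ≢ h
      incˡ     : Incident u g
      incʳ     : Incident u h
      onˡ      : OnH A g
      onʳ      : OnH A h
      only     : ∀ {f} → Incident u f → OnH A f → f ≡ g ⊎ f ≡ h
      rest     : ∀ {d} → ¬ In d → #at A u d ≡ 1
  open TwoAt public

  -- Purely local: unlike an almost edge colouring, it does not limit the number of deficient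
  -- vertices. `TwoDef` adds that later.
  Near : Assignment → Set
  Near A = ∀ u → ∃[ g ] ∃[ h ] TwoAt A u g h

  two-swap : ∀ {A u g h} → TwoAt A u g h → TwoAt A u h g
  two-swap t = twoAt (λ eq → distinct t (sym eq)) (incʳ t) (incˡ t) (onʳ t) (onˡ t) (λ i o → swap (only t i o)) (rest t)

  focus : ∀ {A u f} → Near A → Incident u f → OnH A f → ∃[ h ] TwoAt A u f h
  focus {u = u} near i o with near u
  ... | g , h , t with only t i o
  ... | inj₁ refl = h , t
  ... | inj₂ refl = g , two-swap t

  flip-on : ∀ {S A e} → OnH A e → OnH (flip c c′ S A) e
  flip-on {S} {A} {e} o with e ∈? S
  ... | yes e∈ = subst In (sym (flip-∈ A e∈)) (τ-in o)
  ... | no e∉  = subst In (sym (flip-∉ A e∉)) o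

  flip-on⁻ : ∀ {S A e} → OnH (flip c c′ S A) e → OnH A e
  flip-on⁻ {S} {A} o = subst (λ B → OnH B _) (flip-involutive S A) (flip-on {S} {flip c c′ S A} o)

  flip-out : ∀ {S A e d} → ¬ In d → lookup A e ≡ d → lookup (flip c c′ S A) e ≡ d
  flip-out {S} {A} {e} d∉ refl with e ∈? S
  ... | yes e∈ = trans (flip-∈ A e∈) (τ-out d∉)
  ... | no e∉  = flip-∉ A e∉

  flip-out⁻ : ∀ {S A e d} → ¬ In d → lookup (flip c c′ S A) e ≡ d → lookup A e ≡ d
  flip-out⁻ {S} {A} d∉ eq = subst (λ B → lookup B _ ≡ _) (flip-involutive S A) (flip-out {S} {flip c c′ S A} d∉ eq)

  flip-two : ∀ {S A u g h} → TwoAt A u g h → TwoAt (flip c c′ S A) u g h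
  flip-two {S} {A} {u} t = twoAt (distinct t) (incˡ t) (incʳ t) (flip-on {S} {A} (onˡ t)) (flip-on {S} {A} (onʳ t))
    (λ i o → only t i (flip-on⁻ {S} {A} o))
    (λ {d} d∉ → trans (count-cong (λ e → incident? u e ×-dec (lookup (flip c c′ S A) e Fin.≟ d))
        (λ e → incident? u e ×-dec (lookup A e Fin.≟ d))
      (λ _ (i , eq) → i , flip-out⁻ {S} {A} d∉ eq) (λ _ (i , eq) → i , flip-out {S} {A} d∉ eq)) (rest t d∉))

  flip-near : ∀ {S A} → Near A → Near (flip c c′ S A)
  flip-near near u with near u
  ... | g , h , t = g , h , flip-two t

  def⇒≡ : ∀ {A u g h} → TwoAt A u g h → Deficient A u → lookup A g ≡ lookup A h
  def⇒≡ {A} {u} t (a , b , eq₂ , _) with in? a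
  ... | no a∉ = contradiction (trans (sym eq₂) (rest t a∉)) λ ()
  ... | yes a∈ with count-2⁻ (λ e → incident? u e ×-dec (lookup A e Fin.≟ a)) eq₂
  ... | x , y , x≢y , (ix , refl) , (iy , eq) , _ with only t ix a∈ | only t iy (subst In (sym eq) a∈)
  ... | inj₁ refl | inj₁ refl = contradiction refl x≢y
  ... | inj₁ refl | inj₂ refl = sym eq
  ... | inj₂ refl | inj₁ refl = eq
  ... | inj₂ refl | inj₂ refl = contradiction refl x≢y

  ≡⇒deficiency : ∀ {A u g h} → TwoAt A u g h → lookup A g ≡ lookup A h → Deficiency A u (lookup A g) (τ (lookup A g))
  ≡⇒deficiency {A} {u} {g} {h} t eq =
    count-2 (at? a) (incˡ t , refl) (incʳ t , sym eq) (distinct t) (λ f (i , p) → only t i (subst In (sym p) (onˡ t))) ,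
    none , others
    where
    a = lookup A g
    at? = λ d e → incident? u e ×-dec (lookup A e Fin.≟ d)
    none : #at A u (τ a) ≡ 0
    none = count-0 (at? (τ a)) λ f (i , p) → case only t i (subst In (sym p) (τ-in (onˡ t))) of λ
      { (inj₁ refl) → τ-≢ (onˡ t) (sym p)
      ; (inj₂ refl) → τ-≢ (onˡ t) (sym (trans eq p)) }
    others : ∀ d → d ≢ a → #at A u d ℕ.≤ 1
    others d d≢a with in? d
    ... | no d∉ = ℕ.≤-reflexive (rest t d∉)
    ... | yes d∈ = ℕ.≤-trans (ℕ.≤-reflexive (subst (λ x → #at A u x ≡ 0)
            (τ-other (onˡ t) d∈ (λ e → d≢a (sym e))) none)) ℕ.z≤n

  ≡⇒def : ∀ {A u g h} → TwoAt A u g h → lookup A g ≡ lookup A h → Deficient A u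
  ≡⇒def t eq = _ , _ , ≡⇒deficiency t eq

  ok⇒≢ : ∀ {A u g h} → TwoAt A u g h → ¬ Deficient A u → lookup A g ≢ lookup A h
  ok⇒≢ t ok eq = ok (≡⇒def t eq)

  repeated⇒≡ : ∀ {A u g h d} → TwoAt A u g h → Repeated A u d → d ≡ lookup A g
  repeated⇒≡ {A} {u} {g} {h} {d} t r@(b , eq₂ , none , le) with d Fin.≟ lookup A g
  ... | yes eq = eq
  ... | no d≢ with ≡⇒deficiency t (def⇒≡ t (d , r))
  ...   | eq₂′ , _ = contradiction (ℕ.≤-trans (ℕ.≤-reflexive (sym eq₂′)) (le (lookup A g) (λ e → d≢ (sym e))))
          λ { (ℕ.s≤s ()) }

  differ⇒ok : ∀ {A u g f} → Near A → Incident u g → Incident u f → OnH A g → OnH A f → lookup A g ≢ lookup A f →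
      ¬ Deficient A u
  differ⇒ok near ig if og of neq def with focus near ig og
  ... | h , t with only t if of
  ... | inj₁ refl = neq refl
  ... | inj₂ refl = neq (def⇒≡ t def)

  proper⇒two : ∀ A → Proper A → ∀ u → ∃[ g ] ∃[ h ] (TwoAt A u g h × lookup A g ≡ c × lookup A h ≡ c′)
  proper⇒two A proper u with count-1⁻ (λ e → incident? u e ×-dec (lookup A e Fin.≟ c)) (#at-1 A proper u c)
                             | count-1⁻ (λ e → incident? u e ×-dec (lookup A e Fin.≟ c′)) (#at-1 A proper u c′)
  ... | g , (ig , gc) , onlyg | h , (ih , hc) , onlyh = g , h , twoAt (λ { refl → c≢c′ (trans (sym gc) hc) }) ig
          ih (inj₁ gc) (inj₂ hc)
    (λ { i (inj₁ eq) → inj₁ (onlyg _ (i , eq)) ; i (inj₂ eq) → inj₂ (onlyh _ (i , eq)) })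
    (λ {d} _ → #at-1 A proper u d) , gc , hc

  proper⇒near : ∀ A → Proper A → Near A
  proper⇒near A proper u with proper⇒two A proper u
  ... | g , h , t , _ = g , h , t

  proper⇒nodef : ∀ A → Proper A → NoDef A
  proper⇒nodef A proper u def with proper⇒two A proper u
  ... | g , h , t , gc , hc = c≢c′ (trans (sym gc) (trans (def⇒≡ t def) hc))

  -- A clash in a third colour contradicts `rest`; a clash in `c` or `c′` is a deficiency.
  nodef⇒proper : ∀ {A} → Near A → NoDef A → Proper A
  nodef⇒proper {A} near nodef e f (e≢f , u , i , j) eq with in? (lookup A e)
  ... | no out with near u
  ...   | g , h , t = e≢f (count-≤1⁻ (λ x → incident? u x ×-dec (lookup A x Fin.≟ lookup A e))
          (ℕ.≤-reflexive (rest t out)) (i , refl) (j , sym eq))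
  nodef⇒proper {A} near nodef e f (e≢f , u , i , j) eq | yes on with focus near i on
  ...   | h , t with only t j (subst In eq on)
  ...     | inj₁ f≡e = e≢f (sym f≡e)
  ...     | inj₂ refl = ok⇒≢ t (nodef u) eq

  -- Degrees in subgraphs of the two-factor

  CS : Assignment → Subgraph → Set
  CS A S = Coloured A c c′ S

  data Degree (S : Subgraph) (u : Vertex) (g h : Edge) : Set where
    both  : g ∈ S → h ∈ S → deg S u ≡ 2 → Degree S u g h
    left  : g ∈ S → h ∉ S → deg S u ≡ 1 → Degree S u g h
    right : g ∉ S → h ∈ S → deg S u ≡ 1 → Degree S u g h
    neither  : g ∉ S → h ∉ S → deg S u ≡ 0 → Degree S u g h

  degree : ∀ {A S u g h} → CS A S → TwoAt A u g h → Degree S u g h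
  degree {A} {S} {u} {g} {h} cs t with g ∈? S | h ∈? S
  ... | yes p | yes q = both p q (count-2 (λ e → incident? u e ×-dec (e ∈? S)) (incˡ t , p) (incʳ t , q)
          (distinct t) λ f (i , f∈) → only t i (cs f f∈))
  ... | yes p | no q  = left p q (count-1 (λ e → incident? u e ×-dec (e ∈? S)) (incˡ t , p) λ f (i , f∈) →
          case only t i (cs f f∈) of λ { (inj₁ eq) → eq ; (inj₂ refl) → contradiction f∈ q })
  ... | no p  | yes q = right p q (count-1 (λ e → incident? u e ×-dec (e ∈? S)) (incʳ t , q) λ f (i , f∈) →
          case only t i (cs f f∈) of λ { (inj₂ eq) → eq ; (inj₁ refl) → contradiction f∈ p })
  ... | no p  | no q  = neither p q (count-0 (λ e → incident? u e ×-dec (e ∈? S)) λ f (i , f∈) → case only t i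
          (cs f f∈) of λ { (inj₁ refl) → p f∈ ; (inj₂ refl) → q f∈ })

  flip-coloured : ∀ {S T A} → CS A T → CS (flip c c′ S A) T
  flip-coloured {S} {A = A} cs e e∈ = flip-on {S} {A} (cs e e∈)

  flip-coloured⁻ : ∀ {S T A} → CS (flip c c′ S A) T → CS A T
  flip-coloured⁻ {S} {A = A} cs e e∈ = flip-on⁻ {S} {A} (cs e e∈)

  module _ {S : Subgraph} {A : Assignment} {u : Vertex} {g h : Edge} (t : TwoAt A u g h) where

    -- Only two colours are interchanged, so the two edges at `u` change between agreeing and
    -- differing exactly when one of them alone is flipped. Hence a flip toggles deficiency
    -- precisely at the vertices of degree 1 in `S`.
    flip-agree : (g ∈ S → h ∈ S) → (h ∈ S → g ∈ S) → lookup (flip c c′ S A) g ≡ lookup (flip c c′ S A) h →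
        lookup A g ≡ lookup A h
    flip-agree p q eq with g ∈? S
    ... | yes g∈ = transpose-injective c c′ (trans (sym (flip-∈ A g∈)) (trans eq (flip-∈ A (p g∈))))
    ... | no g∉  = trans (sym (flip-∉ A g∉)) (trans eq (flip-∉ A (λ h∈ → g∉ (q h∈))))

    flip-toggle : g ∈ S → h ∉ S → lookup (flip c c′ S A) g ≡ lookup (flip c c′ S A) h → lookup A g ≢ lookup A h
    flip-toggle g∈ h∉ eq eq′ = τ-≢ (onˡ t) (trans (sym (flip-∈ A g∈)) (trans eq (trans (flip-∉ A h∉) (sym eq′))))

    flip-toggle′ : g ∈ S → h ∉ S → lookup A g ≢ lookup A h → lookup (flip c c′ S A) g ≡ lookup (flip c c′ S A) h
    flip-toggle′ g∈ h∉ neq = trans (flip-∈ A g∈) (trans (τ-other (onˡ t) (onʳ t) neq) (sym (flip-∉ A h∉)))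

-- Elimination of deficiencies

module Elimination (G : BipartiteGraph) (k : ℕ) (regular : BipartiteGraph.Regular G k)
                   (c c′ : Fin k) (c≢c′ : c ≢ c′) where

  open TwoFactor G k regular c c′ c≢c′ public

  -- Describes both a path that an elimination may flip and, by `path-elim`, a path that has just
  -- been flipped in a proper colouring. This symmetry is the source of the inverse ways.
  record Elim (A : Assignment) (S : Subgraph) : Set where
    constructor elim
    field
      path        : IsPath S
      coloured    : CS A S
      alternating : Alternating A S
      end⇒def     : ∀ u → deg S u ≡ 1 → Deficient A u
      def⇒end     : ∀ u → Deficient A u → deg S u ≡ 1
  open Elim public

  -- At an end of `S` one of two equally coloured edges changes; at every other vertex the two edges
  -- differ, and both or neither change.
  elim-nodef : ∀ {A S} → Near A → Elim A S → NoDef (flip c c′ S A)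
  elim-nodef {A} {S} near el u def with near u
  ... | g , h , t with degree (coloured el) t
  ...   | both p q eq    = case trans (sym eq)
          (def⇒end el u (≡⇒def t (flip-agree t (λ _ → q) (λ _ → p) (def⇒≡ (flip-two {S} t) def)))) of λ ()
  ...   | neither p q eq = case trans (sym eq)
          (def⇒end el u (≡⇒def t (flip-agree t (⊥-elim ∘ p) (⊥-elim ∘ q) (def⇒≡ (flip-two {S} t) def)))) of λ ()
  ...   | left p q eq    = flip-toggle t p q (def⇒≡ (flip-two {S} t) def) (def⇒≡ t (end⇒def el u eq))
  ...   | right p q eq   = flip-toggle (two-swap t) q p (sym (def⇒≡ (flip-two {S} t) def))
          (sym (def⇒≡ t (end⇒def el u eq)))

  -- Without deficiencies the two edges at each vertex differ. Flipping both or neither keeps this;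
  -- flipping one, as happens at the ends of the path, makes them agree.
  path-elim : ∀ {A S} → Near A → NoDef A → IsPath S → CS A S → Elim (flip c c′ S A) S
  path-elim {A} {S} near nodef isPath cs = elim isPath (flip-coloured {S} {A = A} cs) alt end⇒ def
    where
    alt : Alternating (flip c c′ S A) S
    alt e f e∈ f∈ (e≢f , u , i , j) eq with focus near i (cs e e∈)
    ... | h , t with only t j (cs f f∈)
    ... | inj₁ f≡e = e≢f (sym f≡e)
    ... | inj₂ refl = ok⇒≢ t (nodef u) (flip-agree {S} t (λ _ → f∈) (λ _ → e∈) eq)
    end⇒ : ∀ u → deg S u ≡ 1 → Deficient (flip c c′ S A) u
    end⇒ u eq with near u
    ... | g , h , t with degree cs t
    ... | both _ _ eq′    = case trans (sym eq) eq′ of λ ()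
    ... | neither _ _ eq′ = case trans (sym eq) eq′ of λ ()
    ... | left p q _      = ≡⇒def (flip-two t) (flip-toggle′ t p q (ok⇒≢ t (nodef u)))
    ... | right p q _     = ≡⇒def (flip-two t) (sym (flip-toggle′ (two-swap t) q p (λ e → ok⇒≢ t (nodef u) (sym e))))
    def : ∀ u → Deficient (flip c c′ S A) u → deg S u ≡ 1
    def u d with near u
    ... | g , h , t with degree cs t
    ... | both p q _    = ⊥-elim (ok⇒≢ t (nodef u) (flip-agree t (λ _ → q) (λ _ → p) (def⇒≡ (flip-two {S} t) d)))
    ... | neither p q _ = ⊥-elim (ok⇒≢ t (nodef u) (flip-agree t (⊥-elim ∘ p) (⊥-elim ∘ q) (def⇒≡ (flip-two {S} t) d)))
    ... | left _ _ eq   = eq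
    ... | right _ _ eq  = eq

  -- `T` could leave `S` only at an end of `S`. That vertex is deficient, its two edges agree in
  -- colour, and the alternating `T` cannot contain both.
  alternating-⊆ : ∀ {A S T e} → Near A → Elim A S → Connected T → CS A T → Alternating A T → e ∈ T → e ∈ S →
      ∀ f → f ∈ T → f ∈ S
  alternating-⊆ {A} {S} {T} near el conn cs alt e∈T e∈S = connected-⊆ (_∈ S) conn e∈T e∈S step
    where
    step : ∀ {g f} → g ∈ T → g ∈ S → f ∈ T → Adjacent g f → f ∈ S
    step {g} {f} g∈T g∈S f∈T adj@(g≢f , u , i , j) with focus near i (cs g g∈T)
    ... | h , t with only t j (cs f f∈T)
    ... | inj₁ f≡g = contradiction (sym f≡g) g≢f
    ... | inj₂ refl with degree (coloured el) t
    ... | both _ q _    = q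
    ... | left _ _ eq   = contradiction (def⇒≡ t (end⇒def el u eq)) (alt g f g∈T f∈T adj)
    ... | right p _ _   = contradiction g∈S p
    ... | neither p _ _ = contradiction g∈S p

  elim-start : ∀ {A S v e} → Elim A S → Deficient A v → e ∈ S → Incident v e → AlternatingPath A c c′ v e S
  elim-start el def e∈ i = path el , coloured el , alternating el , e∈ , i , def⇒end el _ def

  -- By `alternating-⊆` every alternating path from `v` along `e` lies inside `S`. So `S` is the
  -- greatest one, and the draw among maximal paths is deterministic.
  maximal-unique : ∀ {A S v e} → Near A → Elim A S → Deficient A v → e ∈ S → Incident v e →
                   filter (maximalAlternatingPath? A c c′ v e) (subsets #E) ≡ S ∷ []
  maximal-unique {A} {S} {v} {e} near el def e∈ i =
    unique-singleton (subsets-filter-unique max?) (∈-subsets-filter max? (elim-start el def e∈ i ,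
        λ (T , alt , S⊂T) → ⊄ alt S⊂T)) unique
    where
    max? = maximalAlternatingPath? A c c′ v e
    inside-S : ∀ {T} → AlternatingPath A c c′ v e T → ∀ f → f ∈ T → f ∈ S
    inside-S ((conn , _) , cs , alt , e∈T , _) = alternating-⊆ near el conn cs alt e∈T e∈
    ⊄ : ∀ {T} → AlternatingPath A c c′ v e T → ¬ S ⊂ T
    ⊄ alt (_ , f , f∈T , f∉S) = f∉S (inside-S alt f f∈T)
    unique : ∀ T → T ∈ˡ filter max? (subsets #E) → T ≡ S
    unique T T∈ with ∈-subsets-filter⁻ max? T∈
    ... | alt , max = subset-≡ (inside-S alt) λ f f∈S → case f ∈? T of λ
      { (yes f∈T) → f∈T
      ; (no f∉T) → contradiction (S , elim-start el def e∈ i , (λ {x} → inside-S alt x) , f , f∈S , f∉T) max }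

  repeated-edges : ∀ {A v g h} → TwoAt A v g h → Deficient A v →
                   length (repeatedEdges A v) ≡ 2 × (∀ {f} → f ≡ g ⊎ f ≡ h → f ∈ˡ repeatedEdges A v) ×
                       (∀ {f} → f ∈ˡ repeatedEdges A v → f ≡ g ⊎ f ≡ h)
  repeated-edges {A} {v} {g} {h} t def =
    count-2 P? Pg Ph (distinct t) P⇒ , (λ { (inj₁ refl) → ∈-filter P? Pg ; (inj₂ refl) → ∈-filter P? Ph }) ,
        (λ f∈ → P⇒ _ (∈-filter⁻ P? f∈))
    where
    P? = λ e → incident? v e ×-dec repeated? A v (lookup A e)
    eq = def⇒≡ t def
    rep : Repeated A v (lookup A g)
    rep = _ , ≡⇒deficiency t eq
    Pg = incˡ t , rep
    Ph = incʳ t , subst (Repeated A v) eq rep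
    P⇒ : ∀ f → Incident v f × Repeated A v (lookup A f) → f ≡ g ⊎ f ≡ h
    P⇒ f (i , r) = only t i (subst In (sym (repeated⇒≡ t r)) (onˡ t))

  eliminate-nodef : ∀ vs {A} → NoDef A → eliminateAt c c′ vs A ≡ return ⊥
  eliminate-nodef []       nodef = refl
  eliminate-nodef (v ∷ vs) {A} nodef rewrite dec-false (deficient? A v) (nodef v) = eliminate-nodef vs nodef

  eliminate-skip : ∀ {v vs A} → ¬ Deficient A v → eliminateAt c c′ (v ∷ vs) A ≡ eliminateAt c c′ vs A
  eliminate-skip {v} {vs} {A} ok rewrite dec-false (deficient? A v) ok = refl

  -- The elimination at a deficient vertex followed by those at vs.
  module Step (v : Vertex) (vs : List Vertex) (A : Assignment) where

    paths : Edge → List Subgraph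
    paths e = filter (maximalAlternatingPath? A c c′ v e) (subsets #E)

    after : Subgraph → Dist Subgraph
    after S = eliminateAt c c′ vs (flip c c′ S A) >>= λ T → return (S △ T)

    along : Edge → Dist Subgraph
    along e = uniform (paths e) >>= after

    step : Dist Subgraph
    step = uniform (repeatedEdges A v) >>= along

  eliminate-at : ∀ {v vs A} → Deficient A v → eliminateAt c c′ (v ∷ vs) A ≡ Step.step v vs A
  eliminate-at {v} {vs} {A} def rewrite dec-true (deficient? A v) def = refl

  sub-eliminate : ∀ vs A → Sub (eliminateAt c c′ vs A)
  sub-after     : ∀ v vs A S → Sub (Step.after v vs A S)
  sub-along     : ∀ v vs A e → Sub (Step.along v vs A e)
  sub-eliminate []       A = sub-return ⊥
  sub-eliminate (v ∷ vs) A = split (deficient? A v)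
    where
    split : Dec (Deficient A v) → Sub (eliminateAt c c′ (v ∷ vs) A)
    split (no ok)   = subst Sub (sym (eliminate-skip {v} {vs} {A} ok)) (sub-eliminate vs A)
    split (yes def) = subst Sub (sym (eliminate-at {v} {vs} {A} def)) (sub->>= {f = Step.along v vs A}
        (sub-uniform (repeatedEdges A v)) (sub-along v vs A))
  sub-after v vs A S = sub->>= {d = eliminateAt c c′ vs (flip c c′ S A)} {f = λ T → return (S △ T)}
      (sub-eliminate vs (flip c c′ S A)) (λ T → sub-return (S △ T))
  sub-along v vs A e = sub->>= {f = Step.after v vs A} (sub-uniform (Step.paths v vs A e)) (sub-after v vs A)

  -- The first deficient vertex in the list does all the work. It is an end of `S`, so one of its
  -- two repeated edges lies in `S`: this is the 2. After the flip of `S` the remaining vertices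
  -- contribute `⊥`.
  low-eliminateAt : ∀ vs {A S} → Near A → Elim A S → ∃[ v ] (v ∈ˡ vs × Deficient A v) → Low (eliminateAt c c′ vs A) S 2
  low-eliminateAt (v ∷ vs) {A} {S} near el (w , w∈ , defw) = split (deficient? A v)
    where
    later : ¬ Deficient A v → w ∈ˡ v ∷ vs → w ∈ˡ vs
    later ok (here refl) = contradiction defw ok
    later ok (there p)   = p
    open Step v vs A
    start : Deficient A v → ∃[ e ] ((Incident v e × e ∈ S) × (∀ f → Incident v f × f ∈ S → f ≡ e)) → Low step S 2
    start def (e , (i , e∈) , _) =
      let h , t = focus near i (coloured el e e∈)
          len , ∈rep , _ = repeated-edges t def
      in low->>= {d = uniform (repeatedEdges A v)} {f = along} {m = 2} {n = 1} (λ e → nonneg (sub-along v vs A e))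
        (subst (Low (uniform (repeatedEdges A v)) e) len (low-uniform {xs = repeatedEdges A v} {e}
            (∈rep {e} (inj₁ refl))))
        (low->>= {d = uniform (paths e)} {f = after} {m = 1} {n = 1} (λ S → nonneg (sub-after v vs A S))
          (subst (λ l → Low (uniform l) S 1) (sym (maximal-unique {A} {S} {v} {e} near el def e∈ i))
              (low-uniform {xs = S ∷ []} (here refl)))
          (subst (λ d → Low (d >>= λ T → return (S △ T)) S 1)
              (sym (eliminate-nodef vs {flip c c′ S A} (elim-nodef {A} {S} near el)))
            (low->>= {d = return ⊥} {f = λ T → return (S △ T)} {m = 1} {n = 1} (λ T → nonneg-return (S △ T))
                (low-return ⊥) (subst (λ R → Low (return (S △ ⊥)) R 1) (△-⊥ S) (low-return (S △ ⊥))))))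
    split : Dec (Deficient A v) → Low (eliminateAt c c′ (v ∷ vs) A) S 2
    split (no ok)   = subst (λ d → Low d S 2) (sym (eliminate-skip {v} {vs} {A} ok)) (low-eliminateAt vs {A} {S}
        near el (w , later ok w∈ , defw))
    split (yes def) = subst (λ d → Low d S 2) (sym (eliminate-at {v} {vs} {A} def))
        (start def (count-1⁻ (λ e → incident? v e ×-dec (e ∈? S)) (def⇒end el v def)))

  low-eliminate : ∀ {A S} → Near A → Elim A S → Low (eliminate c c′ A) S 2
  low-eliminate {A} {S} near el =
    let v , eq = proj₂ (proj₂ (path el)) in low-eliminateAt (allFin #V) {A} {S} near el (v , ∈ˡ.∈-allFin v ,
            end⇒def el v eq)

  low-eliminate-nodef : ∀ {A} → NoDef A → Low (eliminate c c′ A) ⊥ 1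
  low-eliminate-nodef {A} nodef = subst (λ d → Low d ⊥ 1) (sym (eliminate-nodef (allFin #V) {A} nodef)) (low-return ⊥)

  -- Whichever repeated edge is drawn, `exist` supplies an eliminating path through it,
  -- `maximal-unique` makes it the only candidate, and after its flip the remaining vertices have
  -- nothing to do.
  supp-eliminateAt : ∀ vs {A T} → Near A → (∀ {v e} → Deficient A v → Incident v e → OnH A e →
      ∃[ S ] (Elim A S × e ∈ S)) →
                     ∃[ v ] (v ∈ˡ vs × Deficient A v) → Supp (eliminateAt c c′ vs A) T → Elim A T
  supp-eliminateAt (v ∷ vs) {A} {T} near exist (w , w∈ , defw) supp = split (deficient? A v)
    where
    later : ¬ Deficient A v → w ∈ˡ v ∷ vs → w ∈ˡ vs
    later ok (here refl) = contradiction defw ok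
    later ok (there p)   = p
    open Step v vs A
    tail≡ : ∀ {S} → NoDef (flip c c′ S A) → Supp (after S) T → T ≡ S
    tail≡ {S} nodef supp = done (supp->>= {d = return ⊥} {f = λ T → return (S △ T)}
        (subst (λ d → Supp (d >>= λ T → return (S △ T)) T) (eliminate-nodef vs {flip c c′ S A} nodef) supp))
      where
      done : ∃[ R ] (Supp (return ⊥) R × Supp (return (S △ R)) T) → T ≡ S
      done (_ , here refl , here refl) = △-⊥ S
    finish : ∀ {S S′} → Elim A S′ → S ∈ˡ S′ ∷ [] →
           Supp (after S) T → Elim A T
    finish el (here refl) supp = subst (Elim A) (sym (tail≡ (elim-nodef near el) supp)) el
    rep : ∀ {e g h} → Deficient A v → TwoAt A v g h → e ≡ g ⊎ e ≡ h → ∃[ S ] (Elim A S × e ∈ S × Incident v e)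
    rep def t (inj₁ refl) = map₂ (λ (el , p) → el , p , incˡ t) (exist def (incˡ t) (onˡ t))
    rep def t (inj₂ refl) = map₂ (λ (el , p) → el , p , incʳ t) (exist def (incʳ t) (onʳ t))
    split : Dec (Deficient A v) → Elim A T
    split (no ok)   = supp-eliminateAt vs {A} {T} near exist (w , later ok w∈ , defw) (subst (λ d → Supp d T)
        (eliminate-skip {v} {vs} {A} ok) supp)
    split (yes def) =
      let e , e∈ , supp₁ = supp->>= {d = uniform (repeatedEdges A v)} {f = along} (subst (λ d → Supp d T)
              (eliminate-at {v} {vs} {A} def) supp)
          S , S∈ , supp₂ = supp->>= {d = uniform (paths e)} {f = after} supp₁
          g , h , t = near v
          S′ , el , e∈S′ , i = rep def t (proj₂ (proj₂ (repeated-edges t def))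
              (supp-uniform {xs = repeatedEdges A v} e∈))
      in finish el (subst (S ∈ˡ_) (maximal-unique near el def e∈S′ i) (supp-uniform {xs = paths e} S∈)) supp₂

  supp-eliminate-nodef : ∀ {A T} → NoDef A → Supp (eliminate c c′ A) T → T ≡ ⊥
  supp-eliminate-nodef {A} {T} nodef supp = supp-return (subst (λ d → Supp d T) (eliminate-nodef (allFin #V) {A}
      nodef) supp)

odd : ∀ j → ¬ 2 ∣ suc (2 * j)
odd j 2∣ = case ∣1⇒≡1 (∣m+n∣m⇒∣n (subst (2 ∣_) (ℕ.+-comm 1 (2 * j)) 2∣) (divides j (ℕ.*-comm 2 j))) of λ ()

-- Orbits of a relation that is injective away from the starting point

module Orbits {n : ℕ} (N : Fin n → Fin n → Set) (N? : ∀ x y → Dec (N x y)) (e : Fin n)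
              (inj : ∀ {x y z} → N x z → N y z → z ≢ e → x ≡ y) where

  open DecMembership (Fin._≟_ {n}) using () renaming (_∈?_ to _∈ˡ?_)

  -- The last element comes first.
  data Strand : Fin n → List (Fin n) → Set where
    start : Strand e (e ∷ [])
    step  : ∀ {x xs y} → Strand x xs → N x y → y ∉ˡ xs → Strand y (y ∷ xs)

  start∈ : ∀ {x xs} → Strand x xs → e ∈ˡ xs
  start∈ start        = here refl
  start∈ (step s _ _) = there (start∈ s)

  last∈ : ∀ {x xs} → Strand x xs → x ∈ˡ xs
  last∈ start        = here refl
  last∈ (step _ _ _) = here refl

  strand-unique : ∀ {x xs} → Strand x xs → Unique xs
  strand-unique start          = All.[] AllPairs.∷ AllPairs.[]
  strand-unique (step s _ y∉) = All.¬Any⇒All¬ _ y∉ AllPairs.∷ strand-unique s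

  strand-length : ∀ {x xs} → Strand x xs → length xs ℕ.≤ n
  strand-length {xs = xs} s = subst (length xs ℕ.≤_) (List.length-tabulate {n = n} id)
    (unique-length _≡_ (strand-unique s) (λ {x} _ → x , ∈ˡ.∈-allFin x , refl) (λ { _ _ refl refl → refl }))

  predecessor : ∀ {x xs y} → Strand x xs → y ∈ˡ xs → y ≢ e → ∃[ z ] (z ∈ˡ xs × z ≢ x × N z y)
  predecessor start (here refl) y≢e = contradiction refl y≢e
  predecessor (step {x} s nxy y∉) (here refl) _ = x , there (last∈ s) , (λ { refl → y∉ (last∈ s) }) , nxy
  predecessor (step s _ y∉) (there y∈) y≢e with predecessor s y∈ y≢e
  ... | z , z∈ , _ , nzy = z , there z∈ , (λ { refl → y∉ z∈ }) , nzy

  successor : ∀ {x xs z} → Strand x xs → z ∈ˡ xs → z ≢ x → ∃[ y ] (y ∈ˡ xs × y ≢ e × N z y)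
  successor start (here refl) z≢x = contradiction refl z≢x
  successor (step _ _ _) (here refl) z≢x = contradiction refl z≢x
  successor {z = z} (step {x} {y = y} s nxy y∉) (there z∈) z≢y with z Fin.≟ x
  ... | yes refl = y , here refl , (λ { refl → y∉ (start∈ s) }) , nxy
  ... | no z≢x with successor s z∈ z≢x
  ...   | y′ , y′∈ , y′≢e , nzy = y′ , there y′∈ , y′≢e , nzy

  record Orbit : Set where
    constructor orbit
    field
      {last}   : Fin n
      {list}   : List (Fin n)
      strand   : Strand last list
      stop     : (∀ y → ¬ N last y) ⊎ N last e

  -- A successor `y` that is already listed and differs from `e` would have a second predecessor
  -- besides `x`, against injectivity. So the walk can only get stuck or return to `e`. The fuel `m`
  -- is at least the number of elements not yet visited.
  extend : ∀ m {x xs} → Strand x xs → n ℕ.≤ m ℕ.+ length xs → Orbit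
  extend m {x} {xs} s le with Fin.any? (N? x)
  ... | no none = orbit s (inj₁ (λ y nxy → none (y , nxy)))
  ... | yes (y , nxy) with y ∈ˡ? xs
  extend m       {x} {xs} s le | yes (y , nxy) | yes y∈ with y Fin.≟ e
  ...   | yes refl = orbit s (inj₂ nxy)
  ...   | no y≢e with predecessor s y∈ y≢e
  ...     | z , _ , z≢x , nzy = contradiction (inj nzy nxy y≢e) z≢x
  extend zero    {x} {xs} s le | yes (y , nxy) | no y∉ =
    contradiction (ℕ.≤-trans (strand-length (step s nxy y∉)) le) ℕ.1+n≰n
  extend (suc m) {x} {xs} s le | yes (y , nxy) | no y∉ =
    extend m (step s nxy y∉) (subst (n ℕ.≤_) (sym (ℕ.+-suc m (length xs))) le)

  existence : Orbit
  existence = extend n start (ℕ.m≤m+n n 1)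

  strand-parity : ∀ {x xs} (P Q : Fin n → Set) → P e → (∀ {x y} → N x y → P x → Q y) → (∀ {x y} → N x y → Q x → P y) →
                  Strand x xs → (P x × ∃[ j ] length xs ≡ suc (2 * j)) ⊎ (Q x × ∃[ j ] length xs ≡ 2 * j)
  strand-parity P Q Pe PQ QP start = inj₁ (Pe , 0 , refl)
  strand-parity P Q Pe PQ QP (step s nxy _) with strand-parity P Q Pe PQ QP s
  ... | inj₁ (Px , j , eq) = inj₂ (PQ nxy Px , suc j , trans (cong suc eq) (sym (ℕ.*-suc 2 j)))
  ... | inj₂ (Qx , j , eq) = inj₁ (QP nxy Qx , j , cong suc eq)

  set : List (Fin n) → Subset n
  set xs = subset (λ x → x ∈ˡ? xs)

  ∈-set : ∀ xs {x} → x ∈ˡ xs → x ∈ set xs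
  ∈-set xs = ∈-subset (λ x → x ∈ˡ? xs)

  ∈-set⁻ : ∀ xs {x} → x ∈ set xs → x ∈ˡ xs
  ∈-set⁻ xs = ∈-subset⁻ (λ x → x ∈ˡ? xs)

  ∣set∣ : ∀ {x xs} → Strand x xs → ∣ set xs ∣ ≡ length xs
  ∣set∣ {xs = xs} s = trans (∣∣≡count (set xs)) (ℕ.≤-antisym
    (unique-length _≡_ (filter-unique (_∈? set xs)) (λ {x} x∈ → x , ∈-set⁻ xs (∈-filter⁻ (_∈? set xs) x∈) ,
        refl) (λ { _ _ refl refl → refl }))
    (unique-length _≡_ (strand-unique s) (λ {x} x∈ → x , ∈-filter (_∈? set xs) (∈-set xs x∈) , refl)
        (λ { _ _ refl refl → refl })))

-- Alternating walks

module Walks (G : BipartiteGraph) where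

  open BipartiteGraph G
  open Graph G

  module _ {N : Edge → Edge → Set} {N? : ∀ x y → Dec (N x y)} {e : Edge} {inj : ∀ {x y z} → N x z → N y z →
      z ≢ e → x ≡ y}
           (adjacent : ∀ {x y} → N x y → Adjacent x y) where

    open Orbits N N? e inj

    strand-linked : ∀ {x xs} (S : Subgraph) → (∀ {f} → f ∈ˡ xs → f ∈ S) → Strand x xs →
                    ∀ {f g} → f ∈ˡ xs → g ∈ˡ xs → Linked S (length xs) f g
    strand-linked S ∈S start (here refl) (here refl) = inj₁ refl
    strand-linked S ∈S (step s nxy _) (here refl) (here refl) = linked-mono {i = 0} ℕ.z≤n refl
    strand-linked S ∈S (step {xs = xs} s nxy _) (here refl) (there g∈) =
      linked-prepend (length xs) (adjacent-sym (adjacent nxy)) (∈S (there (last∈ s)))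
          (strand-linked S (∈S ∘ there) s (last∈ s) g∈)
    strand-linked S ∈S (step {x} s nxy _) (there f∈) (here refl) =
      inj₂ (∈S (here refl) , x , strand-linked S (∈S ∘ there) s f∈ (last∈ s) , adjacent nxy)
    strand-linked S ∈S (step s _ _) (there f∈) (there g∈) = inj₁ (strand-linked S (∈S ∘ there) s f∈ g∈)

    strand-connected : ∀ {x xs} → Strand x xs → Connected (set xs)
    strand-connected {x} {xs} s = (x , ∈-set xs (last∈ s)) , λ f g f∈ g∈ →
      linked-mono (strand-length s) (strand-linked (set xs) (∈-set xs) s (∈-set⁻ xs f∈) (∈-set⁻ xs g∈))

  -- Steps along a walk with alternating colours a and b that traverses the
  -- edges of colour a away from side s.
  module Alternate {k : ℕ} (A : Edge → Fin k) (a b : Fin k) (a≢b : a ≢ b) (s : Bool) where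

    N : Edge → Edge → Set
    N g h = (A g ≡ a × A h ≡ b × end (not s) g ≡ end (not s) h) ⊎ (A g ≡ b × A h ≡ a × end s g ≡ end s h)

    N? : ∀ g h → Dec (N g h)
    N? g h = ((A g Fin.≟ a) ×-dec ((A h Fin.≟ b) ×-dec (end (not s) g Fin.≟ end (not s) h)))
       ⊎-dec ((A g Fin.≟ b) ×-dec ((A h Fin.≟ a) ×-dec (end s g Fin.≟ end s h)))

    N-colours : ∀ {g h} → N g h → (A g ≡ a × A h ≡ b) ⊎ (A g ≡ b × A h ≡ a)
    N-colours (inj₁ (p , q , _)) = inj₁ (p , q)
    N-colours (inj₂ (p , q , _)) = inj₂ (p , q)

    N-≢ : ∀ {g h} → N g h → A g ≢ A h
    N-≢ (inj₁ (p , q , _)) eq = a≢b (trans (sym p) (trans eq q))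
    N-≢ (inj₂ (p , q , _)) eq = a≢b (trans (sym q) (trans (sym eq) p))

    N-vertex : ∀ {g h} → N g h → ∃[ u ] (Incident u g × Incident u h)
    N-vertex {g} {h} (inj₁ (_ , _ , eq)) = end (not s) g , end-incident (not s) g , subst (λ u → Incident u h)
        (sym eq) (end-incident (not s) h)
    N-vertex {g} {h} (inj₂ (_ , _ , eq)) = end s g , end-incident s g , subst (λ u → Incident u h) (sym eq)
        (end-incident s h)

    N-adjacent : ∀ {g h} → N g h → Adjacent g h
    N-adjacent n = (λ { refl → N-≢ n refl }) , N-vertex n

-- Maximal alternating paths from a deficient vertex

module Strips (G : BipartiteGraph) (k : ℕ) (regular : BipartiteGraph.Regular G k)
              (c c′ : Fin k) (c≢c′ : c ≢ c′) where

  open Elimination G k regular c c′ c≢c′ public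
  open Walks G

  record TwoDef (A : Assignment) (v w : Vertex) : Set where
    constructor twoDef
    field
      neq     : v ≢ w
      defˡ    : Deficient A v
      defʳ    : Deficient A w
      onlyDef : ∀ {u} → Deficient A u → u ≡ v ⊎ u ≡ w
  open TwoDef public

  twoDef-swap : ∀ {A v w} → TwoDef A v w → TwoDef A w v
  twoDef-swap t = twoDef (λ eq → neq t (sym eq)) (defʳ t) (defˡ t) (λ d → swap (onlyDef t d))

  -- The maximal alternating path that leaves the deficient vertex v along e.
  record Strip (A : Assignment) (v : Vertex) (e : Edge) : Set where
    field
      w           : Vertex
      S           : Subgraph
      w≢v         : w ≢ v
      defw        : Deficient A w
      e∈          : e ∈ S
      connected   : Connected S
      coloured    : CS A S
      alternating : Alternating A S
      degv        : deg S v ≡ 1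
      degw        : deg S w ≡ 1
      others      : ∀ {u} → Deficient A u → u ≢ v → u ≢ w → deg S u ≢ 1
      inner       : ∀ {u} → ¬ Deficient A u → deg S u ≢ 1
      -- An even number of edges leads back to the starting side and ends with the colour other than
      -- that of `e`, which `w` then repeats; an odd number leads to the other side.
      parity      : (2 ∣ ∣ S ∣ × side w ≡ side v × (∀ f → Incident w f → OnH A f → lookup A f ≢ lookup A e)) ⊎
          (¬ 2 ∣ ∣ S ∣ × side w ≢ side v)

  deficient-same : ∀ {A u g h} → Near A → Deficient A u → Incident u g → Incident u h → OnH A g → OnH A h →
      lookup A g ≡ lookup A h
  deficient-same {A} {u} {g} {h} near def ig ih og oh with lookup A g Fin.≟ lookup A h
  ... | yes eq = eq
  ... | no neq = contradiction def (differ⇒ok {A} near ig ih og oh neq)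

  module _ {A : Assignment} {v : Vertex} {e : Edge} (near : Near A) (defv : Deficient A v) (iv : Incident v e)
      (on : OnH A e) where

    private
      a b : Colour
      a = lookup A e
      b = τ a
      a≢b : a ≢ b
      a≢b eq = τ-≢ on (sym eq)
      s = side v
      open Alternate (lookup A) a b a≢b s

      N-on : ∀ {g h} → N g h → OnH A g × OnH A h
      N-on n with N-colours n
      ... | inj₁ (p , q) = subst In (sym p) on , subst In (sym q) (τ-in on)
      ... | inj₂ (p , q) = subst In (sym p) (τ-in on) , subst In (sym q) on

      same-mate : ∀ {u x y z} → Incident u x → Incident u y → Incident u z → OnH A x → OnH A y → OnH A z →
          x ≢ z → y ≢ z → x ≡ y
      same-mate ix iy iz ox oy oz x≢z y≢z with focus near iz oz
      ... | h , t with only t ix ox | only t iy oy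
      ... | inj₁ p | _ = contradiction p x≢z
      ... | _ | inj₁ q = contradiction q y≢z
      ... | inj₂ p | inj₂ q = trans p (sym q)

      N-side : ∀ {g h} → N g h → ∃[ u ] (Incident u g × Incident u h × ((lookup A h ≡ b × side u ≡ not s) ⊎
          (lookup A h ≡ a × side u ≡ s)))
      N-side {g} {h} (inj₁ (_ , p , eq)) = end (not s) g , end-incident (not s) g , subst (λ u → Incident u h)
          (sym eq) (end-incident (not s) h) , inj₁ (p , side-end (not s) g)
      N-side {g} {h} (inj₂ (_ , p , eq)) = end s g , end-incident s g , subst (λ u → Incident u h) (sym eq)
          (end-incident s h) , inj₂ (p , side-end s g)

      -- Bipartiteness at work: the colour of `z` fixes the side on which the walk enters it. So
      -- both predecessors meet `z` at the same vertex, which has only one further edge of the two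
      -- colours.
      N-inj : ∀ {x y z} → N x z → N y z → z ≢ e → x ≡ y
      N-inj {x} {y} {z} n m _ with N-side n | N-side m
      ... | u , ix , iz , p | u′ , iy , iz′ , q =
        same-mate ix (subst (λ w → Incident w y) (incident-same iz′ iz (sym (sides p q))) iy) iz
            (proj₁ (N-on n)) (proj₁ (N-on m)) (proj₂ (N-on n)) (λ { refl → N-≢ n refl }) (λ { refl → N-≢ m refl })
        where
        sides : ∀ {u u′} → (lookup A z ≡ b × side u ≡ not s) ⊎ (lookup A z ≡ a × side u ≡ s) →
            (lookup A z ≡ b × side u′ ≡ not s) ⊎ (lookup A z ≡ a × side u′ ≡ s) → side u ≡ side u′
        sides (inj₁ (_ , p)) (inj₁ (_ , q)) = trans p (sym q)
        sides (inj₂ (_ , p)) (inj₂ (_ , q)) = trans p (sym q)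
        sides (inj₁ (p , _)) (inj₂ (q , _)) = contradiction (trans (sym q) p) a≢b
        sides (inj₂ (p , _)) (inj₁ (q , _)) = contradiction (trans (sym p) q) a≢b

      open Orbits N N? e N-inj

      -- Returning to `e` would mean arriving at `v` along the other colour, but the edges of both
      -- colours at the deficient vertex `v` agree.
      not-to-e : ∀ {z} → ¬ N z e
      not-to-e {z} n@(inj₁ (_ , p , _)) = a≢b p
      not-to-e {z} n@(inj₂ (_ , _ , eq)) =
        N-≢ n (deficient-same {A} near defv (subst (λ u → Incident u z) (trans eq (incident⇒end iv))
            (end-incident s z)) iv (proj₁ (N-on n)) on)

      module OfStrand {last : Edge} {list : List Edge} (strand : Strand last list) (stop : (∀ y → ¬ N last y) ⊎
          N last e) where

        ab : ∀ {f} → f ∈ˡ list → lookup A f ≡ a ⊎ lookup A f ≡ b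
        ab {f} f∈ = decide (f Fin.≟ e)
          where
          decide : Dec (f ≡ e) → lookup A f ≡ a ⊎ lookup A f ≡ b
          decide (yes f≡e) = inj₁ (cong (lookup A) f≡e)
          decide (no f≢e)  =
            let z , _ , _ , n = predecessor strand f∈ f≢e
            in [ (λ (_ , q) → inj₂ q) , (λ (_ , q) → inj₁ q) ]′ (N-colours n)

        on-list : ∀ {f} → f ∈ˡ list → OnH A f
        on-list f∈ with ab f∈
        ... | inj₁ eq = subst In (sym eq) on
        ... | inj₂ eq = subst In (sym eq) (τ-in on)

        End : Vertex → Set
        End w = (lookup A last ≡ a × side w ≡ not s) ⊎ (lookup A last ≡ b × side w ≡ s)

        ends : ∃[ w ] (Incident w last × End w)
        ends with ab (last∈ strand)
        ... | inj₁ eq = end (not s) last , end-incident (not s) last , inj₁ (eq , side-end (not s) last)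
        ... | inj₂ eq = end s last , end-incident s last , inj₂ (eq , side-end s last)

        -- The far end of the last edge is deficient since the walk cannot be continued there.
        module OfEnd (w : Vertex) (iw : Incident w last) (kind : End w) where

          S : Subgraph
          S = set list

          N-last : ∀ {h} → Incident w h → OnH A h → lookup A last ≢ lookup A h → N last h
          N-last {h} ih oh neq = lemma kind
            where
            lemma : End w → N last h
            lemma (inj₁ (eq , sd)) = inj₁ (eq , sym (τ-other on oh (λ p → neq (trans eq p))) ,
                trans (incident-end iw sd) (sym (incident-end ih sd)))
            lemma (inj₂ (eq , sd)) = inj₂ (eq , in-third (τ-in on) oh on (λ p → neq (trans eq p))
                (λ p → a≢b (sym p)) , trans (incident-end iw sd) (sym (incident-end ih sd)))

          last-stop : ∀ y → ¬ N last y
          last-stop y n = [ (λ none → none y n) , not-to-e ]′ stop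

          defw : Deficient A w
          defw with focus near iw (on-list (last∈ strand))
          ... | h , t with lookup A last Fin.≟ lookup A h
          ...   | yes eq = ≡⇒def t eq
          ...   | no neq = contradiction (N-last (incʳ t) (onʳ t) neq) (last-stop h)

          w≢v : w ≢ v
          w≢v w≡v = lemma kind
            where
            lemma : ¬ End w
            lemma (inj₁ (_ , sd)) = Bool.not-¬ refl (trans (cong side (sym w≡v)) sd)
            lemma (inj₂ (eq , _)) = a≢b (trans (deficient-same {A} near defv iv (subst (λ u → Incident u last)
                w≡v iw) on (on-list (last∈ strand))) eq)

          -- Inside the walk every edge is followed or preceded at each of its ends, except for the two outer ends.
          mate : ∀ {u g} → g ∈ˡ list → Incident u g → (u ≡ w × g ≡ last) ⊎ (u ≡ v × g ≡ e) ⊎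
              ∃[ p ] (p ∈ˡ list × Incident u p × lookup A g ≢ lookup A p)
          mate {u} {g} g∈ iu = split (Bool._≟_ (side u) s) (ab g∈)
            where
            Goal : Set
            Goal = (u ≡ w × g ≡ last) ⊎ (u ≡ v × g ≡ e) ⊎ ∃[ p ] (p ∈ˡ list × Incident u p × lookup A g ≢ lookup A p)
            at-tail : ∀ d → side u ≡ d → (∀ {z} → N z g → end d z ≡ end d g) → (g ≡ e → u ≡ v) → Goal
            at-tail d sd meet at-e = decide (g Fin.≟ e)
              where
              decide : Dec (g ≡ e) → Goal
              decide (yes g≡e) = inj₂ (inj₁ (at-e g≡e , g≡e))
              decide (no g≢e)  =
                let z , z∈ , _ , n = predecessor strand g∈ g≢e
                in inj₂ (inj₂ (z , z∈ , subst (λ u → Incident u z) (trans (meet n) (incident-end iu sd))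
                    (end-incident d z) , λ p → N-≢ n (sym p)))
            at-head : ∀ d → side u ≡ d → (∀ {y} → N g y → end d g ≡ end d y) → (g ≡ last → u ≡ w) → Goal
            at-head d sd meet at-last = decide (g Fin.≟ last)
              where
              decide : Dec (g ≡ last) → Goal
              decide (yes g≡last) = inj₁ (at-last g≡last , g≡last)
              decide (no g≢last)  =
                let y , y∈ , _ , n = successor strand g∈ g≢last
                in inj₂ (inj₂ (y , y∈ , subst (λ u → Incident u y) (trans (sym (meet n)) (incident-end iu sd))
                    (end-incident d y) , N-≢ n))
            at-end : g ≡ last → (lookup A last ≡ a → side u ≡ not s) → (lookup A last ≡ b → side u ≡ s) → u ≡ w
            at-end g≡last pa pb = incident-same (subst (Incident u) g≡last iu) iw
              ([ (λ (q , sd) → trans (pa q) (sym sd)) , (λ (q , sd) → trans (pb q) (sym sd)) ]′ kind)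
            -- Colour `a` is traversed away from side `s` and `b` towards it, so the side of `u` and
            -- the colour of `g` decide whether the mate precedes or follows `g`.
            split : Dec (side u ≡ s) → lookup A g ≡ a ⊎ lookup A g ≡ b → Goal
            split (yes su) (inj₁ ga) = at-tail s su
              (λ { (inj₁ (_ , q , _)) → contradiction (trans (sym ga) q) a≢b ; (inj₂ (_ , _ , eq)) → eq })
              (λ g≡e → incident-same (subst (Incident u) g≡e iu) iv su)
            split (yes su) (inj₂ gb) = at-head s su
              (λ { (inj₁ (q , _ , _)) → contradiction (trans (sym q) gb) a≢b ; (inj₂ (_ , _ , eq)) → eq })
              (λ g≡last → at-end g≡last (λ q → contradiction
                  (trans (sym q) (trans (cong (lookup A) (sym g≡last)) gb)) a≢b) (λ _ → su))
            split (no su) (inj₁ ga) = at-head (not s) (Bool.¬-not su)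
              (λ { (inj₂ (q , _ , _)) → contradiction (trans (sym ga) q) a≢b ; (inj₁ (_ , _ , eq)) → eq })
              (λ g≡last → at-end g≡last (λ _ → Bool.¬-not su)
                  (λ q → contradiction (trans (sym ga) (trans (cong (lookup A) g≡last) q)) a≢b))
            split (no su) (inj₂ gb) = at-tail (not s) (Bool.¬-not su)
              (λ { (inj₂ (_ , q , _)) → contradiction (trans (sym q) gb) a≢b ; (inj₁ (_ , _ , eq)) → eq })
              (λ g≡e → contradiction (trans (cong (lookup A) (sym g≡e)) gb) a≢b)

          colouredˢ : CS A S
          colouredˢ f f∈ = on-list (∈-set⁻ list f∈)

          -- An inner vertex of the walk carries two edges of different colours, hence is not
          -- deficient.
          outer : ∀ {u g} → Deficient A u → g ∈ S → Incident u g → (u ≡ w × g ≡ last) ⊎ (u ≡ v × g ≡ e)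
          outer {u} {g} def g∈ iu with mate (∈-set⁻ list g∈) iu
          ... | inj₁ p        = inj₁ p
          ... | inj₂ (inj₁ p) = inj₂ p
          ... | inj₂ (inj₂ (p , p∈ , ip , neq)) = contradiction (deficient-same {A} near def iu ip
                  (colouredˢ g g∈) (on-list p∈)) neq

          degv : deg S v ≡ 1
          degv = count-1 (λ f → incident? v f ×-dec (f ∈? S)) (iv , ∈-set list (start∈ strand)) λ f (i , f∈) →
              case outer defv f∈ i of λ
            { (inj₁ (v≡w , _)) → contradiction (sym v≡w) w≢v ; (inj₂ (_ , eq)) → eq }

          degw : deg S w ≡ 1
          degw = count-1 (λ f → incident? w f ×-dec (f ∈? S)) (iw , ∈-set list (last∈ strand)) λ f (i , f∈) →
              case outer defw f∈ i of λ
            { (inj₁ (_ , eq)) → eq ; (inj₂ (w≡v , _)) → contradiction w≡v w≢v }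

          others : ∀ {u} → Deficient A u → u ≢ v → u ≢ w → deg S u ≢ 1
          others {u} def u≢v u≢w eq with count-1⁻ (λ f → incident? u f ×-dec (f ∈? S)) eq
          ... | f , (i , f∈) , _ with outer def f∈ i
          ...   | inj₁ (p , _) = u≢w p
          ...   | inj₂ (p , _) = u≢v p

          inner : ∀ {u} → ¬ Deficient A u → deg S u ≢ 1
          inner {u} ok eq with count-1⁻ (λ f → incident? u f ×-dec (f ∈? S)) eq
          ... | f , (i , f∈) , single with mate (∈-set⁻ list f∈) i
          ...   | inj₁ (refl , _)        = ok defw
          ...   | inj₂ (inj₁ (refl , _)) = ok defv
          ...   | inj₂ (inj₂ (p , p∈ , ip , neq)) = neq (cong (lookup A) (sym (single p (ip , ∈-set list p∈))))

          alternatingˢ : Alternating A S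
          alternatingˢ f g f∈ g∈ (f≢g , u , i , j) eq with focus near i (colouredˢ f f∈)
          ... | h , t with only t j (colouredˢ g g∈)
          ...   | inj₁ g≡f = f≢g (sym g≡f)
          ...   | inj₂ refl with outer (≡⇒def t eq) f∈ i | outer (≡⇒def t eq) g∈ j
          ...     | inj₁ (_ , p) | inj₁ (_ , q) = f≢g (trans p (sym q))
          ...     | inj₂ (_ , p) | inj₂ (_ , q) = f≢g (trans p (sym q))
          ...     | inj₁ (p , _) | inj₂ (q , _) = w≢v (trans (sym p) q)
          ...     | inj₂ (p , _) | inj₁ (q , _) = w≢v (trans (sym q) p)

          parity : (2 ∣ ∣ S ∣ × side w ≡ s × (∀ f → Incident w f → OnH A f → lookup A f ≢ a)) ⊎
              (¬ 2 ∣ ∣ S ∣ × side w ≢ s)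
          parity = lemma kind (strand-parity (λ x → lookup A x ≡ a) (λ x → lookup A x ≡ b) refl ab→ ba→ strand)
            where
            ab→ : ∀ {x y} → N x y → lookup A x ≡ a → lookup A y ≡ b
            ab→ (inj₁ (_ , q , _)) _ = q
            ab→ (inj₂ (p , _ , _)) r = contradiction (trans (sym r) p) a≢b
            ba→ : ∀ {x y} → N x y → lookup A x ≡ b → lookup A y ≡ a
            ba→ (inj₂ (_ , q , _)) _ = q
            ba→ (inj₁ (p , _ , _)) r = contradiction (trans (sym p) r) a≢b
            lemma : End w → _ → (2 ∣ ∣ S ∣ × side w ≡ s × (∀ f → Incident w f → OnH A f → lookup A f ≢ a)) ⊎
                (¬ 2 ∣ ∣ S ∣ × side w ≢ s)
            lemma (inj₁ (p , sd)) (inj₁ (_ , j , eq)) =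
                inj₂ (subst (λ m → ¬ 2 ∣ m) (sym (trans (∣set∣ strand) eq)) (odd j) , λ eq′ → Bool.not-¬ refl
                (trans (sym eq′) sd))
            lemma (inj₂ (p , sd)) (inj₂ (_ , j , eq)) = inj₁ (subst (2 ∣_) (sym (trans (∣set∣ strand) eq))
                (divides j (ℕ.*-comm 2 j)) , sd ,
              λ f i o eq′ → a≢b (trans (sym eq′) (trans (deficient-same {A} near defw i iw o
                  (on-list (last∈ strand))) p)))
            lemma (inj₁ (p , _)) (inj₂ (q , _)) = contradiction (trans (sym p) q) a≢b
            lemma (inj₂ (p , _)) (inj₁ (q , _)) = contradiction (trans (sym q) p) a≢b

          strip : Strip A v e
          strip = record { w = w ; S = S ; w≢v = w≢v ; defw = defw ; e∈ = ∈-set list (start∈ strand) ;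
              connected = strand-connected N-adjacent strand
                         ; coloured = colouredˢ ; alternating = alternatingˢ ; degv = degv ; degw =
                             degw ; others = others ; inner = inner ; parity = parity }

    strip-exists : Strip A v e
    strip-exists =
      let orbit strand stop = existence
          w , iw , kind = OfStrand.ends strand stop
      in OfStrand.OfEnd.strip strand stop w iw kind

-- Pairs of deficient vertices, and the recolouring of one edge

module Deficits (G : BipartiteGraph) (k : ℕ) (regular : BipartiteGraph.Regular G k)
                (c c′ : Fin k) (c≢c′ : c ≢ c′) where

  open Strips G k regular c c′ c≢c′ public

  -- Deficiencies of opposite types lie on the same side, since an alternating path joins them.
  Opposite : Assignment → Vertex → Vertex → Set
  Opposite A v w = side w ≡ side v × (∀ a → Repeated A v a → ¬ Repeated A w a)

  deficient-repeated : ∀ {A u f} → Near A → Deficient A u → Incident u f → OnH A f → Repeated A u (lookup A f)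
  deficient-repeated near def i o =
    let h , t = focus near i o in _ , ≡⇒deficiency t (def⇒≡ t def)

  deg-≤2 : ∀ {A S} → Near A → CS A S → ∀ u → deg S u ℕ.≤ 2
  deg-≤2 near cs u with near u
  ... | g , h , t with degree cs t
  ...   | both _ _ eq    = ℕ.≤-reflexive eq
  ...   | left _ _ eq    = ℕ.≤-trans (ℕ.≤-reflexive eq) (ℕ.s≤s ℕ.z≤n)
  ...   | right _ _ eq   = ℕ.≤-trans (ℕ.≤-reflexive eq) (ℕ.s≤s ℕ.z≤n)
  ...   | neither _ _ eq = ℕ.≤-trans (ℕ.≤-reflexive eq) ℕ.z≤n

  deg-1⇒edge : ∀ S u → deg S u ≡ 1 → ∃[ e ] (Incident u e × e ∈ S)
  deg-1⇒edge S u eq = let e , p , _ = count-1⁻ (λ f → incident? u f ×-dec (f ∈? S)) eq in e , p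

  -- The far end of a strip is deficient and different from `v`; with only two deficient vertices it
  -- has to be `w`.
  strip-elim : ∀ {A v w e} → Near A → TwoDef A v w → (st : Strip A v e) → Elim A (Strip.S st)
  strip-elim {A} {v} {w} near td st = elim
    (Strip.connected st , deg-≤2 near (Strip.coloured st) , v , Strip.degv st)
    (Strip.coloured st) (Strip.alternating st) end⇒ ⇒end
    where
    w≡ : Strip.w st ≡ w
    w≡ with onlyDef td (Strip.defw st)
    ... | inj₁ eq = contradiction eq (Strip.w≢v st)
    ... | inj₂ eq = eq
    end⇒ : ∀ u → deg (Strip.S st) u ≡ 1 → Deficient A u
    end⇒ u eq with deficient? A u
    ... | yes def = def
    ... | no ok   = contradiction eq (Strip.inner st ok)
    ⇒end : ∀ u → Deficient A u → deg (Strip.S st) u ≡ 1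
    ⇒end u def with onlyDef td def
    ... | inj₁ refl = Strip.degv st
    ... | inj₂ refl = subst (λ x → deg (Strip.S st) x ≡ 1) w≡ (Strip.degw st)

  -- One inclusion is `alternating-⊆`. For the other, a vertex at which `S` passes on has edges of
  -- different colours, so it is not deficient, and strips do not end at such vertices.
  strip-unique : ∀ {A S v e} → Near A → Elim A S → (st : Strip A v e) → e ∈ S → Strip.S st ≡ S
  strip-unique {A} {S} {v} {e} near el st e∈ = subset-≡
    (alternating-⊆ near el (Strip.connected st) (Strip.coloured st) (Strip.alternating st) (Strip.e∈ st) e∈)
    (connected-⊆ (_∈ Strip.S st) (proj₁ (path el)) e∈ (Strip.e∈ st) step)
    where
    step : ∀ {g f} → g ∈ S → g ∈ Strip.S st → f ∈ S → Adjacent g f → f ∈ Strip.S st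
    step {g} {f} g∈ g∈st f∈ (g≢f , u , i , j) with focus near i (coloured el g g∈)
    ... | h , t with only t j (coloured el f f∈)
    ...   | inj₁ f≡g = contradiction (sym f≡g) g≢f
    ...   | inj₂ refl with degree (Strip.coloured st) t
    ...     | both _ q _    = q
    ...     | right p _ _   = contradiction g∈st p
    ...     | neither p _ _ = contradiction g∈st p
    ...     | left _ _ eq   = contradiction eq (Strip.inner st (differ⇒ok {A} near i j (coloured el g g∈)
            (coloured el f f∈) (alternating el g f g∈ f∈ (g≢f , u , i , j))))

  twoDef-elim : ∀ {A v w} → Near A → TwoDef A v w → ∀ {x e} → Deficient A x → Incident x e → OnH A e →
      ∃[ S ] (Elim A S × e ∈ S)
  twoDef-elim {A} {v} {w} near td {x} {e} def i o with onlyDef td def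
  ... | inj₁ refl = let st = strip-exists near def i o in Strip.S st , strip-elim near td st , Strip.e∈ st
  ... | inj₂ refl = let st = strip-exists near def i o in Strip.S st , strip-elim near (twoDef-swap td) st , Strip.e∈ st

  elim-exists : ∀ {A v w} → Near A → TwoDef A v w → ∃[ S ] Elim A S
  elim-exists {A} {v} near td =
    let g , h , t = near v
        S , el , _ = twoDef-elim near td (defˡ td) (incˡ t) (onˡ t)
    in S , el

  supp-eliminate : ∀ {A v w T} → Near A → TwoDef A v w → Supp (eliminate c c′ A) T → Elim A T
  supp-eliminate {A} {v} {w} {T} near td =
    supp-eliminateAt (allFin #V) {A} {T} near (twoDef-elim near td) (v , ∈ˡ.∈-allFin v , defˡ td)

  Parity : Assignment → Vertex → Vertex → Subgraph → Set
  Parity A v w S = (2 ∣ ∣ S ∣ × Opposite A v w) ⊎ (¬ 2 ∣ ∣ S ∣ × side w ≢ side v)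

  strip-parity : ∀ {A v e} → Near A → Deficient A v → Incident v e → OnH A e → (st : Strip A v e) →
      Parity A v (Strip.w st) (Strip.S st)
  strip-parity {A} {v} {e} near def i o st = lemma (Strip.parity st)
    where
    w = Strip.w st
    clash : (∀ f → Incident w f → OnH A f → lookup A f ≢ lookup A e) → ∀ a → Repeated A v a → ¬ Repeated A w a
    clash neq a rv rw =
      let g , h , t = near w
          _ , t′ = focus near i o
      in neq g (incˡ t) (onˡ t) (trans (sym (repeated⇒≡ {d = a} t rw)) (repeated⇒≡ {d = a} t′ rv))
    lemma : _ → Parity A v w (Strip.S st)
    lemma (inj₂ p) = inj₂ p
    lemma (inj₁ (even , sd , neq)) = inj₁ (even , sd , clash neq)

  -- `IsPath` promises just one vertex of degree 1. Identifying the path with the strip that starts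
  -- there yields its second end, and with it the relation between the length and the sides of the
  -- ends.
  elim⇒strip : ∀ {A S} → Near A → Elim A S → ∃[ v ] ∃[ w ] (TwoDef A v w × Parity A v w S)
  elim⇒strip {A} {S} near el =
    let v , eq = proj₂ (proj₂ (path el))
        def = end⇒def el v eq
        e , i , e∈ = deg-1⇒edge S v eq
        st = strip-exists near def i (coloured el e e∈)
        S≡ = strip-unique near el st e∈
        w = Strip.w st
        only′ : ∀ {u} → Deficient A u → u ≡ v ⊎ u ≡ w
        only′ {u} d = case u Fin.≟ v of λ
          { (yes p) → inj₁ p
          ; (no u≢v) → case u Fin.≟ w of λ
            { (yes p) → inj₂ p
            ; (no u≢w) → contradiction (subst (λ T → deg T u ≡ 1) (sym S≡) (def⇒end el u d))
                (Strip.others st d u≢v u≢w) } }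
    in v , w , twoDef (λ p → Strip.w≢v st (sym p)) def (Strip.defw st) only′ ,
       subst (Parity A v w) S≡ (strip-parity near def i (coloured el e e∈) st)

  same-side⇒even : ∀ {A S v w} → Near A → TwoDef A v w → side w ≡ side v → Elim A S → 2 ∣ ∣ S ∣
  same-side⇒even {A} {S} {v} {w} near td sd el =
    let x , y , td′ , p = elim⇒strip near el
    in decide p (sides (onlyDef td (defˡ td′)) (onlyDef td (defʳ td′)))
    where
    sides : ∀ {x y} → x ≡ v ⊎ x ≡ w → y ≡ v ⊎ y ≡ w → side y ≡ side x
    sides (inj₁ refl) (inj₁ refl) = refl
    sides (inj₁ refl) (inj₂ refl) = sd
    sides (inj₂ refl) (inj₁ refl) = sym sd
    sides (inj₂ refl) (inj₂ refl) = refl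
    decide : ∀ {x y} → Parity A x y S → side y ≡ side x → 2 ∣ ∣ S ∣
    decide (inj₁ (even , _)) _  = even
    decide (inj₂ (_ , ne))   eq = contradiction eq ne


  module _ {A : Assignment} (near : Near A) {e : Edge} (on : OnH A e) where

    private
      alone : ∀ {f} → e ≢ f → f ∉ ⁅ e ⁆
      alone neq f∈ = neq (sym (Subset.x∈⁅y⁆⇒x≡y e f∈))

      away-∉ : ∀ {u f} → ¬ Incident u e → Incident u f → f ∉ ⁅ e ⁆
      away-∉ {u} away i f∈ = away (subst (Incident u) (Subset.x∈⁅y⁆⇒x≡y e f∈) i)

    -- At an end of `e` exactly one of the two edges of the two colours changes, which toggles the
    -- deficiency; at all other vertices nothing changes. This governs the lemmas that follow.
    recolour-ok : ∀ {u} → Incident u e → Deficient A u → ¬ Deficient (flip c c′ ⁅ e ⁆ A) u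
    recolour-ok i def def′ =
      let h , t = focus near i on
      in flip-toggle t (Subset.x∈⁅x⁆ e) (alone (distinct t)) (def⇒≡ (flip-two {⁅ e ⁆} t) def′) (def⇒≡ t def)

    recolour-def : ∀ {u} → Incident u e → ¬ Deficient A u → Deficient (flip c c′ ⁅ e ⁆ A) u
    recolour-def i ok =
      let h , t = focus near i on
      in ≡⇒def (flip-two {⁅ e ⁆} t) (flip-toggle′ t (Subset.x∈⁅x⁆ e) (alone (distinct t)) (ok⇒≢ t ok))

    recolour-away : ∀ {u} → ¬ Incident u e → Deficient (flip c c′ ⁅ e ⁆ A) u → Deficient A u
    recolour-away {u} away def′ =
      let g , h , t = near u
      in ≡⇒def t (trans (sym (flip-∉ A (away-∉ away (incˡ t)))) (trans (def⇒≡ (flip-two {⁅ e ⁆} t) def′)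
          (flip-∉ A (away-∉ away (incʳ t)))))

    recolour-away⁻ : ∀ {u} → ¬ Incident u e → Deficient A u → Deficient (flip c c′ ⁅ e ⁆ A) u
    recolour-away⁻ {u} away def =
      let g , h , t = near u
      in ≡⇒def (flip-two {⁅ e ⁆} t) (trans (flip-∉ A (away-∉ away (incˡ t)))
          (trans (def⇒≡ t def) (sym (flip-∉ A (away-∉ away (incʳ t))))))

    recolour-nodef : NoDef A → TwoDef (flip c c′ ⁅ e ⁆ A) (endˡ e) (endʳ e)
    recolour-nodef nodef = twoDef (end-≢ false e) (recolour-def (inj₁ refl) (nodef (endˡ e)))
        (recolour-def (inj₂ refl) (nodef (endʳ e)))
      (λ {u} def′ → split def′ (incident? u e))
      where
      split : ∀ {u} → Deficient (flip c c′ ⁅ e ⁆ A) u → Dec (Incident u e) → u ≡ endˡ e ⊎ u ≡ endʳ e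
      split     def′ (yes (inj₁ p)) = inj₁ (sym p)
      split     def′ (yes (inj₂ p)) = inj₂ (sym p)
      split {u} def′ (no away)      = contradiction (recolour-away away def′) (nodef u)

    opposite-end : Vertex → Vertex
    opposite-end v = end (not (side v)) e

    incident-ends : ∀ {u v} → Incident v e → Incident u e → u ≡ v ⊎ u ≡ opposite-end v
    incident-ends {u} {v} i j with Bool._≟_ (side u) (side v)
    ... | yes eq = inj₁ (incident-same j i eq)
    ... | no neq = inj₂ (sym (incident-end j (Bool.¬-not neq)))

    recolour-closing : ∀ {v w} → TwoDef A v w → Incident v e → Incident w e → NoDef (flip c c′ ⁅ e ⁆ A)
    recolour-closing {v} {w} td i j u def′ = split (incident? u e)
      where
      ends : Incident u e → u ≡ v ⊎ u ≡ opposite-end v → w ≡ v ⊎ w ≡ opposite-end v → u ≡ v ⊎ u ≡ w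
      ends p (inj₁ eq) _          = inj₁ eq
      ends p (inj₂ _)  (inj₁ eq)  = contradiction (sym eq) (neq td)
      ends p (inj₂ eq) (inj₂ eq′) = inj₂ (trans eq (sym eq′))
      near-end : u ≡ v ⊎ u ≡ w → Deficient A u × Incident u e
      near-end (inj₁ eq) = subst (λ x → Deficient A x × Incident x e) (sym eq) (defˡ td , i)
      near-end (inj₂ eq) = subst (λ x → Deficient A x × Incident x e) (sym eq) (defʳ td , j)
      split : ¬ Dec (Incident u e)
      split (no away) = away (proj₂ (near-end (onlyDef td (recolour-away away def′))))
      split (yes p)   = recolour-ok p (proj₁ (near-end (ends p (incident-ends i p) (incident-ends i j)))) def′

    -- The deficiency at `v` is cured and reappears at the other end of `e`. That end was not
    -- deficient before, since `w` is not on `e`.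
    recolour-moving : ∀ {v w} → TwoDef A v w → Incident v e → ¬ Incident w e → TwoDef (flip c c′ ⁅ e ⁆ A)
        (opposite-end v) w
    recolour-moving {v} {w} td i away = twoDef u≢w (recolour-def iu oku) (recolour-away⁻ away (defʳ td))
        (λ {x} def′ → split def′ (incident? x e))
      where
      u = opposite-end v
      iu : Incident u e
      iu = end-incident (not (side v)) e
      u≢w : u ≢ w
      u≢w eq = away (subst (λ x → Incident x e) eq iu)
      not-vw : ¬ (u ≡ v ⊎ u ≡ w)
      not-vw (inj₁ eq) = end-≢ (side v) e (trans (incident⇒end i) (sym eq))
      not-vw (inj₂ eq) = u≢w eq
      oku : ¬ Deficient A u
      oku def = not-vw (onlyDef td def)
      at-end : ∀ {x} → Deficient (flip c c′ ⁅ e ⁆ A) x → x ≡ v ⊎ x ≡ u → x ≡ u ⊎ x ≡ w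
      at-end def′ (inj₁ eq) = contradiction (subst (Deficient (flip c c′ ⁅ e ⁆ A)) eq def′) (recolour-ok i (defˡ td))
      at-end def′ (inj₂ eq) = inj₁ eq
      off-end : ∀ {x} → ¬ Incident x e → x ≡ v ⊎ x ≡ w → x ≡ u ⊎ x ≡ w
      off-end p (inj₁ eq) = contradiction (subst (λ x → Incident x e) (sym eq) i) p
      off-end p (inj₂ eq) = inj₂ eq
      split : ∀ {x} → Deficient (flip c c′ ⁅ e ⁆ A) x → Dec (Incident x e) → x ≡ u ⊎ x ≡ w
      split def′ (yes p) = at-end def′ (incident-ends i p)
      split def′ (no p)  = off-end p (onlyDef td (recolour-away p def′))

    recolour-deficit : ∀ {v w} → TwoDef A v w → Incident v e → NoDef (flip c c′ ⁅ e ⁆ A) ⊎ ∃[ x ] ∃[ y ]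
        (TwoDef (flip c c′ ⁅ e ⁆ A) x y × Incident x e)
    recolour-deficit {v} {w} td i = split (incident? w e)
      where
      split : Dec (Incident w e) → NoDef (flip c c′ ⁅ e ⁆ A) ⊎ ∃[ x ] ∃[ y ] (TwoDef (flip c c′ ⁅ e ⁆ A) x y ×
          Incident x e)
      split (yes j) = inj₁ (recolour-closing td i j)
      split (no j)  = inj₂ (opposite-end v , w , recolour-moving td i j , end-incident (not (side v)) e)

transpose-other : ∀ {n} {a b x y : Fin n} → x ≡ a ⊎ x ≡ b → y ≡ a ⊎ y ≡ b → x ≢ y → Perm.transpose a b x ≡ y
transpose-other (inj₁ refl) (inj₁ refl) x≢y = contradiction refl x≢y
transpose-other {x = a} {b} (inj₁ refl) (inj₂ refl) x≢y = transposeˡ a b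
transpose-other {x = b} {a} (inj₂ refl) (inj₁ refl) x≢y = transposeʳ a b
transpose-other (inj₂ refl) (inj₂ refl) x≢y = contradiction refl x≢y

two-values : ∀ {n} {a b x y z : Fin n} → x ≡ a ⊎ x ≡ b → y ≡ a ⊎ y ≡ b → z ≡ a ⊎ z ≡ b → x ≢ y → x ≢ z → y ≡ z
two-values px py pz x≢y x≢z = trans (sym (transpose-other px py x≢y)) (transpose-other px pz x≢z)

-- Flips along alternating cycles

module Cycles (G : BipartiteGraph) (k : ℕ) (regular : BipartiteGraph.Regular G k) where

  open Colourings G k regular public

  cycle-mate : ∀ A {a b F} → AlternatingCycle A a b F → ∀ {u g} → g ∈ F → Incident u g →
               ∃[ p ] (p ∈ F × Incident u p × p ≢ g × lookup A p ≢ lookup A g × (∀ {f} → f ∈ F → Incident u f →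
                   f ≡ g ⊎ f ≡ p))
  cycle-mate A {a} {b} {F} ((_ , degs) , _ , alt) {u} {g} g∈ iu = split (degs u)
    where
    at? = λ f → incident? u f ×-dec (f ∈? F)
    split : deg F u ≡ 0 ⊎ deg F u ≡ 2 → ∃[ p ] (p ∈ F × Incident u p × p ≢ g × lookup A p ≢ lookup A g ×
        (∀ {f} → f ∈ F → Incident u f → f ≡ g ⊎ f ≡ p))
    split (inj₁ eq) = contradiction (iu , g∈) (count-0⁻ at? eq g)
    split (inj₂ eq) =
      let x , y , x≢y , (ix , x∈) , (iy , y∈) , only = count-2⁻ at? eq
      in choose x≢y ix x∈ iy y∈ (λ f∈ i → only _ (i , f∈)) (only g (iu , g∈))
      where
      choose : ∀ {x y} → x ≢ y → Incident u x → x ∈ F → Incident u y → y ∈ F → (∀ {f} → f ∈ F → Incident u f →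
          f ≡ x ⊎ f ≡ y) → g ≡ x ⊎ g ≡ y →
               ∃[ p ] (p ∈ F × Incident u p × p ≢ g × lookup A p ≢ lookup A g × (∀ {f} → f ∈ F → Incident u f →
                   f ≡ g ⊎ f ≡ p))
      choose {x} {y} x≢y ix x∈ iy y∈ only (inj₁ refl) = y , y∈ , iy , (λ p → x≢y (sym p)) , alt y x y∈ x∈
          ((λ p → x≢y (sym p)) , u , iy , ix) , only
      choose {x} {y} x≢y ix x∈ iy y∈ only (inj₂ refl) = x , x∈ , ix , x≢y , alt x y x∈ y∈ (x≢y , u , ix , iy) ,
          (λ f∈ i → swap (only f∈ i))

  cycle-flip : ∀ A {a b F} → AlternatingCycle A a b F → AlternatingCycle (flip a b F A) a b F
  cycle-flip A {a} {b} {F} (cyc , col , alt) = cyc ,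
    (λ e e∈ → subst (λ x → x ≡ a ⊎ x ≡ b) (sym (flip-∈ A e∈)) (swapped (col e e∈))) ,
    (λ e f e∈ f∈ adj eq → alt e f e∈ f∈ adj (transpose-injective a b (trans (sym (flip-∈ A e∈))
        (trans eq (flip-∈ A f∈)))))
    where
    swapped : ∀ {x} → x ≡ a ⊎ x ≡ b → Perm.transpose a b x ≡ a ⊎ Perm.transpose a b x ≡ b
    swapped (inj₁ refl) = inj₂ (transposeˡ a b)
    swapped (inj₂ refl) = inj₁ (transposeʳ a b)

  -- The two cycle edges at a vertex exchange their colours.
  cycle-count-≤ : ∀ A {a b F} → AlternatingCycle A a b F → ∀ u d → #at A u d ℕ.≤ #at (flip a b F A) u d
  cycle-count-≤ A {a} {b} {F} ac@(_ , col , _) u d = split (Fin.any? (λ g → incident? u g ×-dec (g ∈? F)))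
    where
    P? = λ e → incident? u e ×-dec (lookup A e Fin.≟ d)
    Q? = λ e → incident? u e ×-dec (lookup (flip a b F A) e Fin.≟ d)
    split : Dec (∃[ g ] (Incident u g × g ∈ F)) → #at A u d ℕ.≤ #at (flip a b F A) u d
    split (no none) = count-mono P? Q? λ e (i , eq) → i , trans (flip-∉ A (λ e∈ → none (e , i , e∈))) eq
    split (yes (g , i , g∈)) =
      let p , p∈ , ip , p≢g , neq , only = cycle-mate A ac g∈ i
      in count-inj P? Q? (Perm.transpose g p) (transpose-injective g p) (moved p∈ ip neq only)
      where
      moved : ∀ {p} → p ∈ F → Incident u p → lookup A p ≢ lookup A g → (∀ {f} → f ∈ F → Incident u f → f ≡ g ⊎ f ≡ p) →
              ∀ e → Incident u e × lookup A e ≡ d → Incident u (Perm.transpose g p e) × lookup (flip a b F A)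
                  (Perm.transpose g p e) ≡ d
      moved {p} p∈ ip neq only e (i′ , eq) = pick (e Fin.≟ g) (e Fin.≟ p)
        where
        Goal : Edge → Set
        Goal f = Incident u f × lookup (flip a b F A) f ≡ d
        pick : Dec (e ≡ g) → Dec (e ≡ p) → Goal (Perm.transpose g p e)
        pick (yes e≡g) _ = subst Goal (trans (sym (transposeˡ g p)) (cong (Perm.transpose g p) (sym e≡g)))
          (ip , trans (flip-∈ A p∈) (trans (transpose-other (col p p∈) (col g g∈) neq)
              (trans (cong (lookup A) (sym e≡g)) eq)))
        pick (no _) (yes e≡p) = subst Goal (trans (sym (transposeʳ g p)) (cong (Perm.transpose g p) (sym e≡p)))
          (i , trans (flip-∈ A g∈) (trans (transpose-other (col g g∈) (col p p∈) (λ q → neq (sym q)))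
              (trans (cong (lookup A) (sym e≡p)) eq)))
        pick (no e≢g) (no e≢p) = subst Goal (sym (transpose-fix g p e≢g e≢p))
          (i′ , trans (flip-∉ A (λ e∈ → [ e≢g , e≢p ]′ (only e∈ i′))) eq)

  -- The flip is an involution and leaves the cycle alternating, so the inequality applies in both
  -- directions.
  cycle-count : ∀ A {a b F} → AlternatingCycle A a b F → ∀ u d → #at (flip a b F A) u d ≡ #at A u d
  cycle-count A {a} {b} {F} ac u d = ℕ.≤-antisym
    (subst (λ B → #at (flip a b F A) u d ℕ.≤ #at B u d) (flip-involutive F A) (cycle-count-≤ (flip a b F A)
        (cycle-flip A ac) u d))
    (cycle-count-≤ A ac u d)

  -- Properness, deficiency and `Near` can all be read off the counts, which lets them pass through
  -- a flip of an alternating cycle unchanged.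
  SameCounts : Assignment → Assignment → Set
  SameCounts A B = ∀ u d → #at A u d ≡ #at B u d

  counts-deficiency : ∀ A B → SameCounts A B → ∀ {u a b} → Deficiency A u a b → Deficiency B u a b
  counts-deficiency A B same {u} {a} {b} (p , q , r) =
    trans (sym (same u a)) p , trans (sym (same u b)) q , λ d ne → subst (ℕ._≤ 1) (same u d) (r d ne)

  counts-repeated : ∀ A B → SameCounts A B → ∀ {u a} → Repeated A u a → Repeated B u a
  counts-repeated A B same {u} {a} (b , p) = b , counts-deficiency A B same {u} {a} {b} p

  counts-deficient : ∀ A B → SameCounts A B → ∀ {u} → Deficient A u → Deficient B u
  counts-deficient A B same {u} (a , p) = a , counts-repeated A B same {u} {a} p

  counts-proper : ∀ A B → SameCounts A B → Proper A → Proper B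
  counts-proper A B same proper e f (e≢f , u , i , j) eq =
    e≢f (count-≤1⁻ (λ x → incident? u x ×-dec (lookup B x Fin.≟ lookup B f))
      (ℕ.≤-reflexive (trans (sym (same u (lookup B f))) (#at-1 A proper u (lookup B f)))) (i , eq) (j , refl))

  proper-same : ∀ A → Proper A → ∀ {u e f} → Incident u e → Incident u f → lookup A e ≡ lookup A f → e ≡ f
  proper-same A proper {u} {e} {f} i j eq =
    count-≤1⁻ (λ x → incident? u x ×-dec (lookup A x Fin.≟ lookup A f))
        (ℕ.≤-reflexive (#at-1 A proper u (lookup A f))) (i , eq) (j , refl)

  -- At each vertex the edge on which `F` continues has the same colour as that on which `F′`
  -- continues, and properness makes them equal. Used twice, it shows that an edge determines its
  -- alternating cycle.
  proper-cycle-⊆ : ∀ A {a b F F′ e} → Proper A → AlternatingCycle A a b F → AlternatingCycle A a b F′ → e ∈ F →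
      e ∈ F′ → ∀ f → f ∈ F → f ∈ F′
  proper-cycle-⊆ A {a} {b} {F} {F′} proper ((conn , _) , col , alt) ac′@(_ , col′ , _) e∈ e∈′ = connected-⊆
      (_∈ F′) conn e∈ e∈′ step
    where
    step : ∀ {g f} → g ∈ F → g ∈ F′ → f ∈ F → Adjacent g f → f ∈ F′
    step {g} {f} g∈ g∈′ f∈ adj@(_ , u , i , j) =
      let p , p∈ , ip , _ , neq , _ = cycle-mate A ac′ g∈′ i
      in subst (_∈ F′) (proper-same A proper ip j (two-values (col g g∈) (col′ p p∈) (col f f∈)
          (λ q → neq (sym q)) (alt g f g∈ f∈ adj))) p∈

-- The cycle of colours c̃ and c″ through a vertex with repeated colour c̃

module DeficientCycles (G : BipartiteGraph) (k : ℕ) (regular : BipartiteGraph.Regular G k)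
                       (c c′ : Fin k) (c≢c′ : c ≢ c′) where

  open Deficits G k regular c c′ c≢c′ public
  open Cycles G k regular public using (cycle-mate; cycle-flip; cycle-count; SameCounts; counts-deficiency;
      counts-repeated; counts-deficient; counts-proper; proper-same; proper-cycle-⊆)
  open Walks G

  -- The edges of colours `c` and `c′` at a vertex may be different ones in `B`, so they are
  -- recovered from the counts: one colour twice and the other absent, or each of them once.
  counts-near : ∀ {A B} → SameCounts A B → Near A → Near B
  counts-near {A} {B} same near u =
    let g , h , t = near u in split g h t (lookup A g Fin.≟ lookup A h)
    where
    atA? = λ d e → incident? u e ×-dec (lookup A e Fin.≟ d)
    atB? = λ d e → incident? u e ×-dec (lookup B e Fin.≟ d)
    split : ∀ g h → TwoAt A u g h → Dec (lookup A g ≡ lookup A h) → ∃[ x ] ∃[ y ] TwoAt B u x y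
    split g h t (yes eq) =
      let #2 , #0 , _ = ≡⇒deficiency t eq
          x , y , x≢y , (ix , ex) , (iy , ey) , only′ = count-2⁻ (atB? (lookup A g))
              (trans (sym (same u (lookup A g))) #2)
          in-a : ∀ {z} → lookup B z ≡ lookup A g → OnH B z
          in-a = λ e → subst In (sym e) (onˡ t)
          a-or : ∀ {f} → Incident u f → OnH B f → Dec (lookup A g ≡ lookup B f) → f ≡ x ⊎ f ≡ y
          a-or = λ {f} i o → λ
            { (yes p) → only′ f (i , sym p)
            ; (no ne) → contradiction (i , sym (τ-other (onˡ t) o ne)) (count-0⁻ (atB? (τ (lookup A g)))
                (trans (sym (same u (τ (lookup A g)))) #0) f) }
      in x , y , twoAt x≢y ix iy (in-a ex) (in-a ey) (λ {f} i o → a-or i o (lookup A g Fin.≟ lookup B f))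
          (λ {d} d∉ → trans (sym (same u d)) (rest t d∉))
    split g h t (no ne) =
      let one : ∀ {z} → Incident u z → (∀ f → Incident u f × lookup A f ≡ lookup A z → f ≡ z) →
              ∃[ x ] ((Incident u x × lookup B x ≡ lookup A z) × (∀ f → Incident u f × lookup B f ≡ lookup A z → f ≡ x))
          one = λ {z} i only′ → count-1⁻ (atB? (lookup A z)) (trans (sym (same u (lookup A z)))
              (count-1 (atA? (lookup A z)) (i , refl) only′))
          x , (ix , ex) , onlyx = one (incˡ t) (λ f (i , e) →
              [ id , (λ f≡h → contradiction (trans (sym e) (cong (lookup A) f≡h)) ne) ]′
              (only t i (subst In (sym e) (onˡ t))))
          y , (iy , ey) , onlyy = one (incʳ t) (λ f (i , e) →
              [ (λ f≡g → contradiction (trans (cong (lookup A) (sym f≡g)) e) ne) , id ]′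
              (only t i (subst In (sym e) (onʳ t))))
          choose : ∀ {f} → Incident u f → OnH B f → Dec (lookup A g ≡ lookup B f) → f ≡ x ⊎ f ≡ y
          choose = λ {f} i o → λ
            { (yes p) → inj₁ (onlyx f (i , sym p))
            ; (no p)  → inj₂ (onlyy f (i , in-third (onˡ t) o (onʳ t) p ne)) }
      in x , y , twoAt (λ x≡y → ne (trans (sym ex) (trans (cong (lookup B) x≡y) ey))) ix iy
          (subst In (sym ex) (onˡ t)) (subst In (sym ey) (onʳ t))
           (λ {f} i o → choose i o (lookup A g Fin.≟ lookup B f)) (λ {d} d∉ → trans (sym (same u d)) (rest t d∉))

  counts-twoDef : ∀ {A B v w} → SameCounts A B → TwoDef A v w → TwoDef B v w
  counts-twoDef {A} {B} {v} {w} same td = twoDef (neq td) (counts-deficient A B same {v} (defˡ td))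
      (counts-deficient A B same {w} (defʳ td))
    (λ {u} d → onlyDef td (counts-deficient B A (λ u d → sym (same u d)) {u} d))

  module _ {A : Assignment} (near : Near A) {v : Vertex} (defv : Deficient A v) {e₀ : Edge}
      (iv₀ : Incident v e₀) (on₀ : OnH A e₀)
           -- This keeps the walk below closed: apart from `v`, `c̃` is nowhere repeated, and it can
           -- be missing only at vertices on the side of `v`, where the walk continues with `c″`
           -- instead.
           (away : ∀ {w} → Deficient A w → w ≢ v → side w ≡ side v × (∀ a → Repeated A v a → ¬ Repeated A w a))
           {c″ : Colour} (c″∉ : ¬ In c″) where

    private
      c̃ : Colour
      c̃ = lookup A e₀
      s = side v
      c″≢c̃ : c″ ≢ c̃
      c″≢c̃ eq = c″∉ (subst In (sym eq) on₀)
      open Alternate (lookup A) c″ c̃ c″≢c̃ s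

      at″ : ∀ u → ∃[ x ] ((Incident u x × lookup A x ≡ c″) × (∀ f → Incident u f × lookup A f ≡ c″ → f ≡ x))
      at″ u = count-1⁻ (λ f → incident? u f ×-dec (lookup A f Fin.≟ c″)) (rest (proj₂ (proj₂ (near u))) c″∉)

      same″ : ∀ {u x y} → Incident u x → Incident u y → lookup A x ≡ c″ → lookup A y ≡ c″ → x ≡ y
      same″ {u} ix iy ex ey = let z , _ , only′ = at″ u in trans (only′ _ (ix , ex)) (sym (only′ _ (iy , ey)))

      on-c̃ : ∀ {f} → lookup A f ≡ c̃ → OnH A f
      on-c̃ eq = subst In (sym eq) on₀

      ok-away : ∀ {u x} → u ≢ v → Incident u x → lookup A x ≡ c̃ → ¬ Deficient A u
      ok-away {u} {x} u≢v ix ex def = proj₂ (away def u≢v) c̃ (deficient-repeated near defv iv₀ on₀)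
        (subst (Repeated A u) ex (deficient-repeated near def ix (on-c̃ ex)))

      same-c̃ : ∀ {u x y} → u ≢ v → Incident u x → Incident u y → lookup A x ≡ c̃ → lookup A y ≡ c̃ → x ≡ y
      same-c̃ {u} {x} {y} u≢v ix iy ex ey = decide (x Fin.≟ y)
        where
        decide : Dec (x ≡ y) → x ≡ y
        decide (yes p) = p
        decide (no x≢y) =
          let h , t = focus near ix (on-c̃ ex)
          in contradiction (≡⇒def t (trans ex
              (trans (sym ey) (cong (lookup A) ([ (λ y≡x → contradiction (sym y≡x) x≢y) , id ]′
              (only t iy (on-c̃ ey)))))))
               (ok-away u≢v ix ex)

      ok-c̃ : ∀ {u} → ¬ Deficient A u → ∃[ x ] (Incident u x × lookup A x ≡ c̃)
      ok-c̃ {u} ok = let g , h , t = near u in choose t (lookup A g Fin.≟ c̃)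
        where
        choose : ∀ {g h} → TwoAt A u g h → Dec (lookup A g ≡ c̃) → ∃[ x ] (Incident u x × lookup A x ≡ c̃)
        choose {g} t (yes p)    = g , incˡ t , p
        choose {g} {h} t (no p) = h , incʳ t , sym (in-third (onˡ t) on₀ (onʳ t) p (ok⇒≢ t ok))

      side⇒ok : ∀ {u} → side u ≢ s → ¬ Deficient A u
      side⇒ok {u} sd def = decide (u Fin.≟ v)
        where
        decide : ¬ Dec (u ≡ v)
        decide (yes u≡v) = sd (cong side u≡v)
        decide (no u≢v)  = sd (proj₁ (away def u≢v))

      e : Edge
      e = proj₁ (at″ v)
      ie : Incident v e
      ie = proj₁ (proj₁ (proj₂ (at″ v)))
      e″ : lookup A e ≡ c″
      e″ = proj₂ (proj₁ (proj₂ (at″ v)))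

      meet : ∀ {g h b} → end b g ≡ end b h → Incident (end b g) g × Incident (end b g) h
      meet {g} {h} {b} eq = end-incident b g , subst (λ u → Incident u h) (sym eq) (end-incident b h)

      not-v : ∀ f → end (not s) f ≢ v
      not-v f eq = Bool.not-¬ refl (trans (sym (cong side eq)) (side-end (not s) f))

      -- At `v` the colour `c̃` is repeated, so two edges may precede the edge `e` of colour `c″`
      -- there. Elsewhere the predecessor is the only edge of its colour at the meeting vertex.
      N-inj : ∀ {x y z} → N x z → N y z → z ≢ e → x ≡ y
      N-inj {x} {y} {z} (inj₁ (px , _ , ex)) (inj₁ (py , _ , ey)) _ =
        same″ (proj₂ (meet {z} {x} {not s} (sym ex))) (proj₂ (meet {z} {y} {not s} (sym ey))) px py
      N-inj {x} {y} {z} (inj₂ (px , pz , ex)) (inj₂ (py , _ , ey)) z≢e =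
        same-c̃ (λ u≡v → z≢e (same″ (subst (λ u → Incident u z) u≡v (end-incident s z)) ie pz e″))
          (proj₂ (meet {z} {x} {s} (sym ex))) (proj₂ (meet {z} {y} {s} (sym ey))) px py
      N-inj (inj₁ (_ , p , _)) (inj₂ (_ , q , _)) _ = contradiction (trans (sym q) p) c″≢c̃
      N-inj (inj₂ (_ , p , _)) (inj₁ (_ , q , _)) _ = contradiction (trans (sym p) q) c″≢c̃

      open Orbits N N? e N-inj

      alternate : ∀ {x xs} → Strand x xs → ∀ {f} → f ∈ˡ xs → lookup A f ≡ c″ ⊎ lookup A f ≡ c̃
      alternate strand {f} f∈ = decide (f Fin.≟ e)
        where
        decide : Dec (f ≡ e) → lookup A f ≡ c″ ⊎ lookup A f ≡ c̃
        decide (yes refl) = inj₁ e″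
        decide (no f≢e) with predecessor strand f∈ f≢e
        ... | z , _ , _ , inj₁ (_ , q , _) = inj₂ q
        ... | z , _ , _ , inj₂ (_ , q , _) = inj₁ q

      -- An edge of colour `c″` leads to the side without deficient vertices, where `c̃` occurs; an
      -- edge of colour `c̃` leads back to the other side, and `c″` occurs everywhere. So the orbit
      -- must return to `e`.
      continue : ∀ {x} → lookup A x ≡ c″ ⊎ lookup A x ≡ c̃ → ∃[ y ] N x y
      continue {x} (inj₁ eq) =
        let y , i , ey = ok-c̃ {end (not s) x} (side⇒ok (λ p → Bool.not-¬ refl (trans (sym p) (side-end (not s) x))))
        in y , inj₁ (eq , ey , sym (incident-end i (side-end (not s) x)))
      continue {x} (inj₂ eq) =
        let y , (i , ey) , _ = at″ (end s x)
        in y , inj₂ (eq , ey , sym (incident-end i (side-end s x)))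

      module OfStrand {last : Edge} {list : List Edge} (strand : Strand last list) (back : N last e) where

        F : Subgraph
        F = set list

        cols : ∀ {f} → f ∈ˡ list → lookup A f ≡ c″ ⊎ lookup A f ≡ c̃
        cols = alternate strand

        before : ∀ {f} → f ∈ˡ list → ∃[ z ] (z ∈ˡ list × N z f)
        before {f} f∈ = decide (f Fin.≟ e)
          where
          decide : Dec (f ≡ e) → ∃[ z ] (z ∈ˡ list × N z f)
          decide (yes refl) = last , last∈ strand , back
          decide (no f≢e)   = let z , z∈ , _ , n = predecessor strand f∈ f≢e in z , z∈ , n

        after : ∀ {f} → f ∈ˡ list → ∃[ z ] (z ∈ˡ list × N f z)
        after {f} f∈ = decide (f Fin.≟ last)
          where
          decide : Dec (f ≡ last) → ∃[ z ] (z ∈ˡ list × N f z)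
          decide (yes refl) = e , start∈ strand , back
          decide (no f≢)    = let z , z∈ , _ , n = successor strand f∈ f≢ in z , z∈ , n

        -- Three edges at `v` have one of the two colours. An edge that enters `v` with colour `c̃`
        -- is followed by `e`, so the closed walk takes only one of the two and its degree at `v`
        -- stays 2.
        enters-v : ∀ {f} → f ∈ˡ list → Incident v f → lookup A f ≡ c̃ → f ≡ last
        enters-v {f} f∈ i fc = decide (f Fin.≟ last)
          where
          decide : Dec (f ≡ last) → f ≡ last
          decide (yes p) = p
          decide (no f≢) with successor strand f∈ f≢
          ... | y , _ , y≢e , inj₁ (p , _ , _) = contradiction (trans (sym p) fc) c″≢c̃
          ... | y , _ , y≢e , inj₂ (_ , q , eq) =
            contradiction (same″ (subst (λ u → Incident u y) (trans (sym eq) (incident⇒end i))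
                (end-incident s y)) ie q e″) y≢e

        same-list : ∀ {u x y} → x ∈ˡ list → y ∈ˡ list → Incident u x → Incident u y → lookup A x ≡ lookup A y → x ≡ y
        same-list {u} {x} {y} x∈ y∈ ix iy eq = split (cols x∈) (u Fin.≟ v)
          where
          split : lookup A x ≡ c″ ⊎ lookup A x ≡ c̃ → Dec (u ≡ v) → x ≡ y
          split (inj₁ p) _          = same″ ix iy p (trans (sym eq) p)
          split (inj₂ p) (no u≢v)   = same-c̃ u≢v ix iy p (trans (sym eq) p)
          split (inj₂ p) (yes u≡v) = trans (enters-v x∈ (subst (λ u → Incident u x) u≡v ix) p)
            (sym (enters-v y∈ (subst (λ u → Incident u y) u≡v iy) (trans (sym eq) p)))

        mate : ∀ {u g} → g ∈ˡ list → Incident u g → ∃[ p ] (p ∈ˡ list × Incident u p × lookup A g ≢ lookup A p)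
        mate {u} {g} g∈ i = split (Bool._≟_ (side u) s) (cols g∈)
          where
          Goal : Set
          Goal = ∃[ p ] (p ∈ˡ list × Incident u p × lookup A g ≢ lookup A p)
          prev : ∀ b → side u ≡ b → (∀ {z} → N z g → end b z ≡ end b g) → Goal
          prev b sd at = let z , z∈ , n = before g∈ in
            z , z∈ , subst (λ u → Incident u z) (trans (at n) (incident-end i sd)) (end-incident b z) , λ p →
                N-≢ n (sym p)
          next : ∀ b → side u ≡ b → (∀ {z} → N g z → end b g ≡ end b z) → Goal
          next b sd at = let z , z∈ , n = after g∈ in
            z , z∈ , subst (λ u → Incident u z) (trans (sym (at n)) (incident-end i sd)) (end-incident b z) , N-≢ n
          split : Dec (side u ≡ s) → lookup A g ≡ c″ ⊎ lookup A g ≡ c̃ → Goal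
          split (yes sd) (inj₁ p) = prev s sd λ { (inj₁ (_ , q , _)) → contradiction (trans (sym p) q) c″≢c̃ ;
              (inj₂ (_ , _ , eq)) → eq }
          split (yes sd) (inj₂ p) = next s sd λ { (inj₁ (q , _ , _)) → contradiction (trans (sym q) p) c″≢c̃ ;
              (inj₂ (_ , _ , eq)) → eq }
          split (no sd) (inj₁ p)  = next (not s) (Bool.¬-not sd) λ { (inj₂ (q , _ , _)) → contradiction
              (trans (sym p) q) c″≢c̃ ; (inj₁ (_ , _ , eq)) → eq }
          split (no sd) (inj₂ p)  = prev (not s) (Bool.¬-not sd) λ { (inj₂ (_ , q , _)) → contradiction
              (trans (sym q) p) c″≢c̃ ; (inj₁ (_ , _ , eq)) → eq }

        degrees : ∀ u → deg F u ≡ 0 ⊎ deg F u ≡ 2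
        degrees u = split (Fin.any? at?)
          where
          at? = λ f → incident? u f ×-dec (f ∈? F)
          split : Dec (∃[ g ] (Incident u g × g ∈ F)) → deg F u ≡ 0 ⊎ deg F u ≡ 2
          split (no none) = inj₁ (count-0 at? (λ f p → none (f , p)))
          split (yes (g , i , g∈)) =
            let p , p∈ , ip , ne = mate (∈-set⁻ list g∈) i
                choose : ∀ {f} → Incident u f × f ∈ F → Dec (lookup A g ≡ lookup A f) → f ≡ g ⊎ f ≡ p
                choose = λ (j , f∈) → λ
                  { (yes eq) → inj₁ (same-list (∈-set⁻ list f∈) (∈-set⁻ list g∈) j i (sym eq))
                  ; (no ne′) → inj₂ (same-list (∈-set⁻ list f∈) p∈ j ip (two-values (cols (∈-set⁻ list g∈))
                      (cols (∈-set⁻ list f∈)) (cols p∈) ne′ ne)) }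
            in inj₂ (count-2 at? (i , g∈) (ip , ∈-set list p∈) (λ g≡p → ne (cong (lookup A) g≡p))
                (λ f q → choose q (lookup A g Fin.≟ lookup A f)))

        isCycle : AlternatingCycle A c̃ c″ F
        isCycle = (strand-connected N-adjacent strand , degrees) , (λ f f∈ → swap (cols (∈-set⁻ list f∈))) ,
          (λ f g f∈ g∈ (f≢g , u , i , j) eq → f≢g (same-list (∈-set⁻ list f∈) (∈-set⁻ list g∈) i j eq))

        through-e : ∀ {F′} → AlternatingCycle A c̃ c″ F′ → ∃[ f ] (Incident v f × f ∈ F′) → e ∈ F′
        through-e {F′} ac@(_ , col , _) (f , i , f∈) = split (col f f∈)
          where
          split : lookup A f ≡ c̃ ⊎ lookup A f ≡ c″ → e ∈ F′
          split (inj₂ p) = subst (_∈ F′) (same″ i ie p e″) f∈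
          split (inj₁ p) =
            let q , q∈ , iq , _ , ne , _ = cycle-mate A ac f∈ i
            in subst (_∈ F′) (same″ iq ie (two-values (col f f∈) (col q q∈) (inj₂ refl) (λ r → ne (sym r))
                (λ r → c″≢c̃ (trans (sym r) p))) e″) q∈

        strand-⊆ : ∀ {F′ x xs} → AlternatingCycle A c̃ c″ F′ → e ∈ F′ → Strand x xs → ∀ {f} → f ∈ˡ xs → f ∈ F′
        strand-⊆ ac e∈ start (here refl) = e∈
        strand-⊆ ac e∈ (step s′ n y∉) (there f∈) = strand-⊆ ac e∈ s′ f∈
        strand-⊆ {F′} ac@(_ , col , _) e∈ (step {x} {xs} {y} s′ n y∉) (here refl) = follow n
          where
          x∈ : x ∈ F′
          x∈ = strand-⊆ ac e∈ s′ (last∈ s′)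
          follow : N x y → y ∈ F′
          follow (inj₁ (p , q , eq)) =
            let z , z∈ , iz , _ , ne , _ = cycle-mate A ac x∈ (end-incident (not s) x)
            in subst (_∈ F′) (same-c̃ (not-v x) iz (proj₂ (meet {x} {y} {not s} eq)) (two-values (col x x∈)
                (col z z∈) (inj₁ refl) (λ r → ne (sym r)) (λ r → c″≢c̃ (trans (sym p) r))) q) z∈
          follow (inj₂ (p , q , eq)) =
            let z , z∈ , iz , _ , ne , _ = cycle-mate A ac x∈ (end-incident s x)
            in subst (_∈ F′) (same″ iz (proj₂ (meet {x} {y} {s} eq)) (two-values (col x x∈) (col z z∈)
                (inj₂ refl) (λ r → ne (sym r)) (λ r → c″≢c̃ (trans (sym r) p))) q) z∈

        -- A cycle that touches `v` contains `e`, and from there on `strand-⊆` shows each step of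
        -- the walk to be forced until `v` is reached again. A further edge adjacent to the walk
        -- would share its colour with an edge of `F′` at the same vertex.
        cycle-unique : ∀ {F′} → AlternatingCycle A c̃ c″ F′ → ∃[ f ] (Incident v f × f ∈ F′) → F′ ≡ F
        cycle-unique {F′} ac@((conn , _) , col , alt) touch = subset-≡ (connected-⊆ (_∈ F) conn e∈
            (∈-set list (start∈ strand)) close) (λ f f∈ → F⊆ (∈-set⁻ list f∈))
          where
          e∈ : e ∈ F′
          e∈ = through-e ac touch
          F⊆ : ∀ {f} → f ∈ˡ list → f ∈ F′
          F⊆ = strand-⊆ ac e∈ strand
          close : ∀ {g f} → g ∈ F′ → g ∈ F → f ∈ F′ → Adjacent g f → f ∈ F
          close {g} {f} g∈′ g∈ f∈ adj@(_ , u , i , j) =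
            let p , p∈ , ip , ne = mate (∈-set⁻ list g∈) i
            in decide p∈ ip (two-values (cols (∈-set⁻ list g∈)) (swap (col f f∈)) (cols p∈) (alt g f g∈′ f∈ adj)
                ne) (f Fin.≟ p)
            where
            decide : ∀ {p} → p ∈ˡ list → Incident u p → lookup A f ≡ lookup A p → Dec (f ≡ p) → f ∈ F
            decide p∈ ip eq (yes refl) = ∈-set list p∈
            decide {p} p∈ ip eq (no f≢p) = contradiction eq (alt f p f∈ (F⊆ p∈) (f≢p , u , j , ip))

    cycle-at : ∃[ F ] (AlternatingCycle A (lookup A e₀) c″ F × (∀ {f} → Incident v f → lookup A f ≡ c″ → f ∈ F) ×
                       (∀ {F′} → AlternatingCycle A (lookup A e₀) c″ F′ → ∃[ f ] (Incident v f × f ∈ F′) → F′ ≡ F))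
    cycle-at = build existence
      where
      build : Orbit → ∃[ F ] (AlternatingCycle A (lookup A e₀) c″ F × (∀ {f} → Incident v f → lookup A f ≡ c″ → f ∈ F) ×
                              (∀ {F′} → AlternatingCycle A (lookup A e₀) c″ F′ → ∃[ f ] (Incident v f ×
                                  f ∈ F′) → F′ ≡ F))
      build (orbit {last} {list} strand stop) =
        set list , OfStrand.isCycle strand back , (λ {f} i eq → subst (_∈ set list) (same″ ie i e″ eq)
            (∈-set list (start∈ strand))) , (λ {F′} → OfStrand.cycle-unique strand back {F′})
        where
        back : N last e
        back = [ (λ none → let y , n = continue (alternate strand (last∈ strand)) in contradiction n (none y)) , id ]′ stop

-- Perturbations

module Perturbations (G : BipartiteGraph) (k : ℕ) (regular : BipartiteGraph.Regular G k)
                     (c c′ : Fin k) (c≢c′ : c ≢ c′) where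

  open DeficientCycles G k regular c c′ c≢c′ public

  onH : Assignment → List Edge
  onH A = filter (hasColour? A c c′) (allFin #E)

  singleton : Edge → Dist Subgraph
  singleton e = return ⁅ e ⁆

  recolourAt : Assignment → Vertex → Dist Subgraph
  recolourAt A v = uniform (repeatedEdges A v) >>= singleton

  -- This and its companions unfold the branches of the perturbations into binds of named functions,
  -- to which the rules for masses apply.
  perturb₂-[] : ∀ A → deficientVertices A ≡ [] → perturb₂ c c′ A ≡ fair (uniform (onH A) >>= singleton) (return ⊥)
  perturb₂-[] A eq with deficientVertices A | eq
  ... | [] | _ = refl

  perturb₂-∷ : ∀ A {v vs} → deficientVertices A ≡ v ∷ vs → perturb₂ c c′ A ≡ (uniform (v ∷ vs) >>= recolourAt A)
  perturb₂-∷ A eq with deficientVertices A | eq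
  ... | _ ∷ _ | refl = refl

  module _ (c″ : Colour) (A : Assignment) where

    cyclesThrough : Edge → Edge → List Subgraph
    cyclesThrough e f = filter (λ F → alternatingCycle? A c″ (lookup A f) F ×-dec ((e ∈? F) ×-dec (f ∈? F)))
        (subsets #E)

    cyclesAt : Vertex → Colour → List Subgraph
    cyclesAt v c̃ = filter (λ F → alternatingCycle? A c̃ c″ F ×-dec Fin.any? (λ e → incident? v e ×-dec
        (e ∈? F))) (subsets #E)

    edges″ edgesH : Vertex → List Edge
    edges″ v = filter (λ e → incident? v e ×-dec (lookup A e Fin.≟ c″)) (allFin #E)
    edgesH v = filter (λ f → incident? v f ×-dec hasColour? A c c′ f) (allFin #E)

    through₃ : Edge → Edge → Dist (Colour × Subgraph)
    through₃ e f = uniform (cyclesThrough e f) >>= λ F → return (lookup A f , F)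

    through₂ : Vertex → Edge → Dist (Colour × Subgraph)
    through₂ v e = uniform (edgesH v) >>= through₃ e

    through₁ : Vertex → Dist (Colour × Subgraph)
    through₁ v = uniform (edges″ v) >>= through₂ v

    at₂ : Vertex → Colour → Dist (Colour × Subgraph)
    at₂ v c̃ = uniform (cyclesAt v c̃) >>= λ F → return (c̃ , F)

    at₁ : Vertex → Dist (Colour × Subgraph)
    at₁ v = uniform (repeatedColours A v) >>= at₂ v

  perturb₃-[] : ∀ A {c″} → deficientVertices A ≡ [] → perturb₃ c c′ c″ A ≡ (uniform (allFin #V) >>= through₁ c″ A)
  perturb₃-[] A eq with deficientVertices A | eq
  ... | [] | _ = refl

  perturb₃-∷ : ∀ A {c″ v vs} → deficientVertices A ≡ v ∷ vs → perturb₃ c c′ c″ A ≡ (uniform (v ∷ vs) >>= at₁ c″ A)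
  perturb₃-∷ A eq with deficientVertices A | eq
  ... | _ ∷ _ | refl = refl

  sub-recolourAt : ∀ A v → Sub (recolourAt A v)
  sub-recolourAt A v = sub->>= {f = singleton} (sub-uniform (repeatedEdges A v)) (λ e → sub-return ⁅ e ⁆)

  sub-perturb₂ : ∀ A → Sub (perturb₂ c c′ A)
  sub-perturb₂ A = split (deficientVertices A) refl
    where
    split : ∀ vs → deficientVertices A ≡ vs → Sub (perturb₂ c c′ A)
    split []       eq = subst Sub (sym (perturb₂-[] A eq))
        (sub-fair (sub->>= {f = singleton} (sub-uniform (onH A)) (λ e → sub-return ⁅ e ⁆)) (sub-return ⊥))
    split (v ∷ vs) eq = subst Sub (sym (perturb₂-∷ A eq)) (sub->>= {f = recolourAt A} (sub-uniform (v ∷ vs))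
        (sub-recolourAt A))

  sub-through₃ : ∀ c″ A e f → Sub (through₃ c″ A e f)
  sub-through₃ c″ A e f = sub->>= {f = λ F → return (lookup A f , F)} (sub-uniform (cyclesThrough c″ A e f))
      (λ F → sub-return (lookup A f , F))

  sub-through₂ : ∀ c″ A v e → Sub (through₂ c″ A v e)
  sub-through₂ c″ A v e = sub->>= {f = through₃ c″ A e} (sub-uniform (edgesH c″ A v)) (sub-through₃ c″ A e)

  sub-through₁ : ∀ c″ A v → Sub (through₁ c″ A v)
  sub-through₁ c″ A v = sub->>= {f = through₂ c″ A v} (sub-uniform (edges″ c″ A v)) (sub-through₂ c″ A v)

  sub-at₂ : ∀ c″ A v c̃ → Sub (at₂ c″ A v c̃)
  sub-at₂ c″ A v c̃ = sub->>= {f = λ F → return (c̃ , F)} (sub-uniform (cyclesAt c″ A v c̃)) (λ F → sub-return (c̃ , F))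

  sub-at₁ : ∀ c″ A v → Sub (at₁ c″ A v)
  sub-at₁ c″ A v = sub->>= {f = at₂ c″ A v} (sub-uniform (repeatedColours A v)) (sub-at₂ c″ A v)

  sub-perturb₃ : ∀ c″ A → Sub (perturb₃ c c′ c″ A)
  sub-perturb₃ c″ A = split (deficientVertices A) refl
    where
    split : ∀ vs → deficientVertices A ≡ vs → Sub (perturb₃ c c′ c″ A)
    split []       eq = subst Sub (sym (perturb₃-[] A eq)) (sub->>= {f = through₁ c″ A}
        (sub-uniform (allFin #V)) (sub-through₁ c″ A))
    split (v ∷ vs) eq = subst Sub (sym (perturb₃-∷ A eq)) (sub->>= {f = at₁ c″ A} (sub-uniform (v ∷ vs)) (sub-at₁ c″ A))

  nodef-vertices : ∀ {A} → NoDef A → deficientVertices A ≡ []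
  nodef-vertices {A} nodef = List.filter-none (deficient? A) (All.universal nodef (allFin #V))

  ∈-deficientVertices : ∀ A {v} → Deficient A v → v ∈ˡ deficientVertices A
  ∈-deficientVertices A def = ∈-filter (deficient? A) def

  ∈-deficientVertices⁻ : ∀ A {v} → v ∈ˡ deficientVertices A → Deficient A v
  ∈-deficientVertices⁻ A v∈ = ∈-filter⁻ (deficient? A) v∈

  twoDef-vertices : ∀ {A v w} → TwoDef A v w → ∃[ x ] ∃[ xs ] (deficientVertices A ≡ x ∷ xs × length (x ∷ xs) ≡ 2)
  twoDef-vertices {A} {v} {w} td = split (deficientVertices A) refl
    where
    len : length (deficientVertices A) ≡ 2
    len = count-2 (deficient? A) (defˡ td) (defʳ td) (neq td) (λ u d → onlyDef td d)
    split : ∀ xs → deficientVertices A ≡ xs → ∃[ x ] ∃[ xs ] (deficientVertices A ≡ x ∷ xs × length (x ∷ xs) ≡ 2)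
    split []       eq = case trans (sym len) (cong length eq) of λ ()
    split (x ∷ xs) eq = x , xs , eq , trans (cong length (sym eq)) len

  low₂-⊥ : ∀ {A} → NoDef A → Low (perturb₂ c c′ A) ⊥ 2
  low₂-⊥ {A} nodef = subst (λ d → Low d ⊥ 2) (sym (perturb₂-[] A (nodef-vertices {A} nodef)))
    (low-fairʳ {d = uniform (onH A) >>= singleton} {return ⊥} {m = 1} (nonneg->>= {f = singleton}
        (nonneg-uniform (onH A)) (λ e → nonneg-return ⁅ e ⁆)) (low-return ⊥))

  low₂-edge : ∀ {A e} → NoDef A → OnH A e → Low (perturb₂ c c′ A) ⁅ e ⁆ (length (onH A) * 1 * 2)
  low₂-edge {A} {e} nodef o = subst (λ d → Low d ⁅ e ⁆ (length (onH A) * 1 * 2))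
      (sym (perturb₂-[] A (nodef-vertices {A} nodef)))
    (low-fairˡ {d = uniform (onH A) >>= singleton} {return ⊥} {m = length (onH A) * 1} (nonneg-return ⊥)
      (low->>= {d = uniform (onH A)} {f = singleton} {m = length (onH A)} {n = 1} (λ e → nonneg-return ⁅ e ⁆)
        (low-uniform (∈-filter (hasColour? A c c′) o)) (low-return ⁅ e ⁆)))

  -- 4 = 2 · 2: one of two deficient vertices and one of its two repeated edges.
  low₂-def : ∀ {A v w e} → Near A → TwoDef A v w → ∀ {x} → Deficient A x → Incident x e → OnH A e →
      Low (perturb₂ c c′ A) ⁅ e ⁆ 4
  low₂-def {A} {v} {w} {e} near td {x} def i o =
    let y , ys , eq , len = twoDef-vertices td
        h , t = focus near i o
        len′ , ∈rep , _ = repeated-edges t def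
    in subst (λ d → Low d ⁅ e ⁆ 4) (sym (perturb₂-∷ A eq))
      (low->>= {d = uniform (y ∷ ys)} {f = recolourAt A} {m = 2} {n = 2} (λ v → nonneg (sub-recolourAt A v))
        (subst (Low (uniform (y ∷ ys)) x) len (low-uniform (subst (x ∈ˡ_) eq (∈-deficientVertices A def))))
        (low->>= {d = uniform (repeatedEdges A x)} {f = singleton} {m = 2} {n = 1} (λ e → nonneg-return ⁅ e ⁆)
          (subst (Low (uniform (repeatedEdges A x)) e) len′ (low-uniform (∈rep (inj₁ refl)))) (low-return ⁅ e ⁆)))

  supp₂-nodef : ∀ {A F} → NoDef A → Supp (perturb₂ c c′ A) F → F ≡ ⊥ ⊎ ∃[ e ] (OnH A e × F ≡ ⁅ e ⁆)
  supp₂-nodef {A} {F} nodef supp =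
    split (supp-fair {d = uniform (onH A) >>= singleton} {d′ = return ⊥} (subst (λ d → Supp d F)
        (perturb₂-[] A (nodef-vertices {A} nodef)) supp))
    where
    split : Supp (uniform (onH A) >>= singleton) F ⊎ Supp (return ⊥) F → F ≡ ⊥ ⊎ ∃[ e ] (OnH A e × F ≡ ⁅ e ⁆)
    split (inj₂ p) = inj₁ (supp-return p)
    split (inj₁ p) =
      let e , e∈ , q = supp->>= {d = uniform (onH A)} {f = singleton} p
      in inj₂ (e , ∈-filter⁻ (hasColour? A c c′) (supp-uniform {xs = onH A} e∈) , supp-return q)

  supp₂-def : ∀ {A v w F} → Near A → TwoDef A v w → Supp (perturb₂ c c′ A) F → ∃[ e ] ∃[ x ] (Deficient A x ×
      Incident x e × OnH A e × F ≡ ⁅ e ⁆)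
  supp₂-def {A} {v} {w} {F} near td supp =
    let y , ys , eq , _ = twoDef-vertices td
        x , x∈ , p = supp->>= {d = uniform (y ∷ ys)} {f = recolourAt A} (subst (λ d → Supp d F) (perturb₂-∷ A eq) supp)
        def = ∈-deficientVertices⁻ A (subst (x ∈ˡ_) (sym eq) (supp-uniform {xs = y ∷ ys} x∈))
        e , e∈ , q = supp->>= {d = uniform (repeatedEdges A x)} {f = singleton} p
        g , h , t = near x
        i , o = at t (proj₂ (proj₂ (repeated-edges t def)) (supp-uniform {xs = repeatedEdges A x} e∈))
    in e , x , def , i , o , supp-return q
    where
    at : ∀ {x g h f} → TwoAt A x g h → f ≡ g ⊎ f ≡ h → Incident x f × OnH A f
    at t (inj₁ refl) = incˡ t , onˡ t
    at t (inj₂ refl) = incʳ t , onʳ t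

  Through : Colour → Assignment → Edge → Edge → Subgraph → Set
  Through c″ A e f F = AlternatingCycle A c″ (lookup A f) F × e ∈ F × f ∈ F

  supp₃-nodef : ∀ {A c″ x} → NoDef A → Supp (perturb₃ c c′ c″ A) x →
                ∃[ v ] ∃[ e ] ∃[ f ] ∃[ F ] (Incident v e × lookup A e ≡ c″ × Incident v f × OnH A f ×
                    Through c″ A e f F × x ≡ (lookup A f , F))
  supp₃-nodef {A} {c″} {x} nodef supp =
    let v , _ , p₁ = supp->>= {d = uniform (allFin #V)} {f = through₁ c″ A} (subst (λ d → Supp d x)
            (perturb₃-[] A (nodef-vertices {A} nodef)) supp)
        e , e∈ , p₂ = supp->>= {d = uniform (edges″ c″ A v)} {f = through₂ c″ A v} p₁
        f , f∈ , p₃ = supp->>= {d = uniform (edgesH c″ A v)} {f = through₃ c″ A e} p₂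
        F , F∈ , p₄ = supp->>= {d = uniform (cyclesThrough c″ A e f)} {f = λ F → return (lookup A f , F)} p₃
        ie , ec = ∈-filter⁻ (λ e → incident? v e ×-dec (lookup A e Fin.≟ c″)) (supp-uniform {xs = edges″ c″ A v} e∈)
        jf , fo = ∈-filter⁻ (λ f → incident? v f ×-dec hasColour? A c c′ f) (supp-uniform {xs = edgesH c″ A v} f∈)
        thr = ∈-subsets-filter⁻ (λ F → alternatingCycle? A c″ (lookup A f) F ×-dec ((e ∈? F) ×-dec (f ∈? F)))
            (supp-uniform {xs = cyclesThrough c″ A e f} F∈)
    in v , e , f , F , ie , ec , jf , fo , thr , supp-return p₄

  supp₃-def : ∀ {A c″ v w x} → TwoDef A v w → Supp (perturb₃ c c′ c″ A) x →
              ∃[ u ] ∃[ c̃ ] ∃[ F ] (Deficient A u × Repeated A u c̃ × AlternatingCycle A c̃ c″ F ×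
                  (∃[ e ] (Incident u e × e ∈ F)) × x ≡ (c̃ , F))
  supp₃-def {A} {c″} {v} {w} {x} td supp =
    let y , ys , eq , _ = twoDef-vertices td
        u , u∈ , p₁ = supp->>= {d = uniform (y ∷ ys)} {f = at₁ c″ A} (subst (λ d → Supp d x) (perturb₃-∷ A eq) supp)
        c̃ , c̃∈ , p₂ = supp->>= {d = uniform (repeatedColours A u)} {f = at₂ c″ A u} p₁
        F , F∈ , p₃ = supp->>= {d = uniform (cyclesAt c″ A u c̃)} {f = λ F → return (c̃ , F)} p₂
        cyc , touch = ∈-subsets-filter⁻ (λ F → alternatingCycle? A c̃ c″ F ×-dec Fin.any?
            (λ e → incident? u e ×-dec (e ∈? F))) (supp-uniform {xs = cyclesAt c″ A u c̃} F∈)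
    in u , c̃ , F , ∈-deficientVertices⁻ A (subst (u ∈ˡ_) (sym eq) (supp-uniform {xs = y ∷ ys} u∈)) ,
        ∈-filter⁻ (repeated? A u) (supp-uniform {xs = repeatedColours A u} c̃∈) , cyc , touch , supp-return p₃

  -- Only the vertex and one of its two edges of colours `c` and `c′` are chosen; properness
  -- determines the edge of colour `c″` and the cycle through both edges.
  low₃-nodef : ∀ {A c″ v e f F} → Proper A → Incident v e → lookup A e ≡ c″ → Incident v f → OnH A f →
      Through c″ A e f F →
               Low (perturb₃ c c′ c″ A) (lookup A f , F) (#V * 2)
  low₃-nodef {A} {c″} {v} {e} {f} {F} proper ie ec jf fo thr@(cyc , e∈ , f∈) =
    subst (λ d → Low d (lookup A f , F) (#V * 2)) (sym (perturb₃-[] A (nodef-vertices {A} (proper⇒nodef A proper))))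
      (low->>= {d = uniform (allFin #V)} {f = through₁ c″ A} {m = #V} {n = 2} (λ v → nonneg (sub-through₁ c″ A v))
        (subst (Low (uniform (allFin #V)) v) (List.length-tabulate id) (low-uniform (∈ˡ.∈-allFin v)))
        (low->>= {d = uniform (edges″ c″ A v)} {f = through₂ c″ A v} {m = 1} {n = 2}
            (λ e → nonneg (sub-through₂ c″ A v e))
          (subst (Low (uniform (edges″ c″ A v)) e) (count-1 e? (ie , ec) λ g (i , p) → proper-same A proper i ie
              (trans p (sym ec))) (low-uniform (∈-filter e? (ie , ec))))
          (low->>= {d = uniform (edgesH c″ A v)} {f = through₃ c″ A e} {m = 2} {n = 1}
              (λ f → nonneg (sub-through₃ c″ A e f))
            (subst (Low (uniform (edgesH c″ A v)) f) two-edges (low-uniform (∈-filter f? (jf , fo))))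
            (low->>= {d = uniform (cyclesThrough c″ A e f)} {f = λ F → return (lookup A f , F)} {m = 1} {n = 1}
                (λ F → nonneg-return (lookup A f , F))
              (subst (λ l → Low (uniform l) F 1) (sym unique) (low-uniform {xs = F ∷ []} (here refl)))
                  (low-return (lookup A f , F))))))
    where
    e? = λ e → incident? v e ×-dec (lookup A e Fin.≟ c″)
    f? = λ f → incident? v f ×-dec hasColour? A c c′ f
    F? = λ F → alternatingCycle? A c″ (lookup A f) F ×-dec ((e ∈? F) ×-dec (f ∈? F))
    two-edges : length (edgesH c″ A v) ≡ 2
    two-edges = let h , t = focus (proper⇒near A proper) jf fo in count-2 f? (jf , fo) (incʳ t , onʳ t) (distinct t) (λ g (i , o) → only t i o)
    unique : cyclesThrough c″ A e f ≡ F ∷ []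
    unique = unique-singleton (subsets-filter-unique F?) (∈-subsets-filter F? thr) λ F′ F′∈ →
        same (∈-subsets-filter⁻ F? F′∈)
      where
      same : ∀ {F′} → Through c″ A e f F′ → F′ ≡ F
      same (cyc′ , e∈′ , _) = subset-≡ (proper-cycle-⊆ A proper cyc′ cyc e∈′ e∈) (proper-cycle-⊆ A proper cyc
          cyc′ e∈ e∈′)

  -- Only the deficient vertex is a genuine choice, one of two; its repeated colour is unique, and
  -- so is the cycle by the last hypothesis.
  low₃-def : ∀ {A c″ v w u e₀ F} → Near A → TwoDef A v w → Deficient A u → Incident u e₀ → OnH A e₀ →
             AlternatingCycle A (lookup A e₀) c″ F → ∃[ e ] (Incident u e × e ∈ F) →
             (∀ {F′} → AlternatingCycle A (lookup A e₀) c″ F′ → ∃[ e ] (Incident u e × e ∈ F′) → F′ ≡ F) →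
             Low (perturb₃ c c′ c″ A) (lookup A e₀ , F) 2
  low₃-def {A} {c″} {v} {w} {u} {e₀} {F} near td def i o cyc touch same =
    let y , ys , eq , len = twoDef-vertices td in
    subst (λ d → Low d (c̃ , F) 2) (sym (perturb₃-∷ A eq))
      (low->>= {d = uniform (y ∷ ys)} {f = at₁ c″ A} {m = 2} {n = 1} (λ v → nonneg (sub-at₁ c″ A v))
        (subst (Low (uniform (y ∷ ys)) u) len (low-uniform (subst (u ∈ˡ_) eq (∈-deficientVertices A def))))
        (low->>= {d = uniform (repeatedColours A u)} {f = at₂ c″ A u} {m = 1} {n = 1} (λ d → nonneg (sub-at₂ c″ A u d))
          (subst (Low (uniform (repeatedColours A u)) c̃) one (low-uniform (∈-filter (repeated? A u) rep)))
          (low->>= {d = uniform (cyclesAt c″ A u c̃)} {f = λ F → return (c̃ , F)} {m = 1} {n = 1}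
              (λ F → nonneg-return (c̃ , F))
            (subst (λ l → Low (uniform l) F 1) (sym unique) (low-uniform {xs = F ∷ []} (here refl)))
                (low-return (c̃ , F)))))
    where
    c̃ = lookup A e₀
    rep : Repeated A u c̃
    rep = deficient-repeated near def i o
    one : length (repeatedColours A u) ≡ 1
    one = count-1 (repeated? A u) rep (λ d r → repeated⇒≡ {d = d} (proj₂ (focus near i o)) r)
    F? = λ F → alternatingCycle? A c̃ c″ F ×-dec Fin.any? (λ e → incident? u e ×-dec (e ∈? F))
    unique : cyclesAt c″ A u c̃ ≡ F ∷ []
    unique = unique-singleton (subsets-filter-unique F?) (∈-subsets-filter F? (cyc , touch)) λ F′ F′∈ →
      let cyc′ , touch′ = ∈-subsets-filter⁻ F? F′∈ in same cyc′ touch′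

-- Comparing mixtures

module _ {S W : Set} (o : S) where

  -- Both kinds of moves begin with such a draw. There `o` is the empty subgraph, which stands for
  -- doing nothing.
  Mixture : List S → (S → Dist W) → Dist W
  Mixture L f = fair (return o) (uniform L) >>= f

  E-mixture : ∀ L f φ → E (Mixture L f) φ ≡ ½ *ℚ E (f o) φ +ℚ ½ *ℚ E (uniform L) (λ s → E (f s) φ)
  E-mixture L f φ = trans (E->>= (fair (return o) (uniform L)) f φ)
      (trans (E-fair (return o) (uniform L) (λ s → E (f s) φ))
    (cong (λ x → ½ *ℚ x +ℚ ½ *ℚ E (uniform L) (λ s → E (f s) φ)) (E-return o (λ s → E (f s) φ))))

  sub-mixture : ∀ {L f} → (∀ s → Sub (f s)) → Sub (Mixture L f)
  sub-mixture {L} {f} sf = sub->>= {d = fair (return o) (uniform L)} {f = f} (sub-fair {d = return o}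
      {d′ = uniform L} (sub-return o) (sub-uniform L)) sf

  module _ {f : S → Dist W} {φ : W → ℚ} (sf : ∀ s → Sub (f s)) (0≤φ : ∀ w → 0ℚ ≤ℚ φ w) (φ≤1 : ∀ w → φ w ≤ℚ 1ℚ)
           {s₀ : S} (≟s₀ : ∀ s → Dec (s ≡ s₀)) (vanish : ∀ s → s ≢ s₀ → E (f s) φ ≡ 0ℚ) where

    -- `φ` is compatible with the single first choice `s₀`, and `o` is not in `L`, so only one of
    -- the two halves can contribute.
    mixture-half : ∀ {L} → (∀ {s} → s ∈ˡ L → s ≢ o) → E (Mixture L f) φ ≤ℚ ½
    mixture-half {L} out = subst (_≤ℚ ½) (sym (E-mixture L f φ)) (split (≟s₀ o))
      where
      rest′ = E (uniform L) (λ s → E (f s) φ)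
      split : Dec (o ≡ s₀) → ½ *ℚ E (f o) φ +ℚ ½ *ℚ rest′ ≤ℚ ½
      split (yes refl) = begin
        ½ *ℚ E (f o) φ +ℚ ½ *ℚ rest′  ≡⟨ cong (λ x → ½ *ℚ E (f o) φ +ℚ ½ *ℚ x) (E-vanish (uniform L) (λ s s∈ →
            vanish s (out (supp-uniform {xs = L} s∈)))) ⟩
        ½ *ℚ E (f o) φ +ℚ ½ *ℚ 0ℚ     ≡⟨ ℚ.+-identityʳ (½ *ℚ E (f o) φ) ⟩
        ½ *ℚ E (f o) φ                ≤⟨ *ℚ-monoˡ 0≤½ (sub-≤1 (sf o) φ≤1) ⟩
        ½ *ℚ 1ℚ                       ∎
        where open ℚ.≤-Reasoning
      split (no o≢) = begin
        ½ *ℚ E (f o) φ +ℚ ½ *ℚ rest′  ≡⟨ cong (λ x → ½ *ℚ x +ℚ ½ *ℚ rest′) (vanish o o≢) ⟩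
        ½ *ℚ 0ℚ +ℚ ½ *ℚ rest′         ≡⟨ ℚ.+-identityˡ (½ *ℚ rest′) ⟩
        ½ *ℚ rest′                    ≤⟨ *ℚ-monoˡ 0≤½ (sub-≤1 (sub-uniform L) (λ s → sub-≤1 (sf s) φ≤1)) ⟩
        ½ *ℚ 1ℚ                       ∎
        where open ℚ.≤-Reasoning

    -- Both sides draw from the same list and may pick different elements of it, so the common
    -- probability of a pick cancels however long the list is.
    mixture-compare : ∀ {L g ψ s₁ w m} → Unique L → s₀ ≢ o → (∀ s → Sub (g s)) → (∀ w → 0ℚ ≤ℚ ψ w) → ψ w ≡ 1ℚ →
                      s₁ ∈ˡ L → Low (g s₁) w m → E (Mixture L f) φ ≤ℚ ⟦ m ⟧ *ℚ E (Mixture L g) ψ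
    mixture-compare {L} {g} {ψ} {s₁} {w} {m} u s₀≢o sg 0≤ψ ψw s₁∈ lw = begin
      E (Mixture L f) φ                                   ≡⟨ E-mixture L f φ ⟩
      ½ *ℚ E (f o) φ +ℚ ½ *ℚ α                            ≡⟨ cong (λ x → ½ *ℚ x +ℚ ½ *ℚ α)
          (vanish o (λ p → s₀≢o (sym p))) ⟩
      ½ *ℚ 0ℚ +ℚ ½ *ℚ α                                   ≡⟨ ℚ.+-identityˡ (½ *ℚ α) ⟩
      ½ *ℚ α                                              ≤⟨ *ℚ-monoˡ 0≤½ (uniform-compare {m = m} ≟s₀ u
          (λ s → sub-≤1 (sf s) φ≤1) vanish
                                                               (λ s → E-nonneg (nonneg (sg s)) 0≤ψ) s₁∈
                                                                   (subst (_≤ℚ ⟦ m ⟧ *ℚ E (g s₁) ψ) ψw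
                                                                   (bound lw ψ 0≤ψ))) ⟩
      ½ *ℚ (⟦ m ⟧ *ℚ β)                                   ≡⟨ swap-½ ⟦ m ⟧ β ⟩
      ⟦ m ⟧ *ℚ (½ *ℚ β)                                   ≤⟨ *ℚ-monoˡ (0≤⟦⟧ m)
          (q≤p+q (½ *ℚ β) (0≤*ℚ 0≤½ (E-nonneg (nonneg (sg o)) 0≤ψ))) ⟩
      ⟦ m ⟧ *ℚ (½ *ℚ E (g o) ψ +ℚ ½ *ℚ β)                 ≡⟨ cong (⟦ m ⟧ *ℚ_) (E-mixture L g ψ) ⟨
      ⟦ m ⟧ *ℚ E (Mixture L g) ψ                          ∎
      where
      open ℚ.≤-Reasoning
      α = E (uniform L) (λ s → E (f s) φ)
      β = E (uniform L) (λ s → E (g s) ψ)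
      swap-½ : ∀ p q → ½ *ℚ (p *ℚ q) ≡ p *ℚ (½ *ℚ q)
      swap-½ p q = trans (sym (ℚ.*-assoc ½ p q)) (trans (cong (_*ℚ q) (ℚ.*-comm ½ p)) (ℚ.*-assoc p ½ q))

  module _ {g : S → Dist W} {ψ : W → ℚ} (sg : ∀ s → Sub (g s)) (0≤ψ : ∀ w → 0ℚ ≤ℚ ψ w) {w : W} (ψw : ψ w ≡ 1ℚ) where

    private
      halve : ∀ {p q} m → 1ℚ ≤ℚ ⟦ m ⟧ *ℚ p → ½ *ℚ p ≤ℚ q → ½ ≤ℚ ⟦ m ⟧ *ℚ q
      halve {p} {q} m 1≤ le = begin
        ½ *ℚ 1ℚ              ≤⟨ *ℚ-monoˡ 0≤½ 1≤ ⟩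
        ½ *ℚ (⟦ m ⟧ *ℚ p)    ≡⟨ ℚ.*-assoc ½ ⟦ m ⟧ p ⟨
        ½ *ℚ ⟦ m ⟧ *ℚ p      ≡⟨ cong (_*ℚ p) (ℚ.*-comm ½ ⟦ m ⟧) ⟩
        ⟦ m ⟧ *ℚ ½ *ℚ p      ≡⟨ ℚ.*-assoc ⟦ m ⟧ ½ p ⟩
        ⟦ m ⟧ *ℚ (½ *ℚ p)    ≤⟨ *ℚ-monoˡ (0≤⟦⟧ m) le ⟩
        ⟦ m ⟧ *ℚ q           ∎
        where open ℚ.≤-Reasoning

    -- Counterpart of `mixture-half`: the ½ there cancels against the ½ here, and what the inverse
    -- way costs beyond that is the bound on the ratio.
    half-mixtureˡ : ∀ {L m} → Low (g o) w m → ½ ≤ℚ ⟦ m ⟧ *ℚ E (Mixture L g) ψ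
    half-mixtureˡ {L} {m} lw = halve m (subst (_≤ℚ ⟦ m ⟧ *ℚ E (g o) ψ) ψw (bound lw ψ 0≤ψ))
      (subst (½ *ℚ E (g o) ψ ≤ℚ_) (sym (E-mixture L g ψ))
          (p≤p+q _ (0≤*ℚ 0≤½ (E-nonneg (nonneg-uniform L) (λ s → E-nonneg (nonneg (sg s)) 0≤ψ)))))

    half-mixtureʳ : ∀ {L s m} → s ∈ˡ L → Low (g s) w m → ½ ≤ℚ ⟦ length L * m ⟧ *ℚ E (Mixture L g) ψ
    half-mixtureʳ {L} {s} {m} s∈ lw = halve (length L * m)
      (subst (λ x → 1ℚ ≤ℚ ⟦ length L * m ⟧ *ℚ x) (E->>= (uniform L) g ψ)
        (subst (_≤ℚ ⟦ length L * m ⟧ *ℚ E (uniform L >>= g) ψ) ψw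
            (bound (low->>= {d = uniform L} {f = g} {m = length L} {n = m} (λ s → nonneg (sg s))
            (low-uniform s∈) lw) ψ 0≤ψ)))
      (subst (½ *ℚ E (uniform L) (λ s → E (g s) ψ) ≤ℚ_) (sym (E-mixture L g ψ))
          (q≤p+q _ (0≤*ℚ 0≤½ (E-nonneg (nonneg (sg o)) 0≤ψ))))

-- Numbers of edges and connected subgraphs of the two-factor

module Bounds (G : BipartiteGraph) (k : ℕ) (regular : BipartiteGraph.Regular G k)
              (c c′ : Fin k) (c≢c′ : c ≢ c′) where

  open Perturbations G k regular c c′ c≢c′ public

  length-product : {A B : Set} (xs : List A) (ys : List B) → length (cartesianProduct xs ys) ≡ length xs * length ys
  length-product []       ys = refl
  length-product (x ∷ xs) ys = trans (List.length-++ (map (x ,_) ys)) (cong₂ ℕ._+_ (List.length-map (x ,_) ys)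
      (length-product xs ys))

  both-colours : List Colour
  both-colours = c ∷ c′ ∷ []

  in-both : ∀ {x} → In x → x ∈ˡ both-colours
  in-both (inj₁ refl) = here refl
  in-both (inj₂ refl) = there (here refl)

  -- An edge is determined by its left end and its colour. Coding with all vertices instead of the
  -- left ones gives away a factor 2, which the final bound affords.
  onH-≤ : ∀ A → Proper A → length (onH A) ℕ.≤ #V * 2
  onH-≤ A proper = subst (length (onH A) ℕ.≤_)
    (trans (length-product (allFin #V) both-colours) (cong (_* 2) (length-allFin #V)))
    (unique-length (λ e (v , a) → endˡ e ≡ v × lookup A e ≡ a) (filter-unique (hasColour? A c c′))
      (λ {e} e∈ → (endˡ e , lookup A e) , ∈ˡ.∈-cartesianProduct⁺ (∈ˡ.∈-allFin (endˡ e))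
          (in-both (∈-filter⁻ (hasColour? A c c′) e∈)) , refl , refl)
      (λ _ _ (p , q) (p′ , q′) → proper-same A proper (inj₁ p) (inj₁ p′) (trans q (sym q′))))

  onH-connected? = λ (A : Assignment) (S : Subgraph) → connected? S ×-dec coloured? A c c′ S

  connected-path : ∀ A {S v} → Proper A → Connected S → CS A S → deg S v ≡ 1 → IsPath S
  connected-path A {S} {v} proper conn cs eq = conn , deg-≤2 (proper⇒near A proper) cs , v , eq

  -- `S` could leave `T` only at an end of `T`; there `S` has degree 1 as well and does not go on.
  shared-⊆ : ∀ A {S T e} → Proper A → Connected S → CS A S → CS A T → (∀ u → deg T u ≡ 1 → deg S u ≡ 1) →
      e ∈ S → e ∈ T → ∀ f → f ∈ S → f ∈ T
  shared-⊆ A {S} {T} {e} proper conn csS csT ends e∈S e∈T = connected-⊆ (_∈ T) conn e∈S e∈T step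
    where
    step : ∀ {g f} → g ∈ S → g ∈ T → f ∈ S → Adjacent g f → f ∈ T
    step {g} {f} g∈S g∈T f∈S (g≢f , u , i , j) =
      let h , t = focus (proper⇒near A proper) i (csS g g∈S) in go t (only t j (csS f f∈S))
      where
      two-edges : ∀ {h} → TwoAt A u g h → h ∈ S → deg S u ≢ 1
      two-edges t h∈ eq = lemma (degree csS t)
        where
        lemma : ¬ Degree S u g _
        lemma (both _ _ eq′)  = contradiction (trans (sym eq) eq′) λ ()
        lemma (left _ q _)    = q h∈
        lemma (right p _ _)   = p g∈S
        lemma (neither p _ _) = p g∈S
      go : ∀ {h} → TwoAt A u g h → f ≡ g ⊎ f ≡ h → f ∈ T
      go t (inj₁ f≡g) = contradiction (sym f≡g) g≢f
      go t (inj₂ refl) = lemma (degree csT t)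
        where
        lemma : Degree T u g f → f ∈ T
        lemma (both _ q _)    = q
        lemma (left _ _ eq)   = contradiction (ends u eq) (two-edges t f∈S)
        lemma (right p _ _)   = contradiction g∈T p
        lemma (neither p _ _) = contradiction g∈T p

  -- A path is encoded by its ends and the colour of its edge at the first one, a cycle by one of its vertices.
  Code : Assignment → Subgraph → Vertex × Colour × Vertex → Set
  Code A S (v , a , w) =
    (v ≡ w × (∀ u → deg S u ≢ 1) × ∃[ e ] (Incident v e × e ∈ S)) ⊎
    (v ≢ w × deg S v ≡ 1 × deg S w ≡ 1 × (∀ u → deg S u ≡ 1 → u ≡ v ⊎ u ≡ w) × ∃[ e ] (Incident v e × e ∈ S ×
        lookup A e ≡ a))

  codes : List (Vertex × Colour × Vertex)
  codes = cartesianProduct (allFin #V) (cartesianProduct both-colours (allFin #V))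

  length-codes : length codes ≡ #V * (2 * #V)
  length-codes = trans (length-product (allFin #V) (cartesianProduct both-colours (allFin #V)))
      (cong₂ _*_ (length-allFin #V)
    (trans (length-product both-colours (allFin #V)) (cong (2 *_) (length-allFin #V))))

  ∈-codes : ∀ {v a w} → In a → (v , a , w) ∈ˡ codes
  ∈-codes {v} {a} {w} a∈ = ∈ˡ.∈-cartesianProduct⁺ (∈ˡ.∈-allFin v) (∈ˡ.∈-cartesianProduct⁺ (in-both a∈) (∈ˡ.∈-allFin w))

  -- Flipping a path turns its ends into the deficient vertices, among which `elim⇒strip` then finds
  -- them.
  code-exists : ∀ A {S} → Proper A → Connected S → CS A S → ∃[ x ] (x ∈ˡ codes × Code A S x)
  code-exists A {S} proper conn cs = split (Fin.any? (λ u → deg S u ℕ.≟ 1))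
    where
    split : Dec (∃[ u ] deg S u ≡ 1) → ∃[ x ] (x ∈ˡ codes × Code A S x)
    split (no none) =
      let e , e∈ = proj₁ conn
      in (endˡ e , c , endˡ e) , ∈-codes (inj₁ refl) , inj₁ (refl , (λ u eq → none (u , eq)) , e , inj₁ refl , e∈)
    split (yes (u , eq)) =
      let el = path-elim {A} {S} (proper⇒near A proper) (proper⇒nodef A proper) (connected-path A proper conn cs eq) cs
          v , w , td , _ = elim⇒strip {flip c c′ S A} {S} (flip-near (proper⇒near A proper)) el
          degv = def⇒end el v (defˡ td)
          e , i , e∈ = deg-1⇒edge S v degv
      in (v , lookup A e , w) , ∈-codes (cs e e∈) ,
         inj₂ (neq td , degv , def⇒end el w (defʳ td) , (λ u d → onlyDef td (end⇒def el u d)) , e , i , e∈ , refl)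

  -- Equal codes give a common edge: for paths the edge at the first end with the given colour, for
  -- cycles any edge at the given vertex, where both have degree 2. With equal sets of ends,
  -- `shared-⊆` applies in both directions.
  code-injective : ∀ A {S T x} → Proper A → Connected S → CS A S → Connected T → CS A T → Code A S x →
      Code A T x → S ≡ T
  code-injective A {S} {T} proper connS csS connT csT = go
    where
    equal : ∀ {e} → (∀ u → deg S u ≡ 1 → deg T u ≡ 1) → (∀ u → deg T u ≡ 1 → deg S u ≡ 1) → e ∈ S → e ∈ T → S ≡ T
    equal p q e∈S e∈T = subset-≡ (shared-⊆ A proper connS csS csT q e∈S e∈T) (shared-⊆ A proper connT csT csS p e∈T e∈S)
    go : ∀ {x} → Code A S x → Code A T x → S ≡ T
    go (inj₁ (_ , cycS , e , i , e∈)) (inj₁ (_ , cycT , f , j , f∈)) =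
      let h , t = focus (proper⇒near A proper) i (csS e e∈)
      in equal (λ u eq → contradiction eq (cycS u)) (λ u eq → contradiction eq (cycT u))
          (f∈S t (only t j (csT f f∈))) f∈
      where
      f∈S : ∀ {h} → TwoAt A _ e h → f ≡ e ⊎ f ≡ h → f ∈ S
      f∈S t (inj₁ refl) = e∈
      f∈S t (inj₂ refl) = lemma (degree csS t)
        where
        lemma : Degree S _ e f → f ∈ S
        lemma (both _ q _)    = q
        lemma (left _ _ eq)   = contradiction eq (cycS _)
        lemma (right p _ _)   = contradiction e∈ p
        lemma (neither p _ _) = contradiction e∈ p
    go (inj₁ (eq , _)) (inj₂ (ne , _)) = contradiction eq ne
    go (inj₂ (ne , _)) (inj₁ (eq , _)) = contradiction eq ne
    go (inj₂ (_ , dv , dw , endsS , e , i , e∈ , ea)) (inj₂ (_ , dv′ , dw′ , endsT , f , j , f∈ , fa)) =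
      equal (λ u eq → lemma dv′ dw′ (endsS u eq)) (λ u eq → lemma dv dw (endsT u eq)) e∈
          (subst (_∈ T) (proper-same A proper j i (trans fa (sym ea))) f∈)
      where
      lemma : ∀ {R u v w} → deg R v ≡ 1 → deg R w ≡ 1 → u ≡ v ⊎ u ≡ w → deg R u ≡ 1
      lemma dv dw (inj₁ refl) = dv
      lemma dv dw (inj₂ refl) = dw

  connected-≤ : ∀ A → Proper A → length (connectedSubgraphs A c c′) ℕ.≤ #V * (2 * #V)
  connected-≤ A proper = subst (length (connectedSubgraphs A c c′) ℕ.≤_) length-codes
    (unique-length (Code A) (subsets-filter-unique (onH-connected? A))
      (λ S∈ → let conn , cs = ∈-subsets-filter⁻ (onH-connected? A) S∈ in code-exists A proper conn cs)
      (λ {S} {T} {x} S∈ T∈ → let conn , cs = ∈-subsets-filter⁻ (onH-connected? A) S∈ ; conn′ , cs′ = ∈-subsets-filter⁻ (onH-connected? A) T∈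
                   in code-injective A {S} {T} {x} proper conn cs conn′ cs′))

  even? = λ (A : Assignment) (S : Subgraph) → (isPath? S ×-dec (2 ∣? ∣ S ∣)) ×-dec coloured? A c c′ S

  evenPaths-≤ : ∀ A → Proper A → length (evenPaths A c c′) ℕ.≤ #V * (2 * #V)
  evenPaths-≤ A proper = ℕ.≤-trans
    (unique-length _≡_ (subsets-filter-unique (even? A))
      (λ {S} S∈ → let (path , _) , cs = ∈-subsets-filter⁻ (even? A) S∈ in S , ∈-subsets-filter (onH-connected? A) (proj₁ path , cs) , refl)
      (λ { _ _ refl refl → refl }))
    (connected-≤ A proper)

  -- Interchanging `c` and `c′` leaves the two-factor itself unchanged. Therefore both ends of a way
  -- with two colours offer literally the same list.
  connectedSubgraphs-flip : ∀ S A → connectedSubgraphs (flip c c′ S A) c c′ ≡ connectedSubgraphs A c c′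
  connectedSubgraphs-flip S A = List.filter-≐ (onH-connected? (flip c c′ S A)) (onH-connected? A)
    ((λ (p , q) → p , flip-coloured⁻ {S} {A = A} q) , (λ (p , q) → p , flip-coloured {S} {A = A} q)) (subsets #E)

χ : {W : Set} {w : W} → (∀ x → Dec (x ≡ w)) → W → ℚ
χ ≟w x = if does (≟w x) then 1ℚ else 0ℚ

module _ {W : Set} {w : W} (≟w : ∀ x → Dec (x ≡ w)) where

  χ-1 : χ ≟w w ≡ 1ℚ
  χ-1 rewrite dec-true (≟w w) refl = refl

  χ-0 : ∀ {x} → x ≢ w → χ ≟w x ≡ 0ℚ
  χ-0 {x} x≢w rewrite dec-false (≟w x) x≢w = refl

  0≤χ : ∀ x → 0ℚ ≤ℚ χ ≟w x
  0≤χ x with does (≟w x)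
  ... | true  = 0≤1
  ... | false = ℚ.≤-refl

  χ≤1 : ∀ x → χ ≟w x ≤ℚ 1ℚ
  χ≤1 x with does (≟w x)
  ... | true  = ℚ.≤-refl
  ... | false = 0≤1

-- The ratio of the probabilities of a way with two colours and its inverse

module TwoColours (G : BipartiteGraph) (k : ℕ) (regular : BipartiteGraph.Regular G k)
                  (c c′ : Fin k) (c≢c′ : c ≢ c′) where

  open Bounds G k regular c c′ c≢c′ public

  is? : ∀ (w x : Way) → Dec (x ≡ w)
  is? w x = x ≟ʷ w

  way₂ : Subgraph → Subgraph → Subgraph → Way
  way₂ S₁ F S₂ = two ((c , c′) , S₁ , F , S₂)

  eliminate₂ : Assignment → Subgraph → Subgraph → Dist Way
  eliminate₂ C S₁ F = eliminate c c′ (flip c c′ F (flip c c′ S₁ C)) >>= λ S₂ → return (way₂ S₁ F S₂)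

  from₂ : Assignment → Subgraph → Dist Way
  from₂ C S₁ = perturb₂ c c′ (flip c c′ S₁ C) >>= eliminate₂ C S₁

  sub-eliminate₂ : ∀ C S₁ F → Sub (eliminate₂ C S₁ F)
  sub-eliminate₂ C S₁ F = sub->>= {d = eliminate c c′ (flip c c′ F (flip c c′ S₁ C))} {f = λ S₂ → return (way₂ S₁ F S₂)}
    (sub-eliminate (allFin #V) (flip c c′ F (flip c c′ S₁ C))) (λ S₂ → sub-return (way₂ S₁ F S₂))

  sub-from₂ : ∀ C S₁ → Sub (from₂ C S₁)
  sub-from₂ C S₁ = sub->>= {d = perturb₂ c c′ (flip c c′ S₁ C)} {f = eliminate₂ C S₁}
      (sub-perturb₂ (flip c c′ S₁ C)) (sub-eliminate₂ C S₁)

  low-from₂ : ∀ C {A S₁ F S₂ m n} → flip c c′ S₁ C ≡ A → Low (perturb₂ c c′ A) F m →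
      Low (eliminate c c′ (flip c c′ F A)) S₂ n →
              Low (from₂ C S₁) (way₂ S₁ F S₂) (m * (n * 1))
  low-from₂ C {A} {S₁} {F} {S₂} {m} {n} refl lp le =
    low->>= {d = perturb₂ c c′ A} {f = eliminate₂ C S₁} {m = m} {n = n * 1} (λ F → nonneg (sub-eliminate₂ C S₁ F)) lp
      (low->>= {d = eliminate c c′ (flip c c′ F A)} {f = λ S₂ → return (way₂ S₁ F S₂)} {m = n} {n = 1}
          (λ S₂ → nonneg-return (way₂ S₁ F S₂)) le (low-return (way₂ S₁ F S₂)))

  supp-from₂ : ∀ C {S₁ w} → Supp (from₂ C S₁) w →
               ∃[ F ] ∃[ S₂ ] (Supp (perturb₂ c c′ (flip c c′ S₁ C)) F ×
                   Supp (eliminate c c′ (flip c c′ F (flip c c′ S₁ C))) S₂ × w ≡ way₂ S₁ F S₂)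
  supp-from₂ C {S₁} supp =
    let F , F∈ , p = supp->>= {d = perturb₂ c c′ (flip c c′ S₁ C)} {f = eliminate₂ C S₁} supp
        S₂ , S₂∈ , q = supp->>= {d = eliminate c c′ (flip c c′ F (flip c c′ S₁ C))} {f = λ S₂ → return (way₂ S₁ F S₂)} p
    in F , S₂ , F∈ , S₂∈ , supp-return q

  -- A way records its first flip, so no other first choice can produce it.
  vanish₂ : ∀ C {S₁ F S₂} S → S ≢ S₁ → E (from₂ C S) (χ (is? (way₂ S₁ F S₂))) ≡ 0ℚ
  vanish₂ C {S₁} {F} {S₂} S S≢ = E-vanish (from₂ C S) λ w supp →
    let F′ , S₂′ , _ , _ , eq = supp-from₂ C supp in χ-0 (is? (way₂ S₁ F S₂)) (λ w≡ → S≢ (first (trans (sym eq) w≡)))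
    where
    first : ∀ {F′ S₂′} → way₂ S F′ S₂′ ≡ way₂ S₁ F S₂ → S ≡ S₁
    first refl = refl

  inner-nodef : ∀ {A S} → Near A → NoDef A → CS A S → (∀ u → deg S u ≢ 1) → NoDef (flip c c′ S A)
  inner-nodef {A} {S} near nodef cs inner u def =
    let g , h , t = near u in split t (degree cs t)
    where
    split : ∀ {g h} → TwoAt A u g h → ¬ Degree S u g h
    split t (both p q _)    = ok⇒≢ t (nodef u) (flip-agree t (λ _ → q) (λ _ → p) (def⇒≡ (flip-two {S} t) def))
    split t (neither p q _) = ok⇒≢ t (nodef u) (flip-agree t (⊥-elim ∘ p) (⊥-elim ∘ q) (def⇒≡ (flip-two {S} t) def))
    split t (left _ _ eq)   = inner u eq
    split t (right _ _ eq)  = inner u eq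

  inner-cycle : ∀ {A S} → Near A → Connected S → CS A S → (∀ u → deg S u ≢ 1) → IsCycle S
  inner-cycle {A} {S} near conn cs inner = conn , λ u → let g , h , t = near u in split (degree cs t)
    where
    split : ∀ {u g h} → Degree S u g h → deg S u ≡ 0 ⊎ deg S u ≡ 2
    split (both _ _ eq)     = inj₂ eq
    split (neither _ _ eq)  = inj₁ eq
    split (left _ _ eq)     = contradiction eq (inner _)
    split (right _ _ eq)    = contradiction eq (inner _)

  cycle-inner : ∀ {S} → IsCycle S → ∀ u → deg S u ≢ 1
  cycle-inner (_ , degs) u eq with degs u
  ... | inj₁ eq′ = case trans (sym eq) eq′ of λ ()
  ... | inj₂ eq′ = case trans (sym eq) eq′ of λ ()

  ⊥-not-cycle : ¬ IsCycle ⊥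
  ⊥-not-cycle (((_ , e∈) , _) , _) = Subset.∉⊥ e∈

  inverse-cycle : ∀ {S₁ F S₂} → IsCycle S₁ → inverse (way₂ S₁ F S₂) ≡ way₂ S₁ F S₂
  inverse-cycle {S₁} cyc rewrite dec-true (isCycle? S₁) cyc = refl

  inverse-other : ∀ {S₁ F S₂} → ¬ IsCycle S₁ → inverse (way₂ S₁ F S₂) ≡ way₂ S₂ F S₁
  inverse-other {S₁} cyc rewrite dec-false (isCycle? S₁) cyc = refl

  -- In the case of parallel ways both start with a draw from the same list, so that its length cancels.
  data Verdict (C₁ C₂ : Assignment) (S₁ : Subgraph) (w : Way) (B : ℕ) : Set where
    parallel : ∀ {T} m → S₁ ∈ˡ connectedSubgraphs C₁ c c′ → T ∈ˡ connectedSubgraphs C₁ c c′ → connectedSubgraphs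
        C₂ c c′ ≡ connectedSubgraphs C₁ c c′ →
              Low (from₂ C₂ T) w m → m ℕ.≤ B → Verdict C₁ C₂ S₁ w B
    -- In the remaining two cases the forward probability is estimated by ½ only. The inverse way
    -- starts by doing nothing, or with a draw that costs the length of the list.
    resting : ∀ m → Low (from₂ C₂ ⊥) w m → m ℕ.≤ B → Verdict C₁ C₂ S₁ w B
    moving  : ∀ {T} m → T ∈ˡ connectedSubgraphs C₂ c c′ → Low (from₂ C₂ T) w m →
        length (connectedSubgraphs C₂ c c′) * m ℕ.≤ B → Verdict C₁ C₂ S₁ w B

  nonempty-≢ : ∀ {A S} → S ∈ˡ connectedSubgraphs A c c′ → S ≢ ⊥
  nonempty-≢ {A} S∈ eq = let ((e , e∈) , _) , _ = ∈-subsets-filter⁻ (onH-connected? A) S∈ in Subset.∉⊥ (subst (e ∈_) eq e∈)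

  verdict⇒≤ : ∀ C₁ C₂ {S₁ F S₂ w B} → Verdict C₁ C₂ S₁ w B →
              E (twoColours C₁ (c , c′)) (χ (is? (way₂ S₁ F S₂))) ≤ℚ ⟦ B ⟧ *ℚ E (twoColours C₂ (c , c′)) (χ (is? w))
  verdict⇒≤ C₁ C₂ {S₁} {F} {S₂} {w} {B} = split
    where
    φ = χ (is? (way₂ S₁ F S₂))
    ψ = χ (is? w)
    L₁ = connectedSubgraphs C₁ c c′
    L₂ = connectedSubgraphs C₂ c c′
    raise : ∀ {m p} → m ℕ.≤ B → p ≤ℚ ⟦ m ⟧ *ℚ E (Mixture ⊥ L₂ (from₂ C₂)) ψ → p ≤ℚ ⟦ B ⟧ *ℚ E
        (Mixture ⊥ L₂ (from₂ C₂)) ψ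
    raise m≤B le = ℚ.≤-trans le (*ℚ-monoʳ (E-nonneg (nonneg (sub-mixture ⊥ {L₂} {from₂ C₂} (sub-from₂ C₂)))
        (0≤χ (is? w))) (⟦⟧-mono m≤B))
    half : E (Mixture ⊥ L₁ (from₂ C₁)) φ ≤ℚ ½
    half = mixture-half ⊥ {from₂ C₁} {φ} (sub-from₂ C₁) (0≤χ (is? (way₂ S₁ F S₂))) (χ≤1 (is? (way₂ S₁ F S₂)))
        {S₁} (_≟ˢ S₁) (vanish₂ C₁) {L₁} (nonempty-≢ {C₁})
    split : Verdict C₁ C₂ S₁ w B → E (Mixture ⊥ L₁ (from₂ C₁)) φ ≤ℚ ⟦ B ⟧ *ℚ E (Mixture ⊥ L₂ (from₂ C₂)) ψ
    split (parallel m S₁∈ T∈ eq lw m≤B) = raise m≤B (subst (λ L → E (Mixture ⊥ L₁ (from₂ C₁)) φ ≤ℚ ⟦ m ⟧ *ℚ E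
        (Mixture ⊥ L (from₂ C₂)) ψ) (sym eq)
      (mixture-compare ⊥ {from₂ C₁} {φ} (sub-from₂ C₁) (0≤χ (is? (way₂ S₁ F S₂))) (χ≤1 (is? (way₂ S₁ F S₂)))
          {S₁} (_≟ˢ S₁) (vanish₂ C₁)
        {L₁} {from₂ C₂} {ψ} {m = m} (subsets-filter-unique (onH-connected? C₁)) (nonempty-≢ {C₁} S₁∈)
            (sub-from₂ C₂) (0≤χ (is? w)) (χ-1 (is? w)) T∈ lw))
    split (resting m lw m≤B) = raise m≤B (ℚ.≤-trans half (half-mixtureˡ ⊥ {from₂ C₂} {ψ} (sub-from₂ C₂)
        (0≤χ (is? w)) (χ-1 (is? w)) {L₂} {m} lw))
    split (moving m T∈ lw m≤B) = raise m≤B (ℚ.≤-trans half (half-mixtureʳ ⊥ {from₂ C₂} {ψ} (sub-from₂ C₂)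
        (0≤χ (is? w)) (χ-1 (is? w)) {L₂} {m = m} T∈ lw))

  module _ (2≤V : 2 ℕ.≤ #V) {B : ℕ} (8V²≤B : 8 * (#V * #V) ℕ.≤ B) where

    8V≤B : 8 * #V ℕ.≤ B
    8V≤B = ℕ.≤-trans (ℕ.*-monoʳ-≤ 8 (ℕ.m≤m*n #V #V {{ℕ.>-nonZero (ℕ.≤-trans (ℕ.s≤s ℕ.z≤n) 2≤V)}})) 8V²≤B

    8≤B : 8 ℕ.≤ B
    8≤B = ℕ.≤-trans (ℕ.m≤m*n 8 #V {{ℕ.>-nonZero (ℕ.≤-trans (ℕ.s≤s ℕ.z≤n) 2≤V)}}) 8V≤B

    -- The factors are the choice of the edge, the coin for recolouring at all, and the binary
    -- choice in the elimination. The product is merely linear in |V|.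
    onH-bound : ∀ A → Proper A → length (onH A) * 1 * 2 * (2 * 1) ℕ.≤ B
    onH-bound A proper = ℕ.≤-trans
        (ℕ.≤-trans (ℕ.*-monoˡ-≤ 2 (ℕ.*-monoˡ-≤ 2 (ℕ.≤-trans (ℕ.≤-reflexive (ℕ.*-identityʳ (length (onH A))))
        (onH-≤ A proper))))
      (ℕ.≤-reflexive (trans (ℕ.*-assoc (#V * 2) 2 2) (trans (ℕ.*-assoc #V 2 4) (ℕ.*-comm #V 8))))) 8V≤B

    -- The case that determines the constant: 2|V|² subgraphs and two binary choices. With two
    -- colours these are a deficient vertex and its edge, with three a deficient vertex and the edge
    -- of the elimination.
    list-bound : ∀ {n} → n ℕ.≤ #V * (2 * #V) → n * 4 ℕ.≤ B
    list-bound {n} le = ℕ.≤-trans (ℕ.≤-trans (ℕ.*-monoˡ-≤ 4 le) (ℕ.≤-reflexive lemma)) 8V²≤B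
      where
      open ≡-Reasoning
      lemma : #V * (2 * #V) * 4 ≡ 8 * (#V * #V)
      lemma = begin
        #V * (2 * #V) * 4    ≡⟨ cong (_* 4) (trans (sym (ℕ.*-assoc #V 2 #V))
            (trans (cong (_* #V) (ℕ.*-comm #V 2)) (ℕ.*-assoc 2 #V #V))) ⟩
        2 * (#V * #V) * 4    ≡⟨ ℕ.*-comm (2 * (#V * #V)) 4 ⟩
        4 * (2 * (#V * #V))  ≡⟨ ℕ.*-assoc 4 2 (#V * #V) ⟨
        8 * (#V * #V)        ∎

    module _ (C₁ : Assignment) (proper₁ : Proper C₁) where

      private
        near₁ = proper⇒near C₁ proper₁
        nodef₁ = proper⇒nodef C₁ proper₁

        Result : Subgraph → Subgraph → Subgraph → Set
        Result S₁ F S₂ = Verdict C₁ (flip c c′ S₂ (flip c c′ F (flip c c′ S₁ C₁))) S₁ (inverse (way₂ S₁ F S₂)) B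

      drawable : ∀ {S A T} → Connected T → CS A T → T ∈ˡ connectedSubgraphs (flip c c′ S A) c c′
      drawable {S} {A} conn cs = ∈-subsets-filter (onH-connected? (flip c c′ S A)) (conn , flip-coloured {S} {A = A} cs)

      same-list : ∀ S₁ F S₂ → connectedSubgraphs (flip c c′ S₂ (flip c c′ F (flip c c′ S₁ C₁))) c c′ ≡
          connectedSubgraphs C₁ c c′
      same-list S₁ F S₂ = trans (connectedSubgraphs-flip S₂ (flip c c′ F (flip c c′ S₁ C₁)))
          (trans (connectedSubgraphs-flip F (flip c c′ S₁ C₁)) (connectedSubgraphs-flip S₁ C₁))

      idle-verdict : Result ⊥ ⊥ ⊥
      idle-verdict = subst (λ w → Verdict C₁ C₂ ⊥ w B) (sym (inverse-other ⊥-not-cycle))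
        (resting 2 (low-from₂ C₂ {C₁} {m = 2} {n = 1} all≡ (low₂-⊥ {C₁} nodef₁)
            (subst (λ A → Low (eliminate c c′ A) ⊥ 1) (sym (flip-⊥ C₁)) (low-eliminate-nodef {C₁} nodef₁)))
          (ℕ.≤-trans (ℕ.s≤s (ℕ.s≤s ℕ.z≤n)) 8≤B))
        where
        C₂ = flip c c′ ⊥ (flip c c′ ⊥ (flip c c′ ⊥ C₁))
        all≡ : flip c c′ ⊥ C₂ ≡ C₁
        all≡ = trans (flip-⊥ C₂) (trans (flip-⊥ (flip c c′ ⊥ (flip c c′ ⊥ C₁))) (trans (flip-⊥ (flip c c′ ⊥ C₁))
            (flip-⊥ C₁)))

      -- The forward way creates the deficiencies by recolouring `e`; its inverse must draw `S₂`
      -- from the list and then recolour `e`, which cures both ends and leaves nothing to eliminate.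
      edge-verdict : ∀ {e S₂} → OnH C₁ e → Proper (flip c c′ S₂ (flip c c′ ⁅ e ⁆ (flip c c′ ⊥ C₁))) →
          Elim (flip c c′ ⁅ e ⁆ C₁) S₂ → Result ⊥ ⁅ e ⁆ S₂
      edge-verdict {e} {S₂} o proper₂ el = subst (λ w → Verdict C₁ C₂ ⊥ w B) (sym (inverse-other ⊥-not-cycle))
        (moving 4 (drawable {S₂} {flip c c′ ⁅ e ⁆ (flip c c′ ⊥ C₁)} (proj₁ (path el))
            (subst (λ A → CS (flip c c′ ⁅ e ⁆ A) S₂) (sym (flip-⊥ C₁)) (coloured el)))
          (low-from₂ C₂ {flip c c′ ⁅ e ⁆ C₁} {m = 4} {n = 1} (trans (flip-involutive S₂ _)
              (cong (flip c c′ ⁅ e ⁆) (flip-⊥ C₁)))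
            (low₂-def (flip-near near₁) td (defˡ td) (inj₁ refl) (flip-on {⁅ e ⁆} {C₁} o))
            (subst (λ A → Low (eliminate c c′ A) ⊥ 1) (sym (flip-involutive ⁅ e ⁆ C₁)) (low-eliminate-nodef {C₁}
                nodef₁)))
          (list-bound (connected-≤ C₂ proper₂)))
        where
        C₂ = flip c c′ S₂ (flip c c′ ⁅ e ⁆ (flip c c′ ⊥ C₁))
        td : TwoDef (flip c c′ ⁅ e ⁆ C₁) (endˡ e) (endʳ e)
        td = recolour-nodef {C₁} near₁ {e} o nodef₁

      module _ {S₁ : Subgraph} (S₁∈ : S₁ ∈ˡ connectedSubgraphs C₁ c c′) where

        private
          conn₁ : Connected S₁
          conn₁ = proj₁ (∈-subsets-filter⁻ (onH-connected? C₁) S₁∈)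
          cs₁ : CS C₁ S₁
          cs₁ = proj₂ (∈-subsets-filter⁻ (onH-connected? C₁) S₁∈)
          A : Assignment
          A = flip c c′ S₁ C₁

        cycle-verdict : IsCycle S₁ → Result S₁ ⊥ ⊥
        cycle-verdict cyc = subst (λ w → Verdict C₁ C₂ S₁ w B) (sym (inverse-cycle cyc))
          (parallel 2 S₁∈ S₁∈ (same-list S₁ ⊥ ⊥)
            (low-from₂ C₂ {C₁} {m = 2} {n = 1} all≡ (low₂-⊥ {C₁} nodef₁)
                (subst (λ A → Low (eliminate c c′ A) ⊥ 1) (sym (flip-⊥ C₁)) (low-eliminate-nodef {C₁} nodef₁)))
            (ℕ.≤-trans (ℕ.s≤s (ℕ.s≤s ℕ.z≤n)) 8≤B))
          where
          C₂ = flip c c′ ⊥ (flip c c′ ⊥ A)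
          all≡ : flip c c′ S₁ C₂ ≡ C₁
          all≡ = trans (cong (flip c c′ S₁) (trans (flip-⊥ (flip c c′ ⊥ A)) (flip-⊥ A))) (flip-involutive S₁ C₁)

        -- The inverse begins with the cycle `S₁` again. All flips use the same two colours and
        -- commute, so after `S₁` and `e` the assignment is `C₁` with `S₂` flipped, and eliminating
        -- `S₂` leads back to `C₁`.
        cycle-edge-verdict : ∀ {e S₂} → IsCycle S₁ → OnH A e → Proper (flip c c′ S₂ (flip c c′ ⁅ e ⁆ A)) →
            Elim (flip c c′ ⁅ e ⁆ A) S₂ → Result S₁ ⁅ e ⁆ S₂
        cycle-edge-verdict {e} {S₂} cyc o proper₂ el = subst (λ w → Verdict C₁ C₂ S₁ w B) (sym (inverse-cycle cyc))
          (parallel (length (onH Y) * 1 * 2 * (2 * 1)) S₁∈ S₁∈ (same-list S₁ ⁅ e ⁆ S₂)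
            (low-from₂ C₂ {Y} {m = length (onH Y) * 1 * 2} {n = 2} refl (low₂-edge {Y} nodefY oY)
              (subst (λ A → Low (eliminate c c′ A) S₂ 2) (sym all≡)
                (low-eliminate (flip-near near₁) (path-elim near₁ nodef₁ (path el) (flip-coloured⁻ {S₁} {A = C₁}
                    (flip-coloured⁻ {⁅ e ⁆} {A = A} (coloured el)))))))
            (onH-bound Y (nodef⇒proper nearY nodefY)))
          where
          C₂ = flip c c′ S₂ (flip c c′ ⁅ e ⁆ A)
          Y = flip c c′ S₁ C₂
          oY : OnH Y e
          oY = flip-on {S₁} {C₂} (flip-on {S₂} {flip c c′ ⁅ e ⁆ A} (flip-on {⁅ e ⁆} {A} o))
          cs₂ : CS C₂ S₁
          cs₂ = flip-coloured {S₂} {A = flip c c′ ⁅ e ⁆ A} (flip-coloured {⁅ e ⁆} {A = A}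
              (flip-coloured {S₁} {A = C₁} cs₁))
          near₂ : Near C₂
          near₂ = proper⇒near C₂ proper₂
          nearY : Near Y
          nearY = flip-near near₂
          nodefY : NoDef Y
          nodefY = inner-nodef near₂ (proper⇒nodef C₂ proper₂) cs₂ (cycle-inner cyc)
          all≡ : flip c c′ ⁅ e ⁆ Y ≡ flip c c′ S₂ C₁
          all≡ = begin
            flip c c′ ⁅ e ⁆ (flip c c′ S₁ (flip c c′ S₂ (flip c c′ ⁅ e ⁆ A)))  ≡⟨ cong (flip c c′ ⁅ e ⁆)
                (flip-comm S₁ S₂ (flip c c′ ⁅ e ⁆ A)) ⟩
            flip c c′ ⁅ e ⁆ (flip c c′ S₂ (flip c c′ S₁ (flip c c′ ⁅ e ⁆ A)))  ≡⟨ flip-comm ⁅ e ⁆ S₂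
                (flip c c′ S₁ (flip c c′ ⁅ e ⁆ A)) ⟩
            flip c c′ S₂ (flip c c′ ⁅ e ⁆ (flip c c′ S₁ (flip c c′ ⁅ e ⁆ A)))  ≡⟨ cong
                (λ Z → flip c c′ S₂ (flip c c′ ⁅ e ⁆ Z)) (flip-comm S₁ ⁅ e ⁆ A) ⟩
            flip c c′ S₂ (flip c c′ ⁅ e ⁆ (flip c c′ ⁅ e ⁆ (flip c c′ S₁ A)))  ≡⟨ cong (flip c c′ S₂)
                (flip-involutive ⁅ e ⁆ (flip c c′ S₁ A)) ⟩
            flip c c′ S₂ (flip c c′ S₁ (flip c c′ S₁ C₁))                      ≡⟨ cong (flip c c′ S₂)
                (flip-involutive S₁ C₁) ⟩
            flip c c′ S₂ C₁                                                    ∎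
            where open ≡-Reasoning

        -- The mirror image of `edge-verdict`: the forward way draws a path and ends by recolouring
        -- `e`, so the inverse starts idle and has to hit `e` among the edges of the two-factor.
        closing-verdict : ∀ {e} → Elim A S₁ → OnH A e → Proper (flip c c′ ⊥ (flip c c′ ⁅ e ⁆ A)) → Result S₁ ⁅ e ⁆ ⊥
        closing-verdict {e} el o proper₂ = subst (λ w → Verdict C₁ C₂ S₁ w B)
            (sym (inverse-other λ cyc → cycle-inner cyc _ (proj₂ (proj₂ (proj₂ (path el))))))
          (resting (length (onH C₂) * 1 * 2 * (2 * 1))
            (low-from₂ C₂ {C₂} {m = length (onH C₂) * 1 * 2} {n = 2} (flip-⊥ C₂)
                (low₂-edge {C₂} (proper⇒nodef C₂ proper₂) (flip-on {⊥} {flip c c′ ⁅ e ⁆ A} (flip-on {⁅ e ⁆} {A} o)))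
              (subst (λ A → Low (eliminate c c′ A) S₁ 2)
                  (sym (trans (cong (flip c c′ ⁅ e ⁆) (flip-⊥ (flip c c′ ⁅ e ⁆ A))) (flip-involutive ⁅ e ⁆ A)))
                  (low-eliminate (flip-near near₁) el)))
            (onH-bound C₂ proper₂))
          where
          C₂ = flip c c′ ⊥ (flip c c′ ⁅ e ⁆ A)

        -- Both directions draw a path from the common list. The remaining 8 = 4 · 2 stems from the
        -- choice of deficient vertex and edge and from the elimination.
        moving-verdict : ∀ {e S₂ x y} → Elim A S₁ → OnH A e → TwoDef (flip c c′ ⁅ e ⁆ A) x y → Incident x e →
            Elim (flip c c′ ⁅ e ⁆ A) S₂ → Result S₁ ⁅ e ⁆ S₂
        moving-verdict {e} {S₂} el o td i el₂ = subst (λ w → Verdict C₁ C₂ S₁ w B)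
            (sym (inverse-other λ cyc → cycle-inner cyc _ (proj₂ (proj₂ (proj₂ (path el))))))
          (parallel 8 S₁∈ (subst (S₂ ∈ˡ_) (same-list S₁ ⁅ e ⁆ S₂) (drawable {S₂} {flip c c′ ⁅ e ⁆ A}
              (proj₁ (path el₂)) (coloured el₂))) (same-list S₁ ⁅ e ⁆ S₂)
            (low-from₂ C₂ {flip c c′ ⁅ e ⁆ A} {m = 4} {n = 2} (flip-involutive S₂ (flip c c′ ⁅ e ⁆ A))
              (low₂-def (flip-near (flip-near near₁)) td (defˡ td) i (flip-on {⁅ e ⁆} {A} o))
              (subst (λ A → Low (eliminate c c′ A) S₁ 2) (sym (flip-involutive ⁅ e ⁆ A))
                  (low-eliminate (flip-near near₁) el)))
            8≤B)
          where
          C₂ = flip c c′ S₂ (flip c c′ ⁅ e ⁆ A)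

-- A way that is not listed has probability 0, so the comparison may assume the structure of a way
-- that does occur.
supp-compare : {W : Set} (_≟_ : ∀ (x y : W) → Dec (x ≡ y)) {d : Dist W} {w : W} {r : ℚ} → 0ℚ ≤ℚ r →
               (Supp d w → E d (χ (_≟ w)) ≤ℚ r) → E d (χ (_≟ w)) ≤ℚ r
supp-compare _≟_ {d} {w} {r} 0≤r le = split (w ∈ˡ? map proj₂ d)
  where
  open DecMembership _≟_ using () renaming (_∈?_ to _∈ˡ?_)
  split : Dec (Supp d w) → E d (χ (_≟ w)) ≤ℚ r
  split (yes supp) = le supp
  split (no none)  = subst (_≤ℚ r) (sym (E-vanish d (λ x x∈ → χ-0 (_≟ w) (λ x≡w → none (subst (Supp d) x≡w x∈))))) 0≤r

-- Case analysis of the ways with two colours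

module Acceptance₂ (G : BipartiteGraph) (k : ℕ) (regular : BipartiteGraph.Regular G k)
                   (c c′ : Fin k) (c≢c′ : c ≢ c′) where

  open TwoColours G k regular c c′ c≢c′ public

  module _ (2≤V : 2 ℕ.≤ #V) {B : ℕ} (8V²≤B : 8 * (#V * #V) ℕ.≤ B) where

    module _ (C₁ : Assignment) (proper₁ : Proper C₁) where

      private
        near₁ = proper⇒near C₁ proper₁
        nodef₁ = proper⇒nodef C₁ proper₁

        Result : Subgraph → Subgraph → Subgraph → Set
        Result S₁ F S₂ = Verdict C₁ (flip c c′ S₂ (flip c c′ F (flip c c′ S₁ C₁))) S₁ (inverse (way₂ S₁ F S₂)) B

        Ends : Subgraph → Subgraph → Subgraph → Set
        Ends S₁ F S₂ = Proper (flip c c′ S₂ (flip c c′ F (flip c c′ S₁ C₁)))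

      from-⊥ : ∀ {F S₂} → Ends ⊥ F S₂ → Supp (perturb₂ c c′ (flip c c′ ⊥ C₁)) F →
          Supp (eliminate c c′ (flip c c′ F (flip c c′ ⊥ C₁))) S₂ → Result ⊥ F S₂
      from-⊥ {F} {S₂} proper₂ suppF suppS =
          split (supp₂-nodef {C₁} nodef₁ (subst (λ A → Supp (perturb₂ c c′ A) F) (flip-⊥ C₁) suppF))
        where
        suppS′ : Supp (eliminate c c′ (flip c c′ F C₁)) S₂
        suppS′ = subst (λ A → Supp (eliminate c c′ (flip c c′ F A)) S₂) (flip-⊥ C₁) suppS
        rest-⊥ : F ≡ ⊥ → S₂ ≡ ⊥
        rest-⊥ eq = supp-eliminate-nodef {C₁} nodef₁ (subst (λ A → Supp (eliminate c c′ A) S₂)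
            (trans (cong (λ F → flip c c′ F C₁) eq) (flip-⊥ C₁)) suppS′)
        finish-⊥ : F ≡ ⊥ → S₂ ≡ ⊥ → Result ⊥ F S₂
        finish-⊥ refl refl = idle-verdict 2≤V 8V²≤B C₁ proper₁
        finish-e : ∀ {e} → OnH C₁ e → F ≡ ⁅ e ⁆ → Result ⊥ F S₂
        finish-e {e} o refl = edge-verdict 2≤V 8V²≤B C₁ proper₁ o proper₂ (supp-eliminate (flip-near near₁)
            (recolour-nodef {C₁} near₁ {e} o nodef₁) suppS′)
        split : F ≡ ⊥ ⊎ ∃[ e ] (OnH C₁ e × F ≡ ⁅ e ⁆) → Result ⊥ F S₂
        split (inj₁ eq)           = finish-⊥ eq (rest-⊥ eq)
        split (inj₂ (e , o , eq)) = finish-e o eq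

      from-cycle : ∀ {S₁ F S₂} → S₁ ∈ˡ connectedSubgraphs C₁ c c′ → (∀ u → deg S₁ u ≢ 1) → Ends S₁ F S₂ →
                   Supp (perturb₂ c c′ (flip c c′ S₁ C₁)) F →
                       Supp (eliminate c c′ (flip c c′ F (flip c c′ S₁ C₁))) S₂ → Result S₁ F S₂
      from-cycle {S₁} {F} {S₂} S₁∈ inner proper₂ suppF suppS = split (supp₂-nodef {A} nodefA suppF)
        where
        A : Assignment
        A = flip c c′ S₁ C₁
        cs₁ : CS C₁ S₁
        cs₁ = proj₂ (∈-subsets-filter⁻ (onH-connected? C₁) S₁∈)
        nodefA : NoDef A
        nodefA = inner-nodef near₁ nodef₁ cs₁ inner
        cyc : IsCycle S₁
        cyc = inner-cycle {C₁} near₁ (proj₁ (∈-subsets-filter⁻ (onH-connected? C₁) S₁∈)) cs₁ inner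
        rest-⊥ : F ≡ ⊥ → S₂ ≡ ⊥
        rest-⊥ eq = supp-eliminate-nodef {A} nodefA (subst (λ A → Supp (eliminate c c′ A) S₂)
            (trans (cong (λ F → flip c c′ F A) eq) (flip-⊥ A)) suppS)
        finish-⊥ : F ≡ ⊥ → S₂ ≡ ⊥ → Result S₁ F S₂
        finish-⊥ refl refl = cycle-verdict 2≤V 8V²≤B C₁ proper₁ S₁∈ cyc
        finish-e : ∀ {e} → OnH A e → F ≡ ⁅ e ⁆ → Result S₁ F S₂
        finish-e {e} o refl = cycle-edge-verdict 2≤V 8V²≤B C₁ proper₁ S₁∈ cyc o proper₂
          (supp-eliminate (flip-near (flip-near near₁)) (recolour-nodef {A} (flip-near near₁) {e} o nodefA) suppS)
        split : F ≡ ⊥ ⊎ ∃[ e ] (OnH A e × F ≡ ⁅ e ⁆) → Result S₁ F S₂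
        split (inj₁ eq)           = finish-⊥ eq (rest-⊥ eq)
        split (inj₂ (e , o , eq)) = finish-e o eq

      from-path : ∀ {S₁ F S₂ u} → S₁ ∈ˡ connectedSubgraphs C₁ c c′ → deg S₁ u ≡ 1 → Ends S₁ F S₂ →
                  Supp (perturb₂ c c′ (flip c c′ S₁ C₁)) F →
                      Supp (eliminate c c′ (flip c c′ F (flip c c′ S₁ C₁))) S₂ → Result S₁ F S₂
      from-path {S₁} {F} {S₂} S₁∈ eq proper₂ suppF suppS =
        let v , w , td , _ = elim⇒strip nearA el
            e , x , def , i , o , F≡ = supp₂-def nearA td suppF
        in finish o F≡ (recolour nearA td def i o)
        where
        A : Assignment
        A = flip c c′ S₁ C₁
        cs₁ : CS C₁ S₁
        cs₁ = proj₂ (∈-subsets-filter⁻ (onH-connected? C₁) S₁∈)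
        nearA : Near A
        nearA = flip-near near₁
        el : Elim A S₁
        el = path-elim near₁ nodef₁ (connected-path C₁ proper₁ (proj₁ (∈-subsets-filter⁻ (onH-connected? C₁)
            S₁∈)) cs₁ eq) cs₁
        Recoloured : Edge → Set
        Recoloured e = NoDef (flip c c′ ⁅ e ⁆ A) ⊎ ∃[ x ] ∃[ y ] (TwoDef (flip c c′ ⁅ e ⁆ A) x y × Incident x e)
        recolour : ∀ {v w x e} → Near A → TwoDef A v w → Deficient A x → Incident x e → OnH A e → Recoloured e
        recolour {v} {w} {x} {e} nearA td def i o = pick (onlyDef td def)
          where
          pick : x ≡ v ⊎ x ≡ w → Recoloured e
          pick (inj₁ x≡v) = recolour-deficit {A} nearA {e} o td (subst (λ y → Incident y e) x≡v i)
          pick (inj₂ x≡w) = recolour-deficit {A} nearA {e} o (twoDef-swap td) (subst (λ y → Incident y e) x≡w i)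
        finish : ∀ {e} → OnH A e → F ≡ ⁅ e ⁆ → Recoloured e → Result S₁ F S₂
        finish {e} o refl (inj₁ nodef) = close (supp-eliminate-nodef {flip c c′ ⁅ e ⁆ A} nodef suppS)
          where
          close : S₂ ≡ ⊥ → Result S₁ ⁅ e ⁆ S₂
          close refl = closing-verdict 2≤V 8V²≤B C₁ proper₁ S₁∈ el o proper₂
        finish {e} o refl (inj₂ (x , y , td , i)) = moving-verdict 2≤V 8V²≤B C₁ proper₁ S₁∈ el o td i
            (supp-eliminate (flip-near nearA) td suppS)

      -- A connected subgraph of the two-factor without vertices of degree 1 is an entire cycle.
      -- `inverse` treats exactly this case separately, which dictates the distinction.
      verdict : ∀ {S₁ F S₂} → S₁ ≡ ⊥ ⊎ S₁ ∈ˡ connectedSubgraphs C₁ c c′ → Ends S₁ F S₂ →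
                Supp (perturb₂ c c′ (flip c c′ S₁ C₁)) F → Supp (eliminate c c′ (flip c c′ F (flip c c′ S₁ C₁)))
                    S₂ → Result S₁ F S₂
      verdict (inj₁ refl) = from-⊥
      verdict {S₁} (inj₂ S₁∈) proper₂ suppF suppS = split (Fin.any? (λ u → deg S₁ u ℕ.≟ 1))
        where
        split : Dec (∃[ u ] deg S₁ u ≡ 1) → Result S₁ _ _
        split (yes (u , eq)) = from-path S₁∈ eq proper₂ suppF suppS
        split (no none)      = from-cycle S₁∈ (λ u eq → none (u , eq)) proper₂ suppF suppS

    accept₂ : ∀ C₁ C₂ w → Proper C₁ → Proper C₂ → apply C₁ w ≡ C₂ →
              E (twoColours C₁ (c , c′)) (χ (is? w)) ≤ℚ ⟦ B ⟧ *ℚ E (twoColours C₂ (c , c′)) (χ (is? (inverse w)))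
    accept₂ C₁ C₂ w proper₁ proper₂ ends = supp-compare _≟ʷ_ {twoColours C₁ (c , c′)} {w}
      (0≤*ℚ (0≤⟦⟧ B) (E-nonneg (nonneg (sub-mixture ⊥ {connectedSubgraphs C₂ c c′} {from₂ C₂} (sub-from₂ C₂)))
          (0≤χ (is? (inverse w))))) λ supp →
        let S₁ , S₁∈ , p = supp->>= {d = fair (return ⊥) (uniform (connectedSubgraphs C₁ c c′))} {f = from₂ C₁} supp
            F , S₂ , F∈ , S₂∈ , w≡ = supp-from₂ C₁ p
        in finish ends (drawn (supp-fair {d = return ⊥} {d′ = uniform (connectedSubgraphs C₁ c c′)} S₁∈)) F∈ S₂∈ w≡
      where
      drawn : ∀ {S₁} → Supp (return ⊥) S₁ ⊎ Supp (uniform (connectedSubgraphs C₁ c c′)) S₁ → S₁ ≡ ⊥ ⊎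
          S₁ ∈ˡ connectedSubgraphs C₁ c c′
      drawn (inj₁ p) = inj₁ (supp-return p)
      drawn (inj₂ p) = inj₂ (supp-uniform {xs = connectedSubgraphs C₁ c c′} p)
      finish : ∀ {w S₁ F S₂} → apply C₁ w ≡ C₂ → S₁ ≡ ⊥ ⊎ S₁ ∈ˡ connectedSubgraphs C₁ c c′ →
               Supp (perturb₂ c c′ (flip c c′ S₁ C₁)) F → Supp (eliminate c c′ (flip c c′ F (flip c c′ S₁ C₁)))
                   S₂ → w ≡ way₂ S₁ F S₂ →
               E (twoColours C₁ (c , c′)) (χ (is? w)) ≤ℚ ⟦ B ⟧ *ℚ E (twoColours C₂ (c , c′)) (χ (is? (inverse w)))
      finish {S₁ = S₁} {F} {S₂} ends S₁∈ F∈ S₂∈ refl = verdict⇒≤ C₁ C₂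
        (subst (λ C → Verdict C₁ C S₁ (inverse (way₂ S₁ F S₂)) B) ends (verdict C₁ proper₁ S₁∈
            (subst Proper (sym ends) proper₂) F∈ S₂∈))

-- Ways with three colours

module Acceptance₃ (G : BipartiteGraph) (k : ℕ) (regular : BipartiteGraph.Regular G k)
                   (c c′ c″ : Fin k) (c≢c′ : c ≢ c′) (c≢c″ : c″ ≢ c) (c′≢c″ : c″ ≢ c′) where

  open Acceptance₂ G k regular c c′ c≢c′ public

  c″∉ : ¬ In c″
  c″∉ (inj₁ eq) = c≢c″ eq
  c″∉ (inj₂ eq) = c′≢c″ eq

  way₃ : Subgraph → Colour × Subgraph → Subgraph → Way
  way₃ S₁ F S₂ = three (((c , c′) , c″) , S₁ , F , S₂)

  swapped₃ : Assignment → Colour × Subgraph → Assignment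
  swapped₃ A (c̃ , F) = flip c̃ c″ F A

  eliminate₃ : Assignment → Subgraph → Colour × Subgraph → Dist Way
  eliminate₃ C S₁ x = eliminate c c′ (swapped₃ (flip c c′ S₁ C) x) >>= λ S₂ → return (way₃ S₁ x S₂)

  from₃ : Assignment → Subgraph → Dist Way
  from₃ C S₁ = perturb₃ c c′ c″ (flip c c′ S₁ C) >>= eliminate₃ C S₁

  sub-eliminate₃ : ∀ C S₁ x → Sub (eliminate₃ C S₁ x)
  sub-eliminate₃ C S₁ x = sub->>= {d = eliminate c c′ (swapped₃ (flip c c′ S₁ C) x)} {f = λ S₂ → return (way₃ S₁ x S₂)}
    (sub-eliminate (allFin #V) (swapped₃ (flip c c′ S₁ C) x)) (λ S₂ → sub-return (way₃ S₁ x S₂))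

  sub-from₃ : ∀ C S₁ → Sub (from₃ C S₁)
  sub-from₃ C S₁ = sub->>= {d = perturb₃ c c′ c″ (flip c c′ S₁ C)} {f = eliminate₃ C S₁}
      (sub-perturb₃ c″ (flip c c′ S₁ C)) (sub-eliminate₃ C S₁)

  low-from₃ : ∀ C {A S₁ x S₂ m n} → flip c c′ S₁ C ≡ A → Low (perturb₃ c c′ c″ A) x m →
      Low (eliminate c c′ (swapped₃ A x)) S₂ n →
              Low (from₃ C S₁) (way₃ S₁ x S₂) (m * (n * 1))
  low-from₃ C {A} {S₁} {x} {S₂} {m} {n} refl lp le =
    low->>= {d = perturb₃ c c′ c″ A} {f = eliminate₃ C S₁} {m = m} {n = n * 1} (λ x → nonneg (sub-eliminate₃ C S₁ x)) lp
      (low->>= {d = eliminate c c′ (swapped₃ A x)} {f = λ S₂ → return (way₃ S₁ x S₂)} {m = n} {n = 1}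
          (λ S₂ → nonneg-return (way₃ S₁ x S₂)) le (low-return (way₃ S₁ x S₂)))

  supp-from₃ : ∀ C {S₁ w} → Supp (from₃ C S₁) w →
               ∃[ x ] ∃[ S₂ ] (Supp (perturb₃ c c′ c″ (flip c c′ S₁ C)) x ×
                   Supp (eliminate c c′ (swapped₃ (flip c c′ S₁ C) x)) S₂ × w ≡ way₃ S₁ x S₂)
  supp-from₃ C {S₁} supp =
    let x , x∈ , p = supp->>= {d = perturb₃ c c′ c″ (flip c c′ S₁ C)} {f = eliminate₃ C S₁} supp
        S₂ , S₂∈ , q = supp->>= {d = eliminate c c′ (swapped₃ (flip c c′ S₁ C) x)} {f = λ S₂ → return (way₃ S₁ x S₂)} p
    in x , S₂ , x∈ , S₂∈ , supp-return q

  vanish₃ : ∀ C {S₁ x S₂} S → S ≢ S₁ → E (from₃ C S) (χ (is? (way₃ S₁ x S₂))) ≡ 0ℚ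
  vanish₃ C {S₁} {x} {S₂} S S≢ = E-vanish (from₃ C S) λ w supp →
    let x′ , S₂′ , _ , _ , eq = supp-from₃ C supp in χ-0 (is? (way₃ S₁ x S₂)) (λ w≡ → S≢ (first (trans (sym eq) w≡)))
    where
    first : ∀ {x′ S₂′} → way₃ S x′ S₂′ ≡ way₃ S₁ x S₂ → S ≡ S₁
    first refl = refl

  -- There is no parallel case here: a swap with `c″` changes which edges have colours `c` and `c′`,
  -- so the lists of even paths at the two ends of a way need not agree.
  data Verdict₃ (C₂ : Assignment) (w : Way) (B : ℕ) : Set where
    resting : ∀ m → Low (from₃ C₂ ⊥) w m → m ℕ.≤ B → Verdict₃ C₂ w B
    moving  : ∀ {T} m → T ∈ˡ evenPaths C₂ c c′ → Low (from₃ C₂ T) w m → length (evenPaths C₂ c c′) * m ℕ.≤ B →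
        Verdict₃ C₂ w B

  evenPath-≢ : ∀ {A S} → S ∈ˡ evenPaths A c c′ → S ≢ ⊥
  evenPath-≢ {A} S∈ eq = let ((((e , e∈) , _) , _) , _) , _ = ∈-subsets-filter⁻ (even? A) S∈ in Subset.∉⊥ (subst (e ∈_) eq e∈)

  verdict₃⇒≤ : ∀ C₁ C₂ {S₁ x S₂ w B} → Verdict₃ C₂ w B →
               E (threeColours C₁ ((c , c′) , c″)) (χ (is? (way₃ S₁ x S₂))) ≤ℚ ⟦ B ⟧ *ℚ E
                   (threeColours C₂ ((c , c′) , c″)) (χ (is? w))
  verdict₃⇒≤ C₁ C₂ {S₁} {x} {S₂} {w} {B} = split
    where
    φ = χ (is? (way₃ S₁ x S₂))
    ψ = χ (is? w)
    L₁ = evenPaths C₁ c c′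
    L₂ = evenPaths C₂ c c′
    raise : ∀ {m p} → m ℕ.≤ B → p ≤ℚ ⟦ m ⟧ *ℚ E (Mixture ⊥ L₂ (from₃ C₂)) ψ → p ≤ℚ ⟦ B ⟧ *ℚ E
        (Mixture ⊥ L₂ (from₃ C₂)) ψ
    raise m≤B le = ℚ.≤-trans le (*ℚ-monoʳ (E-nonneg (nonneg (sub-mixture ⊥ {L₂} {from₃ C₂} (sub-from₃ C₂)))
        (0≤χ (is? w))) (⟦⟧-mono m≤B))
    half : E (Mixture ⊥ L₁ (from₃ C₁)) φ ≤ℚ ½
    half = mixture-half ⊥ {from₃ C₁} {φ} (sub-from₃ C₁) (0≤χ (is? (way₃ S₁ x S₂))) (χ≤1 (is? (way₃ S₁ x S₂)))
        {S₁} (_≟ˢ S₁) (vanish₃ C₁) {L₁} (evenPath-≢ {C₁})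
    split : Verdict₃ C₂ w B → E (Mixture ⊥ L₁ (from₃ C₁)) φ ≤ℚ ⟦ B ⟧ *ℚ E (Mixture ⊥ L₂ (from₃ C₂)) ψ
    split (resting m lw m≤B)   = raise m≤B (ℚ.≤-trans half (half-mixtureˡ ⊥ {from₃ C₂} {ψ} (sub-from₃ C₂)
        (0≤χ (is? w)) (χ-1 (is? w)) {L₂} {m} lw))
    split (moving m T∈ lw m≤B) = raise m≤B (ℚ.≤-trans half (half-mixtureʳ ⊥ {from₃ C₂} {ψ} (sub-from₃ C₂)
        (0≤χ (is? w)) (χ-1 (is? w)) {L₂} {m = m} T∈ lw))

  opposite-away : ∀ {A v w u} → TwoDef A v w → Opposite A v w → Deficient A u →
                  ∀ {x} → Deficient A x → x ≢ u → side x ≡ side u × (∀ a → Repeated A u a → ¬ Repeated A x a)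
  opposite-away {A} {v} {w} td (sd , opp) def {x} defx x≢u = split (onlyDef td def) (onlyDef td defx) x≢u
    where
    split : ∀ {u x} → u ≡ v ⊎ u ≡ w → x ≡ v ⊎ x ≡ w → x ≢ u → side x ≡ side u × (∀ a → Repeated A u a →
        ¬ Repeated A x a)
    split (inj₁ refl) (inj₁ refl) ne = contradiction refl ne
    split (inj₁ refl) (inj₂ refl) _  = sd , opp
    split (inj₂ refl) (inj₁ refl) _  = sym sd , λ a p q → opp a q p
    split (inj₂ refl) (inj₂ refl) ne = contradiction refl ne

  counts-opposite : ∀ {A B v w} → SameCounts A B → Opposite A v w → Opposite B v w
  counts-opposite {A} {B} {v} {w} same (sd , opp) = sd , λ a p q →
    opp a (counts-repeated B A (λ u d → sym (same u d)) {v} {a} p) (counts-repeated B A (λ u d → sym (same u d))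
        {w} {a} q)

  alternatingCycle-swap : ∀ A {a b F} → AlternatingCycle A a b F → AlternatingCycle A b a F
  alternatingCycle-swap A (cyc , col , alt) = cyc , (λ e e∈ → swap (col e e∈)) , alt

  -- The selected cycle is unique, so that its inverse swap is drawn with the same probability.
  low₃-cycle : ∀ {A v w u c̃ F} → Near A → TwoDef A v w → Opposite A v w → Deficient A u → Repeated A u c̃ →
               AlternatingCycle A c̃ c″ F → ∃[ e ] (Incident u e × e ∈ F) → Low (perturb₃ c c′ c″ A) (c̃ , F) 2
  low₃-cycle {A} {v} {w} {u} {c̃} {F} near td opp def rep cyc touch =
    let g , h , t = near u
    in start (incˡ t) (onˡ t) (repeated⇒≡ {d = c̃} t rep)
    where
    start : ∀ {e₀} → Incident u e₀ → OnH A e₀ → c̃ ≡ lookup A e₀ → Low (perturb₃ c c′ c″ A) (c̃ , F) 2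
    start {e₀} i o c̃≡ =
      let F₀ , _ , _ , unique = cycle-at {A} near {u} def {e₀} i o (opposite-away td opp def) {c″} c″∉
          cyc′ = subst (λ a → AlternatingCycle A a c″ F) c̃≡ cyc
      in subst (λ a → Low (perturb₃ c c′ c″ A) (a , F) 2) (sym c̃≡)
        (low₃-def near td def i o cyc′ touch (λ p q → trans (unique p q) (sym (unique cyc′ touch))))

  module _ (2≤V : 2 ℕ.≤ #V) {B : ℕ} (8V²≤B : 8 * (#V * #V) ℕ.≤ B) (C₁ : Assignment) (proper₁ : Proper C₁) where

    private
      near₁ = proper⇒near C₁ proper₁
      nodef₁ = proper⇒nodef C₁ proper₁

      Ends₃ : Subgraph → Colour × Subgraph → Subgraph → Assignment
      Ends₃ S₁ x S₂ = flip c c′ S₂ (swapped₃ (flip c c′ S₁ C₁) x)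

    -- The swap exchanges the colours of `e` and `f`. Selecting the same vertex again, with the
    -- roles of the two edges exchanged, therefore selects the same cycle.
    proper-verdict₃ : ∀ {v e f F} → Incident v e → lookup C₁ e ≡ c″ → Incident v f → OnH C₁ f → Through c″ C₁ e f F →
                      Verdict₃ (Ends₃ ⊥ (lookup C₁ f , F) ⊥) (way₃ ⊥ (lookup C₁ f , F) ⊥) B
    proper-verdict₃ {v} {e} {f} {F} ie ec jf fo (cyc , e∈ , f∈) =
      resting (#V * 2 * (1 * 1)) (low-from₃ C₂ {A′} {m = #V * 2} {n = 1} C₂≡
        (subst (λ a → Low (perturb₃ c c′ c″ A′) (a , F) (#V * 2)) e′ (low₃-nodef {A′} {c″} proper′ jf f′ ie
            (subst In (sym e′) fo) (subst (λ a → AlternatingCycle A′ c″ a F) (sym e′) (alternatingCycle-swap A′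
            (cycle-flip C₁ cyc′)) , f∈ , e∈)))
        (subst (λ A → Low (eliminate c c′ A) ⊥ 1) (sym (flip-involutive F C₁)) (low-eliminate-nodef {C₁} nodef₁)))
        (ℕ.≤-trans (ℕ.≤-reflexive (trans (ℕ.*-identityʳ (#V * 2)) (ℕ.*-comm #V 2)))
            (ℕ.≤-trans (ℕ.*-monoˡ-≤ #V (ℕ.s≤s (ℕ.s≤s (ℕ.z≤n {6})))) (8V≤B 2≤V 8V²≤B)))
      where
      c̃ = lookup C₁ f
      cyc′ : AlternatingCycle C₁ c̃ c″ F
      cyc′ = alternatingCycle-swap C₁ cyc
      A′ = flip c̃ c″ F C₁
      C₂ = Ends₃ ⊥ (c̃ , F) ⊥
      C₂≡ : flip c c′ ⊥ C₂ ≡ A′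
      C₂≡ = trans (flip-⊥ C₂) (trans (flip-⊥ (flip c̃ c″ F (flip c c′ ⊥ C₁))) (cong (flip c̃ c″ F) (flip-⊥ C₁)))
      proper′ : Proper A′
      proper′ = counts-proper C₁ A′ (λ u d → sym (cycle-count C₁ cyc′ u d)) proper₁
      f′ : lookup A′ f ≡ c″
      f′ = trans (flip-∈ C₁ f∈) (transposeˡ c̃ c″)
      e′ : lookup A′ e ≡ c̃
      e′ = trans (flip-∈ C₁ e∈) (trans (cong (Perm.transpose c̃ c″) ec) (transposeʳ c̃ c″))

    -- The swap preserves all counts, hence the deficient vertices, their repeated colours and their
    -- opposite types. So `S₂` joins vertices of one side and is even, and the inverse way can draw
    -- it; 4 = 2 · 2 counts the deficient vertex and the elimination.
    deficient-verdict₃ : ∀ {S₁ S₂ v w u c̃ F} → Elim (flip c c′ S₁ C₁) S₁ → TwoDef (flip c c′ S₁ C₁) v w →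
        Opposite (flip c c′ S₁ C₁) v w →
                         Deficient (flip c c′ S₁ C₁) u → Repeated (flip c c′ S₁ C₁) u c̃ → AlternatingCycle
                             (flip c c′ S₁ C₁) c̃ c″ F → ∃[ e ] (Incident u e × e ∈ F) →
                         Supp (eliminate c c′ (flip c̃ c″ F (flip c c′ S₁ C₁))) S₂ → Proper (Ends₃ S₁ (c̃ , F) S₂) →
                         Verdict₃ (Ends₃ S₁ (c̃ , F) S₂) (way₃ S₂ (c̃ , F) S₁) B
    deficient-verdict₃ {S₁} {S₂} {v} {w} {u} {c̃} {F} el td opp def rep cyc touch supp proper₂ =
      moving 4 (∈-subsets-filter (even? C₂) ((path el₂ , same-side⇒even near′ td′ (proj₁ opp) el₂) ,
          flip-coloured {S₂} {A = A′} (coloured el₂)))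
        (low-from₃ C₂ {A′} {m = 2} {n = 2} (flip-involutive S₂ A′)
          (low₃-cycle near′ td′ (counts-opposite {A} {A′} {v} {w} same′ opp) (counts-deficient A A′ same′ {u}
              def) (counts-repeated A A′ same′ {u} {c̃} rep) (cycle-flip A cyc) touch)
          (subst (λ A → Low (eliminate c c′ A) S₁ 2) (sym (flip-involutive F A)) (low-eliminate nearA el)))
        (list-bound 2≤V 8V²≤B (evenPaths-≤ C₂ proper₂))
      where
      A = flip c c′ S₁ C₁
      A′ = flip c̃ c″ F A
      C₂ = Ends₃ S₁ (c̃ , F) S₂
      nearA : Near A
      nearA = flip-near near₁
      same′ : SameCounts A A′
      same′ u d = sym (cycle-count A cyc u d)
      near′ : Near A′
      near′ = counts-near {A} {A′} same′ nearA
      td′ : TwoDef A′ v w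
      td′ = counts-twoDef {A} {A′} same′ td
      el₂ : Elim A′ S₂
      el₂ = supp-eliminate near′ td′ supp

    from-⊥₃ : ∀ {x S₂} → Supp (perturb₃ c c′ c″ (flip c c′ ⊥ C₁)) x →
        Supp (eliminate c c′ (swapped₃ (flip c c′ ⊥ C₁) x)) S₂ →
              Verdict₃ (Ends₃ ⊥ x S₂) (way₃ S₂ x ⊥) B
    from-⊥₃ {x} {S₂} suppx suppS =
      let v , e , f , F , ie , ec , jf , fo , thr , x≡ = supp₃-nodef {C₁} {c″} {x} nodef₁
              (subst (λ A → Supp (perturb₃ c c′ c″ A) x) (flip-⊥ C₁) suppx)
      in finish ie ec jf fo thr x≡ (none thr x≡)
      where
      none : ∀ {e f F} → Through c″ C₁ e f F → x ≡ (lookup C₁ f , F) → S₂ ≡ ⊥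
      none {e} {f} {F} (cyc , _) refl = supp-eliminate-nodef {flip (lookup C₁ f) c″ F C₁}
        (proper⇒nodef (flip (lookup C₁ f) c″ F C₁) (counts-proper C₁ (flip (lookup C₁ f) c″ F C₁)
            (λ u d → sym (cycle-count C₁ (alternatingCycle-swap C₁ cyc) u d)) proper₁))
        (subst (λ A → Supp (eliminate c c′ (flip (lookup C₁ f) c″ F A)) S₂) (flip-⊥ C₁) suppS)
      finish : ∀ {v e f F} → Incident v e → lookup C₁ e ≡ c″ → Incident v f → OnH C₁ f → Through c″ C₁ e f F →
          x ≡ (lookup C₁ f , F) → S₂ ≡ ⊥ →
               Verdict₃ (Ends₃ ⊥ x S₂) (way₃ S₂ x ⊥) B
      finish ie ec jf fo thr refl refl = proper-verdict₃ ie ec jf fo thr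

    from-even₃ : ∀ {S₁ x S₂} → S₁ ∈ˡ evenPaths C₁ c c′ → Proper (Ends₃ S₁ x S₂) →
                 Supp (perturb₃ c c′ c″ (flip c c′ S₁ C₁)) x → Supp (eliminate c c′ (swapped₃ (flip c c′ S₁ C₁) x)) S₂ →
                 Verdict₃ (Ends₃ S₁ x S₂) (way₃ S₂ x S₁) B
    from-even₃ {S₁} {x} {S₂} S₁∈ proper₂ suppx suppS =
      let (isPath , even) , cs = ∈-subsets-filter⁻ (even? C₁) S₁∈
          el = path-elim near₁ nodef₁ isPath cs
          v , w , td , par = elim⇒strip (flip-near near₁) el
          u , c̃ , F , def , rep , cyc , touch , x≡ = supp₃-def td suppx
      in finish el td (opp even par) def rep cyc touch x≡
      where
      opp : ∀ {v w} → 2 ∣ ∣ S₁ ∣ → Parity (flip c c′ S₁ C₁) v w S₁ → Opposite (flip c c′ S₁ C₁) v w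
      opp _    (inj₁ (_ , o)) = o
      opp even (inj₂ (odd , _)) = contradiction even odd
      finish : ∀ {v w u c̃ F} → Elim (flip c c′ S₁ C₁) S₁ → TwoDef (flip c c′ S₁ C₁) v w →
          Opposite (flip c c′ S₁ C₁) v w →
               Deficient (flip c c′ S₁ C₁) u → Repeated (flip c c′ S₁ C₁) u c̃ → AlternatingCycle
                   (flip c c′ S₁ C₁) c̃ c″ F → ∃[ e ] (Incident u e × e ∈ F) →
               x ≡ (c̃ , F) → Verdict₃ (Ends₃ S₁ x S₂) (way₃ S₂ x S₁) B
      finish el td opp def rep cyc touch refl = deficient-verdict₃ el td opp def rep cyc touch suppS proper₂

  accept₃ : 2 ℕ.≤ #V → ∀ {B} → 8 * (#V * #V) ℕ.≤ B → ∀ C₁ C₂ w → Proper C₁ → Proper C₂ → apply C₁ w ≡ C₂ →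
            E (threeColours C₁ ((c , c′) , c″)) (χ (is? w)) ≤ℚ ⟦ B ⟧ *ℚ E (threeColours C₂ ((c , c′) , c″))
                (χ (is? (inverse w)))
  accept₃ 2≤V {B} 8V²≤B C₁ C₂ w proper₁ proper₂ ends = supp-compare _≟ʷ_ {threeColours C₁ ((c , c′) , c″)} {w}
    (0≤*ℚ (0≤⟦⟧ B) (E-nonneg (nonneg (sub-mixture ⊥ {evenPaths C₂ c c′} {from₃ C₂} (sub-from₃ C₂)))
        (0≤χ (is? (inverse w))))) λ supp →
      let S₁ , S₁∈ , p = supp->>= {d = fair (return ⊥) (uniform (evenPaths C₁ c c′))} {f = from₃ C₁} supp
          x , S₂ , x∈ , S₂∈ , w≡ = supp-from₃ C₁ p
      in finish ends (supp-fair {d = return ⊥} {d′ = uniform (evenPaths C₁ c c′)} S₁∈) x∈ S₂∈ w≡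
    where
    finish : ∀ {w S₁ x S₂} → apply C₁ w ≡ C₂ → Supp (return ⊥) S₁ ⊎ Supp (uniform (evenPaths C₁ c c′)) S₁ →
             Supp (perturb₃ c c′ c″ (flip c c′ S₁ C₁)) x → Supp (eliminate c c′ (swapped₃ (flip c c′ S₁ C₁) x))
                 S₂ → w ≡ way₃ S₁ x S₂ →
             E (threeColours C₁ ((c , c′) , c″)) (χ (is? w)) ≤ℚ ⟦ B ⟧ *ℚ E (threeColours C₂ ((c , c′) , c″))
                 (χ (is? (inverse w)))
    finish {x = x} {S₂} ends (inj₁ (here refl)) x∈ S₂∈ refl = verdict₃⇒≤ C₁ C₂
      (subst (λ C → Verdict₃ C (way₃ S₂ x ⊥) B) ends (from-⊥₃ 2≤V 8V²≤B C₁ proper₁ x∈ S₂∈))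
    finish {S₁ = S₁} {x} {S₂} ends (inj₂ p) x∈ S₂∈ refl = verdict₃⇒≤ C₁ C₂
      (subst (λ C → Verdict₃ C (way₃ S₂ x S₁) B) ends (from-even₃ 2≤V 8V²≤B C₁ proper₁
          (supp-uniform {xs = evenPaths C₁ c c′} p) (subst Proper (sym ends) proper₂) x∈ S₂∈))

-- From the ratio for ways to the acceptance probability

Pr≡E : {A : Set} {P : Pred A 0ℓ} (P? : Decidable P) (d : Dist A) → Pr P? d ≡ E d (λ a → if does (P? a) then 1ℚ else 0ℚ)
Pr≡E P? []            = refl
Pr≡E P? ((p , a) ∷ d) = cong₂ _+ℚ_ (lemma (does (P? a))) (Pr≡E P? d)
  where
  lemma : ∀ b → (if b then p else 0ℚ) ≡ p *ℚ (if b then 1ℚ else 0ℚ)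
  lemma true  = sym (ℚ.*-identityʳ p)
  lemma false = sym (ℚ.*-zeroʳ p)

>>=-compare : {A B : Set} {d : Dist A} {f g : A → Dist B} {φ ψ : B → ℚ} {q : ℚ} → Nonneg d →
              (∀ a → Supp d a → E (f a) φ ≤ℚ q *ℚ E (g a) ψ) → E (d >>= f) φ ≤ℚ q *ℚ E (d >>= g) ψ
>>=-compare {d = d} {f} {g} {φ} {ψ} {q} nn le = begin
  E (d >>= f) φ                    ≡⟨ E->>= d f φ ⟩
  E d (λ a → E (f a) φ)            ≤⟨ E-mono nn le ⟩
  E d (λ a → q *ℚ E (g a) ψ)       ≡⟨ E-*ˡ d q (λ a → E (g a) ψ) ⟩
  q *ℚ E d (λ a → E (g a) ψ)       ≡⟨ cong (q *ℚ_) (E->>= d g ψ) ⟨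
  q *ℚ E (d >>= g) ψ               ∎
  where open ℚ.≤-Reasoning

uniformOr-compare : {A B : Set} {d : Dist B} (xs : List A) {f g : A → Dist B} {φ ψ : B → ℚ} {q : ℚ} →
    E d φ ≤ℚ q *ℚ E d ψ →
                    (∀ a → a ∈ˡ xs → E (f a) φ ≤ℚ q *ℚ E (g a) ψ) → E (uniformOr d xs f) φ ≤ℚ q *ℚ E
                        (uniformOr d xs g) ψ
uniformOr-compare []       le _  = le
uniformOr-compare (x ∷ xs) {f} {g} {φ} {ψ} {q} _ le = >>=-compare {d = uniform (x ∷ xs)} {f} {g} {φ} {ψ} {q}
    (nonneg-uniform (x ∷ xs)) (λ a a∈ → le a (supp-uniform {xs = x ∷ xs} a∈))

nonneg->>=-supp : {A B : Set} {d : Dist B} {f : B → Dist A} → Nonneg d → (∀ b → Supp d b → Nonneg (f b)) →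
    Nonneg (d >>= f)
nonneg->>=-supp All.[]         nnf = All.[]
nonneg->>=-supp (0≤p All.∷ nn) nnf = All.++⁺ (nonneg-scale 0≤p (nnf _ (here refl)))
    (nonneg->>=-supp nn (λ b b∈ → nnf b (there b∈)))

nonneg-uniformOr : {A B : Set} {d : Dist B} (xs : List A) {f : A → Dist B} → Nonneg d →
    (∀ a → a ∈ˡ xs → Nonneg (f a)) → Nonneg (uniformOr d xs f)
nonneg-uniformOr []       nn _   = nn
nonneg-uniformOr (x ∷ xs) {f} _ nnf = nonneg->>=-supp {d = uniform (x ∷ xs)} {f = f} (nonneg-uniform (x ∷ xs))
    (λ a a∈ → nnf a (supp-uniform {xs = x ∷ xs} a∈))

scale-compare : {A : Set} {d d′ : Dist A} {φ ψ : A → ℚ} {q : ℚ} (p : ℚ) → 0ℚ ≤ℚ p → E d φ ≤ℚ q *ℚ E d′ ψ →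
    E (scale p d) φ ≤ℚ q *ℚ E (scale p d′) ψ
scale-compare {d = d} {d′} {φ} {ψ} {q} p 0≤p le = begin
  E (scale p d) φ          ≡⟨ E-scale p d φ ⟩
  p *ℚ E d φ               ≤⟨ *ℚ-monoˡ 0≤p le ⟩
  p *ℚ (q *ℚ E d′ ψ)       ≡⟨ ℚ.*-assoc p q (E d′ ψ) ⟨
  p *ℚ q *ℚ E d′ ψ         ≡⟨ cong (_*ℚ E d′ ψ) (ℚ.*-comm p q) ⟩
  q *ℚ p *ℚ E d′ ψ         ≡⟨ ℚ.*-assoc q p (E d′ ψ) ⟩
  q *ℚ (p *ℚ E d′ ψ)       ≡⟨ cong (q *ℚ_) (E-scale p d′ ψ) ⟨
  q *ℚ E (scale p d′) ψ    ∎
  where open ℚ.≤-Reasoning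

++-compare : {A : Set} {d₁ d₂ e₁ e₂ : Dist A} {φ ψ : A → ℚ} {q : ℚ} → E d₁ φ ≤ℚ q *ℚ E e₁ ψ → E d₂ φ ≤ℚ q *ℚ E
    e₂ ψ → E (d₁ ++ d₂) φ ≤ℚ q *ℚ E (e₁ ++ e₂) ψ
++-compare {d₁ = d₁} {d₂} {e₁} {e₂} {φ} {ψ} {q} le₁ le₂ = begin
  E (d₁ ++ d₂) φ                    ≡⟨ E-++ d₁ d₂ φ ⟩
  E d₁ φ +ℚ E d₂ φ                  ≤⟨ ℚ.+-mono-≤ le₁ le₂ ⟩
  q *ℚ E e₁ ψ +ℚ q *ℚ E e₂ ψ        ≡⟨ ℚ.*-distribˡ-+ q (E e₁ ψ) (E e₂ ψ) ⟨
  q *ℚ (E e₁ ψ +ℚ E e₂ ψ)           ≡⟨ cong (q *ℚ_) (E-++ e₁ e₂ ψ) ⟨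
  q *ℚ E (e₁ ++ e₂) ψ               ∎
  where open ℚ.≤-Reasoning

-- Both terms of the minimum `r` satisfy 1 ≤ `B` · `r`. This also makes `r` positive, so that the
-- inverse exists, and dividing gives the bound.
inverse-minimum : ∀ {B} (P P′ : ℚ) → .{{_ : Positive P}} → 1ℚ ≤ℚ B → P ≤ℚ B *ℚ P′ →
                  Σ[ nz ∈ NonZeroℚ (1ℚ ℚ.⊓ (ℚ._÷_ P′ P {{ℚ.pos⇒nonZero P}})) ]
                      (ℚ.1/ (1ℚ ℚ.⊓ (ℚ._÷_ P′ P {{ℚ.pos⇒nonZero P}}))) {{nz}} ≤ℚ B
inverse-minimum {B} P P′ 1≤B P≤BP′ = ℚ.pos⇒nonZero r {{r>0}} , inverse≤
  where
  instance
    P≢0 : NonZeroℚ P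
    P≢0 = ℚ.pos⇒nonZero P
  r : ℚ
  r = 1ℚ ℚ.⊓ (P′ ℚ.÷ P)
  0≤1/P : 0ℚ ≤ℚ (ℚ.1/ P)
  0≤1/P = ℚ.<⇒≤ (ℚ.positive⁻¹ (ℚ.1/ P) {{ℚ.1/pos⇒pos P}})
  1≤Br : 1ℚ ≤ℚ B *ℚ r
  1≤Br = split (ℚ.⊓-sel 1ℚ (P′ ℚ.÷ P))
    where
    open ℚ.≤-Reasoning
    split : r ≡ 1ℚ ⊎ r ≡ P′ ℚ.÷ P → 1ℚ ≤ℚ B *ℚ r
    split (inj₁ eq) = subst (λ x → 1ℚ ≤ℚ B *ℚ x) (sym eq) (subst (1ℚ ≤ℚ_) (sym (ℚ.*-identityʳ B)) 1≤B)
    split (inj₂ eq) = subst (λ x → 1ℚ ≤ℚ B *ℚ x) (sym eq) (begin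
      1ℚ                      ≡⟨ ℚ.*-inverseʳ P ⟨
      P *ℚ (ℚ.1/ P)           ≤⟨ *ℚ-monoʳ 0≤1/P P≤BP′ ⟩
      B *ℚ P′ *ℚ (ℚ.1/ P)     ≡⟨ ℚ.*-assoc B P′ (ℚ.1/ P) ⟩
      B *ℚ (P′ ℚ.÷ P)         ∎)
  r>0 : Positive r
  r>0 = ℚ.positive (ℚ.≰⇒> λ r≤0 → ℚ.<-irrefl refl (ℚ.<-≤-trans (ℚ.positive⁻¹ 1ℚ)
    (ℚ.≤-trans 1≤Br (ℚ.≤-trans (*ℚ-monoˡ (ℚ.≤-trans 0≤1 1≤B) r≤0) (ℚ.≤-reflexive (ℚ.*-zeroʳ B))))))
  inverse≤ : (ℚ.1/ r) {{ℚ.pos⇒nonZero r {{r>0}}}} ≤ℚ B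
  inverse≤ = begin
    1/r                ≡⟨ ℚ.*-identityʳ 1/r ⟨
    1/r *ℚ 1ℚ          ≤⟨ *ℚ-monoˡ (ℚ.<⇒≤ (ℚ.positive⁻¹ 1/r {{ℚ.1/pos⇒pos r {{r>0}}}})) 1≤Br ⟩
    1/r *ℚ (B *ℚ r)    ≡⟨ cong (1/r *ℚ_) (ℚ.*-comm B r) ⟩
    1/r *ℚ (r *ℚ B)    ≡⟨ ℚ.*-assoc 1/r r B ⟨
    1/r *ℚ r *ℚ B      ≡⟨ cong (_*ℚ B) (ℚ.*-inverseˡ r {{ℚ.pos⇒nonZero r {{r>0}}}}) ⟩
    1ℚ *ℚ B            ≡⟨ ℚ.*-identityˡ B ⟩
    B                  ∎
    where
    open ℚ.≤-Reasoning
    1/r : ℚ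
    1/r = (ℚ.1/ r) {{ℚ.pos⇒nonZero r {{r>0}}}}

module Ratio (G : BipartiteGraph) (k : ℕ) (regular : BipartiteGraph.Regular G k) where

  open Colourings G k regular public

  way? : ∀ (w x : Way) → Dec (x ≡ w)
  way? w x = x ≟ʷ w

  proposal? : ∀ C w (x : Assignment × Way) → Dec (x ≡ (C , w))
  proposal? C w x = (_≟ᵃ_ ⊗ _≟ʷ_) x (C , w)

  inverse-apply : ∀ C w → apply (apply C w) (inverse w) ≡ C
  inverse-apply C idle = refl
  inverse-apply C (two (cs@(c , c′) , S₁ , F , S₂)) = split (does (isCycle? S₁))
    where
    X = apply C (two (cs , S₁ , F , S₂))
    split : ∀ b → apply X (if b then two (cs , S₁ , F , S₂) else two (cs , S₂ , F , S₁)) ≡ C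
    split false = begin
      flip c c′ S₁ (flip c c′ F (flip c c′ S₂ X))  ≡⟨ cong (λ Y → flip c c′ S₁ (flip c c′ F Y))
          (flip-involutive S₂ (flip c c′ F (flip c c′ S₁ C))) ⟩
      flip c c′ S₁ (flip c c′ F (flip c c′ F (flip c c′ S₁ C)))  ≡⟨ cong (flip c c′ S₁)
          (flip-involutive F (flip c c′ S₁ C)) ⟩
      flip c c′ S₁ (flip c c′ S₁ C)                              ≡⟨ flip-involutive S₁ C ⟩
      C                                                          ∎
      where open ≡-Reasoning
    -- A way that starts with a cycle is its own inverse. Its three flips commute, which reduces
    -- this case to the reversed order.
    split true = begin
      flip c c′ S₂ (flip c c′ F (flip c c′ S₁ X))  ≡⟨ cong (flip c c′ S₂) (flip-comm F S₁ X) ⟩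
      flip c c′ S₂ (flip c c′ S₁ (flip c c′ F X))  ≡⟨ flip-comm S₂ S₁ (flip c c′ F X) ⟩
      flip c c′ S₁ (flip c c′ S₂ (flip c c′ F X))  ≡⟨ cong (flip c c′ S₁) (flip-comm S₂ F X) ⟩
      flip c c′ S₁ (flip c c′ F (flip c c′ S₂ X))  ≡⟨ split false ⟩
      C                                            ∎
      where open ≡-Reasoning
  inverse-apply C (three (((c , c′) , c″) , S₁ , (c̃ , F) , S₂)) = begin
    flip c c′ S₁ (flip c̃ c″ F (flip c c′ S₂ (flip c c′ S₂ (flip c̃ c″ F (flip c c′ S₁ C)))))  ≡⟨ cong
        (λ Y → flip c c′ S₁ (flip c̃ c″ F Y)) (flip-involutive S₂ (flip c̃ c″ F (flip c c′ S₁ C))) ⟩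
    flip c c′ S₁ (flip c̃ c″ F (flip c̃ c″ F (flip c c′ S₁ C)))  ≡⟨ cong (flip c c′ S₁)
        (flip-involutive F (flip c c′ S₁ C)) ⟩
    flip c c′ S₁ (flip c c′ S₁ C)                              ≡⟨ flip-involutive S₁ C ⟩
    C                                                          ∎
    where open ≡-Reasoning

  pair-≢ : ∀ {c c′} → (c , c′) ∈ˡ pairs → c ≢ c′
  pair-≢ cs∈ = Fin.<⇒≢ (proj₂ (∈ˡ.∈-filter⁻ (λ (a , b) → a Fin.<? b) {xs = cartesianProduct (allFin k) (allFin k)} cs∈))

  triple-≢ : ∀ {t c c′ c″} → t ∈ˡ triples → ((c , c′) , c″) ∈ˡ distinguish t → c ≢ c′ × c″ ≢ c × c″ ≢ c′
  triple-≢ {a , b , d} t∈ cs∈ with proj₂ (∈ˡ.∈-filter⁻ (λ (a , b , d) → (a Fin.<? b) ×-dec (b Fin.<? d))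
      {xs = cartesianProduct (allFin k) (cartesianProduct (allFin k) (allFin k))} t∈)
  ... | a<b , b<d = split cs∈
    where
    a≢b = Fin.<⇒≢ a<b
    b≢d = Fin.<⇒≢ b<d
    a≢d = Fin.<⇒≢ (Fin.<-trans a<b b<d)
    split : ∀ {c c′ c″} → ((c , c′) , c″) ∈ˡ distinguish (a , b , d) → c ≢ c′ × c″ ≢ c × c″ ≢ c′
    split (here refl)                 = a≢b , (λ e → a≢d (sym e)) , (λ e → b≢d (sym e))
    split (there (here refl))         = a≢d , (λ e → a≢b (sym e)) , b≢d
    split (there (there (here refl))) = b≢d , a≢b , a≢d

  nonneg-twoColours : ∀ C {cs} → cs ∈ˡ pairs → Nonneg (twoColours C cs)
  nonneg-twoColours C {c , c′} cs∈ = nonneg (sub-mixture ⊥ {connectedSubgraphs C c c′} {from₂ C} (sub-from₂ C))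
    where open TwoColours G k regular c c′ (pair-≢ cs∈) using (from₂; sub-from₂)

  nonneg-threeColours : ∀ C {c c′ c″} → c ≢ c′ × c″ ≢ c × c″ ≢ c′ → Nonneg (threeColours C ((c , c′) , c″))
  nonneg-threeColours C {c} {c′} {c″} (p , q , r) = nonneg (sub-mixture ⊥ {evenPaths C c c′} {from₃ C} (sub-from₃ C))
    where open Acceptance₃ G k regular c c′ c″ p q r using (from₃; sub-from₃)

  nonneg-draw : ∀ C → Nonneg (draw C)
  nonneg-draw C = All.++⁺ (nonneg-scale {d = return idle} 0≤½ (nonneg-return idle)) (All.++⁺
    (nonneg-scale {d = uniformOr (return idle) pairs (twoColours C)} 0≤¼ (nonneg-uniformOr pairs {twoColours C}
        (nonneg-return idle) (λ cs cs∈ → nonneg-twoColours C cs∈)))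
    (nonneg-scale {d = uniformOr (return idle) triples (λ t → uniform (distinguish t) >>= threeColours C)} 0≤¼
      (nonneg-uniformOr triples {λ t → uniform (distinguish t) >>= threeColours C} (nonneg-return idle) λ t t∈ →
        nonneg->>=-supp {d = uniform (distinguish t)} {f = threeColours C} (nonneg-uniform (distinguish t)) λ cs cs∈ →
          nonneg-threeColours C (triple-≢ t∈ (supp-uniform {xs = distinguish t} cs∈)))))

  module _ (2≤V : 2 ℕ.≤ #V) {B : ℕ} (8V²≤B : 8 * (#V * #V) ℕ.≤ B) where

    1≤B : 1 ℕ.≤ B
    1≤B = ℕ.≤-trans (ℕ.*-mono-≤ {1} {8} (ℕ.s≤s ℕ.z≤n) (ℕ.*-mono-≤ {1} {#V} {1} {#V} 1≤V 1≤V)) 8V²≤B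
      where
      1≤V : 1 ℕ.≤ #V
      1≤V = ℕ.≤-trans (ℕ.s≤s ℕ.z≤n) 2≤V

    idle-compare : ∀ w → E (return idle) (χ (way? w)) ≤ℚ ⟦ B ⟧ *ℚ E (return idle) (χ (way? (inverse w)))
    idle-compare w = subst (λ x → x ≤ℚ ⟦ B ⟧ *ℚ E (return idle) (χ (way? (inverse w))))
        (sym (E-return idle (χ (way? w)))) (split (idle ≟ʷ w))
      where
      split : Dec (idle ≡ w) → χ (way? w) idle ≤ℚ ⟦ B ⟧ *ℚ E (return idle) (χ (way? (inverse w)))
      split (yes refl) = subst (1ℚ ≤ℚ_) (sym (ℚ.*-identityʳ ⟦ B ⟧)) (⟦⟧-mono 1≤B)
      split (no ne)    = subst (_≤ℚ ⟦ B ⟧ *ℚ E (return idle) (χ (way? (inverse w)))) (sym (χ-0 (way? w) ne))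
        (0≤*ℚ (0≤⟦⟧ B) (E-nonneg (nonneg-return idle) (0≤χ (way? (inverse w)))))

    draw-compare : ∀ C₁ C₂ w → Proper C₁ → Proper C₂ → apply C₁ w ≡ C₂ →
                   E (draw C₁) (χ (way? w)) ≤ℚ ⟦ B ⟧ *ℚ E (draw C₂) (χ (way? (inverse w)))
    draw-compare C₁ C₂ w proper₁ proper₂ ends =
      ++-compare {d₁ = scale ½ (return idle)} {scale (+ 1 / 4) two₁ ++ scale (+ 1 / 4) three₁}
          {scale ½ (return idle)} {scale (+ 1 / 4) two₂ ++ scale (+ 1 / 4) three₂} {φ} {ψ} {⟦ B ⟧}
        (scale-compare {d = return idle} {return idle} {φ} {ψ} {⟦ B ⟧} ½ 0≤½ (idle-compare w))
        (++-compare {d₁ = scale (+ 1 / 4) two₁} {scale (+ 1 / 4) three₁} {scale (+ 1 / 4) two₂}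
            {scale (+ 1 / 4) three₂} {φ} {ψ} {⟦ B ⟧}
          (scale-compare {d = two₁} {two₂} {φ} {ψ} {⟦ B ⟧} (+ 1 / 4) 0≤¼ (uniformOr-compare {d = return idle}
              pairs {twoColours C₁} {twoColours C₂} {φ} {ψ} {⟦ B ⟧} (idle-compare w)
            (λ cs cs∈ → Acceptance₂.accept₂ G k regular (proj₁ cs) (proj₂ cs) (pair-≢ cs∈) 2≤V 8V²≤B C₁ C₂ w
                proper₁ proper₂ ends)))
          (scale-compare {d = three₁} {three₂} {φ} {ψ} {⟦ B ⟧} (+ 1 / 4) 0≤¼
              (uniformOr-compare {d = return idle} triples {λ t → uniform (distinguish t) >>= threeColours C₁}
              {λ t → uniform (distinguish t) >>= threeColours C₂} {φ} {ψ} {⟦ B ⟧} (idle-compare w)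
            (λ t t∈ → >>=-compare {d = uniform (distinguish t)} {threeColours C₁} {threeColours C₂} {φ} {ψ}
                {⟦ B ⟧} (nonneg-uniform (distinguish t)) λ cs cs∈ → accept t∈ cs
                (supp-uniform {xs = distinguish t} cs∈)))))
      where
      φ = χ (way? w)
      ψ = χ (way? (inverse w))
      two₁ = uniformOr (return idle) pairs (twoColours C₁)
      two₂ = uniformOr (return idle) pairs (twoColours C₂)
      three₁ = uniformOr (return idle) triples (λ t → uniform (distinguish t) >>= threeColours C₁)
      three₂ = uniformOr (return idle) triples (λ t → uniform (distinguish t) >>= threeColours C₂)
      accept : ∀ {t} → t ∈ˡ triples → ∀ cs → cs ∈ˡ distinguish t →
               E (threeColours C₁ cs) (χ (way? w)) ≤ℚ ⟦ B ⟧ *ℚ E (threeColours C₂ cs) (χ (way? (inverse w)))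
      accept t∈ ((c , c′) , c″) cs∈ =
        let c≢c′ , c″≢c , c″≢c′ = triple-≢ t∈ cs∈
        in Acceptance₃.accept₃ G k regular c c′ c″ c≢c′ c″≢c c″≢c′ 2≤V 8V²≤B C₁ C₂ w proper₁ proper₂ ends

    -- The probabilities of proposals are those of ways, since a way determines its end.
    P≡ : ∀ C₁ C₂ w → P⟨ C₂ , w ∣ C₁ ⟩ ≡ E (draw (assignment C₁)) (λ x → χ (proposal? (assignment C₂) w)
        (apply (assignment C₁) x , x))
    P≡ C₁ C₂ w = trans (Pr≡E (proposal? (assignment C₂) w) (propose (assignment C₁)))
      (E-return> (draw (assignment C₁)) (λ x → apply (assignment C₁) x , x) (χ (proposal? (assignment C₂) w)))

    P-≤ : ∀ C₁ C₂ w → P⟨ C₂ , w ∣ C₁ ⟩ ≤ℚ E (draw (assignment C₁)) (χ (way? w))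
    P-≤ C₁ C₂ w = subst (_≤ℚ E (draw (assignment C₁)) (χ (way? w))) (sym (P≡ C₁ C₂ w))
        (E-mono {φ = λ x → χ (proposal? (assignment C₂) w) (apply (assignment C₁) x , x)} {χ (way? w)}
        (nonneg-draw (assignment C₁)) (λ x _ → lemma x (x ≟ʷ w)))
      where
      lemma : ∀ x → Dec (x ≡ w) → χ (proposal? (assignment C₂) w) (apply (assignment C₁) x , x) ≤ℚ χ (way? w) x
      lemma x (yes refl) = subst (χ (proposal? (assignment C₂) w) (apply (assignment C₁) x , x) ≤ℚ_)
          (sym (χ-1 (way? w))) (χ≤1 (proposal? (assignment C₂) w) (apply (assignment C₁) x , x))
      lemma x (no x≢w)   = subst (_≤ℚ χ (way? w) x)
          (sym (χ-0 (proposal? (assignment C₂) w) {apply (assignment C₁) x , x} (λ eq → x≢w (cong proj₂ eq))))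
          (0≤χ (way? w) x)

    P-≥ : ∀ C₁ C₂ w → apply (assignment C₁) w ≡ assignment C₂ → E (draw (assignment C₁)) (χ (way? w)) ≤ℚ
        P⟨ C₂ , w ∣ C₁ ⟩
    P-≥ C₁ C₂ w ends = subst (E (draw (assignment C₁)) (χ (way? w)) ≤ℚ_) (sym (P≡ C₁ C₂ w))
        (E-mono {φ = χ (way? w)} {λ x → χ (proposal? (assignment C₂) w) (apply (assignment C₁) x , x)}
        (nonneg-draw (assignment C₁)) (λ x _ → lemma x (x ≟ʷ w)))
      where
      lemma : ∀ x → Dec (x ≡ w) → χ (way? w) x ≤ℚ χ (proposal? (assignment C₂) w) (apply (assignment C₁) x , x)
      lemma x (yes refl) = ℚ.≤-reflexive (trans (χ-1 (way? w))
          (sym (trans (cong (λ C → χ (proposal? (assignment C₂) w) (C , w)) ends) (χ-1 (proposal? (assignment C₂) w)))))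
      lemma x (no x≢w)   = subst (_≤ℚ χ (proposal? (assignment C₂) w) (apply (assignment C₁) x , x))
          (sym (χ-0 (way? w) x≢w)) (0≤χ (proposal? (assignment C₂) w) (apply (assignment C₁) x , x))

    P-ends : ∀ C₁ C₂ w → Positive P⟨ C₂ , w ∣ C₁ ⟩ → apply (assignment C₁) w ≡ assignment C₂
    P-ends C₁ C₂ w pos = split (apply (assignment C₁) w ≟ᵃ assignment C₂)
      where
      split : Dec (apply (assignment C₁) w ≡ assignment C₂) → apply (assignment C₁) w ≡ assignment C₂
      split (yes eq) = eq
      split (no ne)  = contradiction (trans (P≡ C₁ C₂ w) (E-vanish (draw (assignment C₁))
          {λ x → χ (proposal? (assignment C₂) w) (apply (assignment C₁) x , x)} λ x _ →
        χ-0 (proposal? (assignment C₂) w) {apply (assignment C₁) x , x} λ eq →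
            ne (trans (cong (apply (assignment C₁)) (sym (cong proj₂ eq))) (cong proj₁ eq))))
        (λ eq → ℚ.<⇒≢ (ℚ.positive⁻¹ P⟨ C₂ , w ∣ C₁ ⟩ {{pos}}) (sym eq))

    inverse-acceptance : InverseAcceptance≤ ⟦ B ⟧
    inverse-acceptance C₁ C₂ w {{pos}} = inverse-minimum P⟨ C₂ , w ∣ C₁ ⟩ P⟨ C₁ , inverse w ∣ C₂ ⟩ {{pos}} (⟦⟧-mono 1≤B)
      (ℚ.≤-trans (P-≤ C₁ C₂ w) (ℚ.≤-trans (draw-compare (assignment C₁) (assignment C₂) w (proper C₁) (proper C₂) ends)
        (*ℚ-monoˡ (0≤⟦⟧ B) (P-≥ C₂ C₁ (inverse w) (trans (cong (λ C → apply C (inverse w)) (sym ends))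
            (inverse-apply (assignment C₁) w))))))
      where
      ends = P-ends C₁ C₂ w pos

-- Lower bounds for entire transitions

low-uniformOr : {A B : Set} {d : Dist B} {xs : List A} {f : A → Dist B} {a : A} {b : B} {m : ℕ} →
    (∀ a → a ∈ˡ xs → Nonneg (f a)) →
                a ∈ˡ xs → Low (f a) b m → Low (uniformOr d xs f) b (length xs * m)
low-uniformOr {xs = x ∷ xs} {f} {a} {b} {m} nnf a∈ l = low λ φ 0≤φ →
  -- `low-uniform` needs a test function that is nonnegative everywhere, but `E (f y) φ` is known to
  -- be so only for listed `y`. Cutting off at 0 changes nothing on the list.
  let ψ = λ y → 0ℚ ℚ.⊔ E (f y) φ
      eq : ∀ y → y ∈ˡ x ∷ xs → ψ y ≡ E (f y) φ
      eq = λ y y∈ → ℚ.p≤q⇒p⊔q≡q (E-nonneg (nnf y y∈) 0≤φ)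
  in begin
    φ b                                                         ≤⟨ bound l φ 0≤φ ⟩
    ⟦ m ⟧ *ℚ E (f a) φ                                          ≡⟨ cong (⟦ m ⟧ *ℚ_) (eq a a∈) ⟨
    ⟦ m ⟧ *ℚ ψ a                                                ≤⟨ *ℚ-monoˡ (0≤⟦⟧ m) (bound (low-uniform a∈) ψ
        (λ y → ℚ.p≤p⊔q 0ℚ (E (f y) φ))) ⟩
    ⟦ m ⟧ *ℚ (⟦ n ⟧ *ℚ E (uniform (x ∷ xs)) ψ)                  ≤⟨ *ℚ-monoˡ (0≤⟦⟧ m)
        (*ℚ-monoˡ (0≤⟦⟧ n) (E-mono {φ = ψ} {λ y → E (f y) φ} (nonneg-uniform (x ∷ xs))
                                                                     (λ y y∈ → ℚ.≤-reflexive (eq y (supp-uniform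
                                                                         {xs = x ∷ xs} y∈))))) ⟩
    ⟦ m ⟧ *ℚ (⟦ n ⟧ *ℚ E (uniform (x ∷ xs)) (λ y → E (f y) φ))  ≡⟨ ℚ.*-assoc ⟦ m ⟧ ⟦ n ⟧ _ ⟨
    ⟦ m ⟧ *ℚ ⟦ n ⟧ *ℚ E (uniform (x ∷ xs)) (λ y → E (f y) φ)    ≡⟨ cong₂ _*ℚ_ (trans (ℚ.*-comm ⟦ m ⟧ ⟦ n ⟧)
        (sym (⟦⟧-* n m))) (sym (E->>= (uniform (x ∷ xs)) f φ)) ⟩
    ⟦ n * m ⟧ *ℚ E (uniform (x ∷ xs) >>= f) φ                   ∎
  where
  open ℚ.≤-Reasoning
  n = length (x ∷ xs)

module Steps (G : BipartiteGraph) (k : ℕ) (regular : BipartiteGraph.Regular G k) where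

  open Ratio G k regular public

  target? : ∀ (C : Assignment) (x : Assignment × Way) → Dec (proj₁ x ≡ C)
  target? C x = proj₁ x ≟ᵃ C

  -- The size of `m` is irrelevant: were the probability at most 0, the bound would give 1 ≤ `m` ·
  -- 0.
  low⇒transition : ∀ C₁ C₂ {w m} → Low (draw (assignment C₁)) w m → apply (assignment C₁) w ≡ assignment C₂ →
      Transition C₁ C₂
  low⇒transition C₁ C₂ {w} {m} l ends = ℚ.positive (ℚ.≰⇒> λ Pr≤0 → ℚ.<-irrefl refl (ℚ.<-≤-trans (ℚ.positive⁻¹ 1ℚ) (begin
    1ℚ                               ≡⟨ at-w ⟨
    φ w                              ≤⟨ bound l φ 0≤φ ⟩
    ⟦ m ⟧ *ℚ E (draw A₁) φ           ≡⟨ cong (⟦ m ⟧ *ℚ_) Pr≡ ⟨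
    ⟦ m ⟧ *ℚ Pr (target? A₂) (propose A₁)  ≤⟨ *ℚ-monoˡ (0≤⟦⟧ m) Pr≤0 ⟩
    ⟦ m ⟧ *ℚ 0ℚ                      ≡⟨ ℚ.*-zeroʳ ⟦ m ⟧ ⟩
    0ℚ                               ∎)))
    where
    open ℚ.≤-Reasoning
    A₁ = assignment C₁
    A₂ = assignment C₂
    ψ : Assignment × Way → ℚ
    ψ x = if does (target? A₂ x) then 1ℚ else 0ℚ
    φ : Way → ℚ
    φ x = ψ (apply A₁ x , x)
    0≤ψ : ∀ b → 0ℚ ≤ℚ (if b then 1ℚ else 0ℚ)
    0≤ψ true  = 0≤1
    0≤ψ false = ℚ.≤-refl
    0≤φ : ∀ x → 0ℚ ≤ℚ φ x
    0≤φ x = 0≤ψ (does (target? A₂ (apply A₁ x , x)))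
    at-w : φ w ≡ 1ℚ
    at-w = cong (λ b → if b then 1ℚ else 0ℚ) (dec-true (target? A₂ (apply A₁ w , w)) ends)
    Pr≡ : Pr (target? A₂) (propose A₁) ≡ E (draw A₁) φ
    Pr≡ = trans (Pr≡E (target? A₂) (propose A₁)) (E-return> (draw A₁) (λ x → apply A₁ x , x) ψ)

  low-two : ∀ C {c c′ w m} → (c , c′) ∈ˡ pairs → Low (twoColours C (c , c′)) w m → ∃[ n ] Low (draw C) w n
  low-two C {c} {c′} {w} {m} cs∈ l = length pairs * m * 4 ,
    low-++ʳ {d = scale ½ (return idle)} {m = length pairs * m * 4} (nonneg-scale {d = return idle} 0≤½
        (nonneg-return idle))
      (low-++ˡ {d = scale (+ 1 / 4) (uniformOr (return idle) pairs (twoColours C))} {m = length pairs * m * 4}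
          nonneg-three
        (low-scale {q = + 1 / 4} {uniformOr (return idle) pairs (twoColours C)} {w} {length pairs * m} 4 refl
          (low-uniformOr {d = return idle} {pairs} {twoColours C} {m = m} (λ cs cs∈ → nonneg-twoColours C cs∈) cs∈ l)))
    where
    nonneg-three = nonneg-scale {q = + 1 / 4} {d = uniformOr (return idle) triples
        (λ t → uniform (distinguish t) >>= threeColours C)} 0≤¼
      (nonneg-uniformOr triples {λ t → uniform (distinguish t) >>= threeColours C} (nonneg-return idle) λ t t∈ →
        nonneg->>=-supp {d = uniform (distinguish t)} {f = threeColours C} (nonneg-uniform (distinguish t)) λ cs cs∈ →
          nonneg-threeColours C (triple-≢ t∈ (supp-uniform {xs = distinguish t} cs∈)))

  low-three : ∀ C {t cs w m} → t ∈ˡ triples → cs ∈ˡ distinguish t → Low (threeColours C cs) w m →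
      ∃[ n ] Low (draw C) w n
  low-three C {t} {cs} {w} {m} t∈ cs∈ l = length triples * (length (distinguish t) * m) * 4 ,
    low-++ʳ {d = scale ½ (return idle)} {m = length triples * (length (distinguish t) * m) * 4}
        (nonneg-scale {d = return idle} 0≤½ (nonneg-return idle))
      (low-++ʳ {d = scale (+ 1 / 4) (uniformOr (return idle) pairs (twoColours C))} {m = length triples *
          (length (distinguish t) * m) * 4}
        (nonneg-scale {q = + 1 / 4} {d = uniformOr (return idle) pairs (twoColours C)} 0≤¼
            (nonneg-uniformOr pairs {twoColours C} (nonneg-return idle) (λ cs cs∈ → nonneg-twoColours C cs∈)))
        (low-scale {q = + 1 / 4} {uniformOr (return idle) triples pick} {w}
            {length triples * (length (distinguish t) * m)} 4 refl
          (low-uniformOr {d = return idle} {triples} {pick} {m = length (distinguish t) * m} nonneg-pick t∈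
              (low-distinguish (distinguish t) t∈ cs∈))))
    where
    pick = λ t → uniform (distinguish t) >>= threeColours C
    nonneg-pick : ∀ t → t ∈ˡ triples → Nonneg (pick t)
    nonneg-pick t t∈ = nonneg->>=-supp {d = uniform (distinguish t)} {f = threeColours C}
        (nonneg-uniform (distinguish t)) λ cs cs∈ →
      nonneg-threeColours C (triple-≢ t∈ (supp-uniform {xs = distinguish t} cs∈))
    low-distinguish : ∀ xs → t ∈ˡ triples → cs ∈ˡ distinguish t → Low (pick t) w (length (distinguish t) * m)
    low-distinguish _ t∈ cs∈ = low-uniformOr {d = return idle} {distinguish t} {threeColours C} {m = m}
        (λ cs cs∈ → nonneg-threeColours C (triple-≢ t∈ cs∈)) cs∈ l

  ∈-pairs : ∀ {a b} → a Fin.< b → (a , b) ∈ˡ pairs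
  ∈-pairs {a} {b} a<b = ∈ˡ.∈-filter⁺ (λ (a , b) → a Fin.<? b) (∈ˡ.∈-cartesianProduct⁺ (∈ˡ.∈-allFin a)
      (∈ˡ.∈-allFin b)) a<b

  ∈-triples : ∀ {a b d} → a Fin.< b → b Fin.< d → (a , b , d) ∈ˡ triples
  ∈-triples {a} {b} {d} a<b b<d = ∈ˡ.∈-filter⁺ (λ (a , b , d) → (a Fin.<? b) ×-dec (b Fin.<? d))
    (∈ˡ.∈-cartesianProduct⁺ (∈ˡ.∈-allFin a) (∈ˡ.∈-cartesianProduct⁺ (∈ˡ.∈-allFin b) (∈ˡ.∈-allFin d))) (a<b , b<d)

  ∈-distinguish : ∀ {c c′ c″} → c Fin.< c′ → c″ ≢ c → c″ ≢ c′ → ∃[ t ] (t ∈ˡ triples × ((c , c′) , c″) ∈ˡ distinguish t)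
  ∈-distinguish {c} {c′} {c″} c<c′ c″≢c c″≢c′ with Fin.<-cmp c″ c | Fin.<-cmp c″ c′
  ... | tri< lt _ _ | _           = (c″ , c , c′) , ∈-triples lt c<c′ , there (there (here refl))
  ... | tri≈ _ eq _ | _           = contradiction eq c″≢c
  ... | tri> _ _ gt | tri< lt _ _ = (c , c″ , c′) , ∈-triples gt lt , there (here refl)
  ... | tri> _ _ gt | tri≈ _ eq _ = contradiction eq c″≢c′
  ... | tri> _ _ gt | tri> _ _ gt′ = (c , c′ , c″) , ∈-triples c<c′ gt′ , here refl

-- Walking through almost colourings: an almost colouring A is represented by a
-- colouring from which it arises by flipping S.

module Moves (G : BipartiteGraph) (k : ℕ) (regular : BipartiteGraph.Regular G k)
             (c c′ : Fin k) (c<c′ : c Fin.< c′) where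

  private
    c≢c′ : c ≢ c′
    c≢c′ = Fin.<⇒≢ c<c′

  open TwoColours G k regular c c′ c≢c′ public
  open Steps G k regular using (low⇒transition; low-two; low-three; ∈-pairs; ∈-distinguish)

  record Lift (C : EdgeColouring) (A : Assignment) : Set where
    constructor lift
    field
      S       : Subgraph
      flipped : flip c c′ S (assignment C) ≡ A
      -- Exactly what is needed for `S` to be available as the first flip of a transition.
      kind    : S ≡ ⊥ ⊎ (IsPath S × CS (assignment C) S)
  open Lift public

  lift-near : ∀ {C A} → Lift C A → Near A
  lift-near {C} (lift S refl _) = flip-near (proper⇒near (assignment C) (proper C))

  lift-self : ∀ C → Lift C (assignment C)
  lift-self C = lift ⊥ (flip-⊥ (assignment C)) (inj₁ refl)

  lift-elim : ∀ {C A} (l : Lift C A) → S l ≡ ⊥ ⊎ Elim A (S l)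
  lift-elim (lift S refl (inj₁ eq)) = inj₁ eq
  lift-elim {C} (lift S refl (inj₂ (isPath , cs))) =
    inj₂ (path-elim (proper⇒near (assignment C) (proper C)) (proper⇒nodef (assignment C) (proper C)) isPath cs)

  lift-nodef : ∀ {C A} → Lift C A → NoDef A → assignment C ≡ A
  lift-nodef {C} {A} l nodef = split (lift-elim l)
    where
    split : S l ≡ ⊥ ⊎ Elim A (S l) → assignment C ≡ A
    split (inj₁ eq) = trans (sym (flip-⊥ (assignment C))) (trans (cong (λ T → flip c c′ T (assignment C))
        (sym eq)) (flipped l))
    split (inj₂ el) = let v , eq = proj₂ (proj₂ (path el)) in contradiction (end⇒def el v eq) (nodef v)

  low-mixture : ∀ {f : Subgraph → Dist Way} {L T w m} → (∀ T → Sub (f T)) → T ≡ ⊥ ⊎ T ∈ˡ L → Low (f T) w m →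
      ∃[ n ] Low (Mixture ⊥ L f) w n
  low-mixture {f} {L} {T} {w} {m} sf (inj₁ refl) l = _ , low->>= {d = fair (return ⊥) (uniform L)} {f = f}
      {m = 1 * 2} {n = m} (λ T → nonneg (sf T))
    (low-fairˡ {d = return ⊥} {uniform L} {m = 1} (nonneg-uniform L) (low-return ⊥)) l
  low-mixture {f} {L} {T} {w} {m} sf (inj₂ T∈) l = _ , low->>= {d = fair (return ⊥) (uniform L)} {f = f}
      {m = length L * 2} {n = m} (λ T → nonneg (sf T))
    (low-fairʳ {d = return ⊥} {uniform L} {m = length L} (nonneg-return ⊥) (low-uniform T∈)) l

  Eliminated : Assignment → Set
  Eliminated A = ∃[ T ] ∃[ n ] (Low (eliminate c c′ A) T n × NoDef (flip c c′ T A) × (T ≡ ⊥ ⊎ (IsPath T × CS A T)))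

  Status : Assignment → Set
  Status A = NoDef A ⊎ ∃[ v ] ∃[ w ] TwoDef A v w

  eliminated : ∀ {A} → Near A → Status A → Eliminated A
  eliminated {A} near (inj₁ nodef) = ⊥ , 1 , low-eliminate-nodef {A} nodef , subst NoDef (sym (flip-⊥ A)) nodef
      , inj₁ refl
  eliminated {A} near (inj₂ (v , w , td)) =
    let T , el = elim-exists near td in T , 2 , low-eliminate near el , elim-nodef near el ,
            inj₂ (path el , coloured el)

  -- The path just eliminated, flipped back in the new colouring, recovers `A`. So the next
  -- transition can resume there.
  landing : ∀ {A T} → Near A → NoDef (flip c c′ T A) → (T ≡ ⊥ ⊎ (IsPath T × CS A T)) → Σ[ C ∈ EdgeColouring ]
      (assignment C ≡ flip c c′ T A × Lift C A)
  landing {A} {T} near nodef kd = colouring (flip c c′ T A) (nodef⇒proper (flip-near near) nodef) , refl ,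
      lift T (flip-involutive T A) (coloured′ kd)
    where
    coloured′ : T ≡ ⊥ ⊎ (IsPath T × CS A T) → T ≡ ⊥ ⊎ (IsPath T × CS (flip c c′ T A) T)
    coloured′ (inj₁ eq)       = inj₁ eq
    coloured′ (inj₂ (p , cs)) = inj₂ (p , flip-coloured {T} {A = A} cs)

  -- A transition that first flips back to `A`, then recolours `e`, then eliminates. For the
  -- represented almost colouring this is just the recolouring of one edge.
  move₂ : ∀ {C A e m} → Lift C A → Low (perturb₂ c c′ A) ⁅ e ⁆ m → Status (flip c c′ ⁅ e ⁆ A) →
      ∃[ C′ ] (Transition C C′ × Lift C′ (flip c c′ ⁅ e ⁆ A))
  move₂ {C} {A} {e} {m} l lp status =
    let near = lift-near l
        T , n , le , nodef , kd = eliminated (flip-near near) status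
        C′ , C′≡ , l′ = landing (flip-near near) nodef kd
        _ , lw = low-mixture {from₂ (assignment C)} {connectedSubgraphs (assignment C) c c′} {S l}
            {way₂ (S l) ⁅ e ⁆ T} {m * (n * 1)} (sub-from₂ (assignment C)) (drawn (kind l))
          (low-from₂ (assignment C) {A} {m = m} {n = n} (flipped l) lp le)
        _ , ld = low-two (assignment C) (∈-pairs c<c′) lw
    in C′ , low⇒transition C C′ ld (trans (cong (λ X → flip c c′ T (flip c c′ ⁅ e ⁆ X)) (flipped l)) (sym C′≡)) , l′
    where
    drawn : S l ≡ ⊥ ⊎ (IsPath (S l) × CS (assignment C) (S l)) → S l ≡ ⊥ ⊎ S l ∈ˡ connectedSubgraphs (assignment C) c c′
    drawn (inj₁ eq)       = inj₁ eq
    drawn (inj₂ (p , cs)) = inj₂ (∈-subsets-filter (onH-connected? (assignment C)) (proj₁ p , cs))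

  module _ {c″ : Colour} (c″≢c : c″ ≢ c) (c″≢c′ : c″ ≢ c′) where

    open Acceptance₃ G k regular c c′ c″ c≢c′ c″≢c c″≢c′ using (from₃; sub-from₃; low-from₃; way₃; low₃-cycle)

    -- The deficient vertices lie on one side, so the path representing `A` has even length and is
    -- offered by a move with three colours. The swap preserves the counts and with them both
    -- deficiencies.
    move₃ : ∀ {C A v w u c̃ F} → Lift C A → TwoDef A v w → Opposite A v w → Deficient A u → Repeated A u c̃ →
            AlternatingCycle A c̃ c″ F → ∃[ e ] (Incident u e × e ∈ F) → ∃[ C′ ] (Transition C C′ ×
                Lift C′ (flip c̃ c″ F A))
    move₃ {C} {A} {v} {w} {u} {c̃} {F} l td opp def rep cyc touch =
      let T , n , le , nodef , kd = eliminated near′ (inj₂ (v , w , counts-twoDef {A} {A′} same′ td))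
          C′ , C′≡ , l′ = landing near′ nodef kd
          _ , lw = low-mixture {from₃ (assignment C)} {evenPaths (assignment C) c c′} {S l}
              {way₃ (S l) (c̃ , F) T} {2 * (n * 1)} (sub-from₃ (assignment C)) (drawn (kind l))
            (low-from₃ (assignment C) {A} {m = 2} {n = n} (flipped l) (low₃-cycle near td opp def rep cyc touch) le)
          _ , t∈ , cs∈ = ∈-distinguish c<c′ c″≢c c″≢c′
          _ , ld = low-three (assignment C) t∈ cs∈ lw
      in C′ , low⇒transition C C′ ld (trans (cong (λ X → flip c c′ T (flip c̃ c″ F X)) (flipped l)) (sym C′≡)) , l′
      where
      near = lift-near l
      A′ = flip c̃ c″ F A
      same′ : SameCounts A A′
      same′ u d = sym (cycle-count A cyc u d)
      near′ : Near A′
      near′ = counts-near {A} {A′} same′ near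
      even : Elim A (S l) → 2 ∣ ∣ S l ∣
      even el = same-side⇒even near td (proj₁ opp) el
      drawn : S l ≡ ⊥ ⊎ (IsPath (S l) × CS (assignment C) (S l)) → S l ≡ ⊥ ⊎ S l ∈ˡ evenPaths (assignment C) c c′
      drawn (inj₁ eq)       = inj₁ eq
      drawn (inj₂ (p , cs)) = [ inj₁ , (λ el → inj₂ (∈-subsets-filter (even? (assignment C)) ((p , even el) ,
          cs))) ]′ (lift-elim l)

-- Agreement with a target colouring

count-< : ∀ {n} {P Q : Pred (Fin n) 0ℓ} (P? : Decidable P) (Q? : Decidable Q) → (∀ x → P x → Q x) → ∀ {x} →
    Q x → ¬ P x → count P? ℕ.< count Q?
count-< {n} {P} {Q} P? Q? P⊆Q {x} Qx ¬Px = unique-length {xs = x ∷ filter P? (allFin n)} _≡_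
  (All.tabulate (λ y∈ x≡y → ¬Px (subst P (sym x≡y) (∈-filter⁻ P? y∈))) AllPairs.∷ filter-unique P?)
  (λ { (here refl) → x , ∈-filter Q? Qx , refl ; {y} (there y∈) → y , ∈-filter Q? (P⊆Q y (∈-filter⁻ P? y∈)) , refl })
  (λ { _ _ refl refl → refl })

module Targets (G : BipartiteGraph) (k : ℕ) (D : M.Assignment G k) where

  open BipartiteGraph G
  open M G k

  wrong? : ∀ t A e → Dec (lookup D e ≡ t × lookup A e ≢ t)
  wrong? t A e = (lookup D e Fin.≟ t) ×-dec ¬? (lookup A e Fin.≟ t)

  wrong : Colour → Assignment → ℕ
  wrong t A = count (wrong? t A)

  module Preservation (done : Colour → Set) where

    Preserved : Assignment → Set
    Preserved A = ∀ e → done (lookup D e) → lookup A e ≡ lookup D e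

-- Making the edges of colour t agree with the target D, using one further
-- colour at a time.  The colours in done agree already and are not touched.

module Descent (G : BipartiteGraph) (k : ℕ) (regular : BipartiteGraph.Regular G k)
               (c c′ : Fin k) (c<c′ : c Fin.< c′)
               (D : M.Assignment G k) (properD : M.Proper G k D) (done : Fin k → Set) where

  open Moves G k regular c c′ c<c′ public

  open Targets G k D public
  open Preservation done public

  recolour-self : ∀ A e → lookup (flip c c′ ⁅ e ⁆ A) e ≡ τ (lookup A e)
  recolour-self A e = flip-∈ A (Subset.x∈⁅x⁆ e)

  recolour-else : ∀ A e {f} → f ≢ e → lookup (flip c c′ ⁅ e ⁆ A) f ≡ lookup A f
  recolour-else A e f≢e = flip-∉ A (λ f∈ → f≢e (Subset.x∈⁅y⁆⇒x≡y e f∈))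

  repeated-colour : ∀ {A u a f} → Near A → Repeated A u a → Incident u f → OnH A f → lookup A f ≡ a
  repeated-colour {A} {u} {a} near r i o = sym (repeated⇒≡ {d = a} (proj₂ (focus near i o)) r)

  repeated-unique : ∀ {A u a b} → Near A → Repeated A u a → Repeated A u b → a ≡ b
  repeated-unique {A} {u} {a} {b} near r r′ =
    let g , h , t = near u in trans (repeated⇒≡ {d = a} t r) (sym (repeated⇒≡ {d = b} t r′))

  repeated-away : ∀ {A u a e} → Near A → ¬ Incident u e → Repeated A u a → Repeated (flip c c′ ⁅ e ⁆ A) u a
  repeated-away {A} {u} {a} {e} near away r =
    let g , h , t = near u
        eq : ∀ {f} → Incident u f → lookup (flip c c′ ⁅ e ⁆ A) f ≡ lookup A f
        eq = λ {f} i → recolour-else A e (λ f≡e → away (subst (Incident u) f≡e i))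
        g≡h = def⇒≡ t (a , r)
    in subst (Repeated (flip c c′ ⁅ e ⁆ A) u) (trans (eq (incˡ t)) (sym (repeated⇒≡ {d = a} t r)))
         (_ , ≡⇒deficiency (flip-two {⁅ e ⁆} t) (trans (eq (incˡ t)) (trans g≡h (sym (eq (incʳ t))))))

  repeated-new : ∀ {A u e} → Near A → OnH A e → Incident u e → ¬ Deficient A u → Repeated (flip c c′ ⁅ e ⁆ A) u
      (τ (lookup A e))
  repeated-new {A} {u} {e} near o i ok = subst (Repeated (flip c c′ ⁅ e ⁆ A) u) (recolour-self A e)
    (deficient-repeated (flip-near near) (recolour-def {A} near {e} o i ok) i (flip-on {⁅ e ⁆} {A} o))

  module _ (t : Colour) (t∈ : In t) (t-open : ¬ done t) (o-open : ¬ done (τ t)) where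

    o : Colour
    o = τ t

    o≢t : o ≢ t
    o≢t = τ-≢ t∈

    o∈ : In o
    o∈ = τ-in t∈

    Progress : EdgeColouring → ℕ → ℕ → Set
    Progress C m n = ∃[ C′ ] ∃[ d ] (Transitions d C C′ × Preserved (assignment C′) × d ℕ.+ 3 * wrong t
        (assignment C′) ℕ.≤ n × wrong t (assignment C′) ℕ.≤ m)

    -- The state after a correction: of the two edges of colour `t` at `z`, `f` is the right one,
    -- and the other is to be recoloured next. `y` is the deficient vertex that stays put.
    record Outer (C : EdgeColouring) (A : Assignment) : Set where
      field
        lifted    : Lift C A
        {z y}     : Vertex
        twoD      : TwoDef A z y
        repz      : Repeated A z t
        repy      : Repeated A y t
        sides     : side y ≢ side z
        f         : Edge
        incident  : Incident z f
        target    : lookup D f ≡ t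
        current   : lookup A f ≡ t
        preserved : Preserved A

    record Inner (C : EdgeColouring) (A : Assignment) : Set where
      field
        lifted    : Lift C A
        {x y}     : Vertex
        twoD      : TwoDef A x y
        repx      : Repeated A x o
        repy      : Repeated A y t
        sides     : side y ≡ side x
        f         : Edge
        incident  : Incident x f
        target    : lookup D f ≡ t
        current   : lookup A f ≢ t
        preserved : Preserved A

    preserve-recolour : ∀ {A e} → Preserved A → ¬ done (lookup D e) → Preserved (flip c c′ ⁅ e ⁆ A)
    preserve-recolour {A} {e} pres undone f d =
        trans (recolour-else A e (λ f≡e → undone (subst (λ x → done (lookup D x)) f≡e d))) (pres f d)

    wrong-irrelevant : ∀ {A e} → lookup D e ≢ t → wrong t (flip c c′ ⁅ e ⁆ A) ℕ.≤ wrong t A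
    wrong-irrelevant {A} {e} ne = count-mono (wrong? t (flip c c′ ⁅ e ⁆ A)) (wrong? t A) λ f (p , q) →
      p , λ eq → q (trans (recolour-else A e (λ f≡e → ne (subst (λ x → lookup D x ≡ t) f≡e p))) eq)

    wrong-corrected : ∀ {A e} → lookup D e ≡ t → lookup A e ≡ o → wrong t (flip c c′ ⁅ e ⁆ A) ℕ.< wrong t A
    wrong-corrected {A} {e} p q = count-< (wrong? t (flip c c′ ⁅ e ⁆ A)) (wrong? t A)
      (λ f (pf , qf) → pf , λ eq → qf
          (trans (recolour-else A e (λ f≡e → qf (trans (cong (lookup (flip c c′ ⁅ e ⁆ A)) f≡e) becomes-t))) eq))
      (p , λ eq → o≢t (trans (sym q) eq)) (λ (_ , ne) → ne becomes-t)
      where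
      becomes-t : lookup (flip c c′ ⁅ e ⁆ A) e ≡ t
      becomes-t = trans (recolour-self A e) (trans (cong τ q) (transpose-involutive c c′ t))

    -- Recolours the second edge of colour t at z.
    leave : ∀ {C A} → Outer C A →
            (∃[ C′ ] (Transition C C′ × Preserved (assignment C′) × wrong t (assignment C′) ℕ.≤ wrong t A)) ⊎
            (∃[ C′ ] ∃[ A′ ] (Transition C C′ × Inner C′ A′ × wrong t A′ ℕ.≤ wrong t A))
    leave {C} {A} s =
      let h , tz = focus near incident (subst In (sym current) t∈)
          h-t = repeated-colour near repz (incʳ tz) (onʳ tz)
          -- The target is proper and already prescribes `t` for `f` at `z`, so it does not
          -- prescribe `t` for `h`, and recolouring `h` creates no new wrong edge.
          h-D = λ eq → distinct tz (proper-same D properD incident (incʳ tz) (trans target (sym eq)))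
      in split (incʳ tz) (onʳ tz) h-t h-D (incident? y h)
      where
      open Outer s
      near = lift-near lifted
      Goal : Set
      Goal = (∃[ C′ ] (Transition C C′ × Preserved (assignment C′) × wrong t (assignment C′) ℕ.≤ wrong t A)) ⊎
             (∃[ C′ ] ∃[ A′ ] (Transition C C′ × Inner C′ A′ × wrong t A′ ℕ.≤ wrong t A))
      module _ {h : Edge} (ih : Incident z h) (oh : OnH A h) (h-t : lookup A h ≡ t) (h-D : lookup D h ≢ t) where
        A′ = flip c c′ ⁅ h ⁆ A
        lw : Low (perturb₂ c c′ A) ⁅ h ⁆ 4
        lw = low₂-def near twoD (defˡ twoD) ih oh
        pres : Preserved A′
        pres = preserve-recolour {A} preserved (λ d → t-open (subst done (trans (sym (preserved h d)) h-t) d))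
        less : wrong t A′ ℕ.≤ wrong t A
        less = wrong-irrelevant {A} {h} h-D
        close : Incident y h → Goal
        close iy =
          let nodef = recolour-closing {A} near {h} oh twoD ih iy
              C′ , tr , l = move₂ {C} {A} {h} {4} lifted lw (inj₁ nodef)
              C′≡ = lift-nodef l nodef
          in inj₁ (C′ , tr , subst Preserved (sym C′≡) pres , subst (λ X → wrong t X ℕ.≤ wrong t A) (sym C′≡) less)
        go-on : ¬ Incident y h → Goal
        go-on away =
          let td = recolour-moving {A} near {h} oh twoD ih away
              C′ , tr , l = move₂ {C} {A} {h} {4} lifted lw (inj₂ (x , y , td))
              f₁ , (i₁ , D₁) , _ = count-1⁻ (λ e → incident? x e ×-dec (lookup D e Fin.≟ t)) (#at-1 D properD x t)
          in inj₂ (C′ , A′ , tr ,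
               record { lifted = l ; twoD = td ; repx = subst (λ a → Repeated A′ x (τ a)) h-t
                   (repeated-new near oh ix okx)
                      ; repy = repeated-away near away repy ; sides = trans (Bool.¬-not sides)
                          (sym (side-end (not (side z)) h))
                      ; f = f₁ ; incident = i₁ ; target = D₁ ; current = not-t i₁ D₁ ; preserved = pres } , less)
          where
          x = end (not (side z)) h
          ix : Incident x h
          ix = end-incident (not (side z)) h
          not-zy : ¬ (x ≡ z ⊎ x ≡ y)
          not-zy (inj₁ eq) = end-≢ (side z) h (trans (incident⇒end ih) (sym eq))
          not-zy (inj₂ eq) = away (subst (λ v → Incident v h) eq ix)
          okx : ¬ Deficient A x
          okx def = not-zy (onlyDef twoD def)
          -- Before this step `x` was not deficient and `h` was its only edge of colour `t`, so the
          -- edge for which the target prescribes `t` there cannot have that colour.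
          not-t : ∀ {f₁} → Incident x f₁ → lookup D f₁ ≡ t → lookup A′ f₁ ≢ t
          not-t {f₁} i₁ D₁ eq =
            let h′ , tx = focus near ix oh
                f₁≢h = λ f₁≡h → h-D (trans (cong (lookup D) (sym f₁≡h)) D₁)
                A₁ = trans (sym (recolour-else A h f₁≢h)) eq
                f₁≡h′ = [ (λ f₁≡h → contradiction f₁≡h f₁≢h) , id ]′ (only tx i₁ (subst In (sym A₁) t∈))
            in okx (≡⇒def tx (trans h-t (trans (sym A₁) (cong (lookup A) f₁≡h′))))
        split : Dec (Incident y h) → Goal
        split (yes iy)  = close iy
        split (no away) = go-on away

    -- Gives f the colour o, by a swap with a third colour if necessary.
    prepare : ∀ {C A} (s : Inner C A) → lookup A (Inner.f s) ≡ o ⊎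
              (∃[ C′ ] ∃[ A′ ] (Transition C C′ × (Σ[ s′ ∈ Inner C′ A′ ] lookup A′ (Inner.f s′) ≡ o) ×
                  wrong t A′ ℕ.≤ wrong t A))
    prepare {C} {A} s = split (lookup A f Fin.≟ o)
      where
      open Inner s
      near = lift-near lifted
      Swapped : Set
      Swapped = ∃[ C′ ] ∃[ A′ ] (Transition C C′ × (Σ[ s′ ∈ Inner C′ A′ ] lookup A′ (Inner.f s′) ≡ o) ×
          wrong t A′ ℕ.≤ wrong t A)
      opp : Opposite A x y
      opp = sides , λ a p q → o≢t (trans (repeated-unique near repx p) (repeated-unique near q repy))
      module _ (f-o : lookup A f ≢ o) where
        c″ = lookup A f
        c″∉ : ¬ In c″
        c″∉ p = f-o (sym (τ-other t∈ p (λ eq → current (sym eq))))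
        exchange : ∀ {h F} → lookup A h ≡ o → AlternatingCycle A (lookup A h) c″ F → f ∈ F → Swapped
        exchange {h} {F} h-o cyc f∈ =
          let C′ , tr , l = move₃ {c″} (λ eq → c″∉ (inj₁ eq)) (λ eq → c″∉ (inj₂ eq)) {C} {A} lifted twoD opp
                  (defˡ twoD) (subst (Repeated A x) (sym h-o) repx) cyc (f , incident , f∈)
          in C′ , A′ , tr ,
             (record { lifted = l ; twoD = counts-twoDef {A} {A′} same′ twoD ; repx = counts-repeated A A′ same′
                 {x} {o} repx ; repy = counts-repeated A A′ same′ {y} {t} repy
                     ; sides = sides ; f = f ; incident = incident ; target = target ; current = λ eq →
                         o≢t (trans (sym f′) eq) ; preserved = pres } , f′) ,
             -- An edge of colour `t` is not on the cycle, whose colours are `o` and `c″`, and so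
             -- keeps its colour.
             count-mono (wrong? t A′) (wrong? t A) (λ e (p , q) → p , λ eq →
                 q (trans (flip-∉ A (λ e∈ → not-t e∈ eq)) eq))
          where
          A′ = flip (lookup A h) c″ F A
          same′ : SameCounts A A′
          same′ u d = sym (cycle-count A cyc u d)
          f′ : lookup A′ f ≡ o
          f′ = trans (flip-∈ A f∈) (trans (transposeʳ (lookup A h) c″) h-o)
          cols : ∀ {e} → e ∈ F → lookup A e ≡ o ⊎ lookup A e ≡ c″
          cols {e} e∈ = [ (λ p → inj₁ (trans p h-o)) , inj₂ ]′ (proj₁ (proj₂ cyc) e e∈)
          not-t : ∀ {e} → e ∈ F → lookup A e ≢ t
          not-t e∈ eq = [ (λ p → o≢t (trans (sym p) eq)) , (λ p → current (trans (sym p) eq)) ]′ (cols e∈)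
          -- At x the target has an edge of every finished colour, and A agrees with it.
          c″-open : ¬ done c″
          c″-open d =
            let g , (ig , Dg) , _ = count-1⁻ (λ e → incident? x e ×-dec (lookup D e Fin.≟ c″)) (#at-1 D properD x c″)
                Ag = trans (preserved g (subst done (sym Dg) d)) Dg
                g≡f = count-≤1⁻ (λ e → incident? x e ×-dec (lookup A e Fin.≟ c″))
                    (ℕ.≤-reflexive (rest (proj₂ (proj₂ (near x))) c″∉)) (ig , Ag) (incident , refl)
            in current (trans (sym Dg) (trans (cong (lookup D) g≡f) target))
          pres : Preserved A′
          pres e d = decide (e ∈? F)
            where
            decide : Dec (e ∈ F) → lookup A′ e ≡ lookup D e
            decide (no e∉)  = trans (flip-∉ A e∉) (preserved e d)
            decide (yes e∈) = contradiction (subst done (sym (preserved e d)) d)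
              (λ q → [ (λ p → o-open (subst done p q)) , (λ p → c″-open (subst done p q)) ]′ (cols e∈))
        swapped : Swapped
        swapped =
          let h , h′ , tx = near x
              F , cyc , through , _ = cycle-at {A} near {x} (defˡ twoD) {h} (incˡ tx) (onˡ tx) away {c″} c″∉
          in exchange (repeated-colour near repx (incˡ tx) (onˡ tx)) cyc (through incident refl)
          where
          away : ∀ {w} → Deficient A w → w ≢ x → side w ≡ side x × (∀ a → Repeated A x a → ¬ Repeated A w a)
          away {w} def w≢x = [ (λ p → contradiction p w≢x) ,
              (λ p → subst (λ v → side v ≡ side x × (∀ a → Repeated A x a → ¬ Repeated A v a)) (sym p) opp) ]′
              (onlyDef twoD def)
      split : Dec (lookup A f ≡ o) → lookup A f ≡ o ⊎ Swapped
      split (yes eq) = inj₁ eq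
      split (no ne)  = inj₂ (swapped ne)

    -- Recolours f from o to t.
    correct : ∀ {C A} (s : Inner C A) → lookup A (Inner.f s) ≡ o → ∃[ C′ ] ∃[ A′ ] (Transition C C′ ×
        Outer C′ A′ × wrong t A′ ℕ.< wrong t A)
    correct {C} {A} s f-o =
      let C′ , tr , l = move₂ {C} {A} {f} {4} lifted (low₂-def near twoD (defˡ twoD) incident on) (inj₂ (z , y , td))
      in C′ , A′ , tr ,
         record { lifted = l ; twoD = td ; repz = subst (Repeated A′ z) τo (repeated-new near on iz okz) ;
             repy = repeated-away near away repy
                ; sides = λ eq → Bool.not-¬ refl (trans (sym sides) (trans eq (side-end (not (side x)) f)))
                ; f = f ; incident = iz ; target = target ; current = trans (recolour-self A f) τo
                ; preserved = preserve-recolour {A} preserved (λ d → t-open (subst done target d)) } ,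
         wrong-corrected {A} {f} target f-o
      where
      open Inner s
      near = lift-near lifted
      A′ = flip c c′ ⁅ f ⁆ A
      on : OnH A f
      on = subst In (sym f-o) o∈
      τo : τ (lookup A f) ≡ t
      τo = trans (cong τ f-o) (transpose-involutive c c′ t)
      -- `y` lies on the side of `x`, and `f` has only one end there. So a correction never ends the
      -- round; only `leave` can.
      away : ¬ Incident y f
      away iy = neq twoD (incident-same incident iy (sym sides))
      z = end (not (side x)) f
      iz : Incident z f
      iz = end-incident (not (side x)) f
      not-xy : ¬ (z ≡ x ⊎ z ≡ y)
      not-xy (inj₁ eq) = end-≢ (side x) f (trans (incident⇒end incident) (sym eq))
      not-xy (inj₂ eq) = away (subst (λ v → Incident v f) eq iz)
      okz : ¬ Deficient A z
      okz def = not-xy (onlyDef twoD def)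
      td : TwoDef A′ z y
      td = recolour-moving {A} near {f} on twoD incident away

    prepend : ∀ {C C′ m n m′ n′} → Transition C C′ → m ℕ.≤ m′ → suc n ℕ.≤ n′ → Progress C′ m n → Progress C m′ n′
    prepend {C′ = C′} tr m≤ n≤ (C″ , d , trs , pres , le , less) = C″ , suc d , (C′ , tr , trs) , pres ,
        ℕ.≤-trans (ℕ.s≤s le) n≤ , ℕ.≤-trans less m≤

    weaken : ∀ {C m n m′ n′} → m ℕ.≤ m′ → n ℕ.≤ n′ → Progress C m n → Progress C m′ n′
    weaken m≤ n≤ (C″ , d , trs , pres , le , less) = C″ , d , trs , pres , ℕ.≤-trans le n≤ , ℕ.≤-trans less m≤

    one-more : ∀ {a b} → a ℕ.≤ b → 1 ℕ.+ 3 * a ℕ.≤ 1 ℕ.+ 3 * b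
    one-more a≤b = ℕ.s≤s (ℕ.*-monoʳ-≤ 3 a≤b)

    three-more : ∀ {a b} → a ℕ.< b → 3 ℕ.+ 3 * a ℕ.≤ 3 * b
    three-more {a} {b} a<b = ℕ.≤-trans (ℕ.≤-reflexive (sym (ℕ.*-suc 3 a))) (ℕ.*-monoʳ-≤ 3 a<b)

    -- Apart from one extra step, three transitions are spent on every edge that is corrected.
    follow : ∀ n {C A} → wrong t A ℕ.≤ n → Outer C A → Progress C (wrong t A) (1 ℕ.+ 3 * wrong t A)

    follow-inner : ∀ n {C A} → wrong t A ℕ.≤ n → Inner C A → Progress C (wrong t A) (3 * wrong t A)

    -- `b` is the number of wrong edges after the correction. One transition for it and `1 + 3 * b`
    -- for the rest make `2 + 3 * b`, which leaves one for the swap in `prepare` within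
    -- `3 * wrong t A`.
    follow-ready : ∀ n {C A} → wrong t A ℕ.≤ n → (s : Inner C A) → lookup A (Inner.f s) ≡ o →
                   ∃[ b ] (3 ℕ.+ 3 * b ℕ.≤ 3 * wrong t A × Progress C (wrong t A) (2 ℕ.+ 3 * b))

    follow n {C} {A} le s = split (leave s)
      where
      split : (∃[ C′ ] (Transition C C′ × Preserved (assignment C′) × wrong t (assignment C′) ℕ.≤ wrong t A)) ⊎
              (∃[ C′ ] ∃[ A′ ] (Transition C C′ × Inner C′ A′ × wrong t A′ ℕ.≤ wrong t A)) →
                  Progress C (wrong t A) (1 ℕ.+ 3 * wrong t A)
      split (inj₁ (C′ , tr , pres , less)) = C′ , 1 , (C′ , tr , refl) , pres , one-more less , less
      split (inj₂ (C′ , A′ , tr , s′ , less)) = prepend {C} {C′} {wrong t A′} {3 * wrong t A′} tr less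
          (one-more less) (follow-inner n (ℕ.≤-trans less le) s′)

    follow-inner n {C} {A} le s = split (prepare s)
      where
      split : lookup A (Inner.f s) ≡ o ⊎
              (∃[ C′ ] ∃[ A′ ] (Transition C C′ × (Σ[ s′ ∈ Inner C′ A′ ] lookup A′ (Inner.f s′) ≡ o) ×
                  wrong t A′ ℕ.≤ wrong t A)) → Progress C (wrong t A) (3 * wrong t A)
      split (inj₁ f-o) =
        let b , more , p = follow-ready n le s f-o in weaken {C} ℕ.≤-refl (ℕ.≤-trans (ℕ.n≤1+n _) more) p
      split (inj₂ (C′ , A′ , tr , (s′ , f-o) , less)) =
        let b , more , p = follow-ready n (ℕ.≤-trans less le) s′ f-o in prepend {C} {C′} tr less
                (ℕ.≤-trans more (ℕ.*-monoʳ-≤ 3 less)) p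

    follow-ready zero    le s f-o =
      let _ , _ , _ , _ , less = correct s f-o in contradiction (ℕ.≤-trans less le) λ ()
    follow-ready (suc n) {C} {A} le s f-o =
      let C′ , A′ , tr , s′ , less = correct s f-o
      in wrong t A′ , three-more less ,
         prepend {C} {C′} tr (ℕ.<⇒≤ less) ℕ.≤-refl (follow n (ℕ.≤-pred (ℕ.≤-trans less le)) s′)

    -- Recolouring `e` makes both of its ends repeat `t`, on opposite sides. This takes one
    -- transition but lowers the bound by three, which also pays for the extra one in `follow`.
    descend : ∀ C {e} → Preserved (assignment C) → lookup D e ≡ t → lookup (assignment C) e ≡ o →
              ∃[ C′ ] ∃[ d ] (Transitions d C C′ × Preserved (assignment C′) × d ℕ.+ 3 * wrong t (assignment C′)
                  ℕ.≤ 3 * wrong t (assignment C) ×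
                              wrong t (assignment C′) ℕ.< wrong t (assignment C))
    descend C {e} pres De Ce =
      let C′ , tr , l = move₂ {C} {A} {e} (lift-self C) (low₂-edge {A} nodef on) (inj₂ (endˡ e , endʳ e , td))
          C″ , d , trs , pres″ , le , less′ = follow (wrong t A′) {C′} {A′} ℕ.≤-refl
            (record { lifted = l ; twoD = td ; repz = rep (inj₁ refl) ; repy = rep (inj₂ refl)
                    ; sides = λ eq → case trans (sym (side-ʳ e)) (trans eq (side-ˡ e)) of λ ()
                    ; f = e ; incident = inj₁ refl ; target = De ; current = trans (recolour-self A e) τo
                    ; preserved = preserve-recolour {A} pres (λ d → t-open (subst done De d)) })
      in C″ , suc d , (C′ , tr , trs) , pres″ , ℕ.≤-trans (ℕ.s≤s le) (ℕ.≤-trans (ℕ.n≤1+n _) (three-more less)) ,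
          ℕ.≤-<-trans less′ less
      where
      A = assignment C
      A′ = flip c c′ ⁅ e ⁆ A
      near = proper⇒near A (proper C)
      nodef = proper⇒nodef A (proper C)
      on : OnH A e
      on = subst In (sym Ce) o∈
      τo : τ (lookup A e) ≡ t
      τo = trans (cong τ Ce) (transpose-involutive c c′ t)
      td : TwoDef A′ (endˡ e) (endʳ e)
      td = recolour-nodef {A} near {e} on nodef
      rep : ∀ {u} → Incident u e → Repeated A′ u t
      rep {u} i = subst (Repeated A′ u) τo (repeated-new near on i (nodef u))
      less : wrong t A′ ℕ.< wrong t A
      less = wrong-corrected {A} {e} De Ce

-- Distances by exhaustive search

count-+ : ∀ {n} {P Q R : Pred (Fin n) 0ℓ} (P? : Decidable P) (Q? : Decidable Q) (R? : Decidable R) →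
          (∀ x → P x → R x) → (∀ x → Q x → R x) → (∀ x → P x → ¬ Q x) → count P? ℕ.+ count Q? ℕ.≤ count R?
count-+ {n} P? Q? R? P⊆R Q⊆R disjoint = subst (ℕ._≤ count R?) (List.length-++ (filter P? (allFin n)))
  (unique-length _≡_ (Unique.++⁺ (filter-unique P?) (filter-unique Q?) (λ (p , q) → disjoint _ (∈-filter⁻ P? p)
      (∈-filter⁻ Q? q)))
    (λ {x} x∈ → x , ∈-filter R? ([ (λ p → P⊆R x (∈-filter⁻ P? p)) , (λ q → Q⊆R x (∈-filter⁻ Q? q)) ]′
        (∈ˡ.∈-++⁻ (filter P? (allFin n)) x∈)) , refl)
    (λ { _ _ refl refl → refl }))

anyVec? : ∀ {k} n {P : Vec (Fin k) n → Set} → (∀ v → Dec (P v)) → Dec (∃ P)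
anyVec? zero    P? = map′ (λ p → Vec.[] , p) (λ { (Vec.[] , p) → p }) (P? Vec.[])
anyVec? (suc n) P? = map′ (λ (x , v , p) → x Vec.∷ v , p) (λ { (x Vec.∷ v , p) → x , v , p })
    (Fin.any? (λ x → anyVec? n (λ v → P? (x Vec.∷ v))))

least : {P : ℕ → Set} → (∀ n → Dec (P n)) → ∀ n → P n → ∃[ m ] (P m × (∀ j → P j → m ℕ.≤ j) × m ℕ.≤ n)
least {P} P? n p = search n n ℕ.≤-refl p
  where
  search : ∀ b n → n ℕ.≤ b → P n → ∃[ m ] (P m × (∀ j → P j → m ℕ.≤ j) × m ℕ.≤ n)
  search b n n≤b p with ℕ.anyUpTo? P? n
  ... | no none = n , p , (λ j q → ℕ.≮⇒≥ (λ j<n → none (j , j<n , q))) , ℕ.≤-refl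
  search zero    n n≤b p | yes (m , m<n , q) = contradiction (ℕ.≤-trans m<n n≤b) λ ()
  search (suc b) n n≤b p | yes (m , m<n , q) with search b m (ℕ.≤-pred (ℕ.≤-trans m<n n≤b)) q
  ... | l , r , min , l≤m = l , r , min , ℕ.≤-trans l≤m (ℕ.<⇒≤ m<n)

module Distances (G : BipartiteGraph) (k : ℕ) (regular : BipartiteGraph.Regular G k) where

  open Colourings G k regular

  -- Two colourings with the same assignment may still carry different proofs of properness.
  -- `Transitions` sees the assignments only, so such colourings are interchangeable.
  transitions-from : ∀ n {C₁ C₂ C₃} → assignment C₁ ≡ assignment C₂ → Transitions n C₂ C₃ → Transitions n C₁ C₃
  transitions-from zero    eq eq′            = trans eq eq′
  transitions-from (suc n) eq (C , tr , trs) =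
    C , subst (λ A → Positive (Pr (λ x → proj₁ x ≟ᵃ assignment C) (propose A))) (sym eq) tr , trs

  transitions-++ : ∀ m {n C₁ C₂ C₃} → Transitions m C₁ C₂ → Transitions n C₂ C₃ → Transitions (m ℕ.+ n) C₁ C₃
  transitions-++ zero {n} {C₁} {C₂} {C₃} eq trs = transitions-from n {C₁} {C₂} {C₃} eq trs
  transitions-++ (suc m) {n} {C₃ = C₃} (C , tr , trs) trs′ = C , tr , transitions-++ m {n} {C} {C₃ = C₃} trs trs′

  proper? : ∀ A → Dec (Proper A)
  proper? A = Fin.all? λ e → Fin.all? λ f → adjacent? e f →-dec ¬? (lookup A e Fin.≟ lookup A f)

  positive? : ∀ p → Dec (Positive p)
  positive? p = map′ ℚ.positive (λ pos → ℚ.positive⁻¹ p {{pos}}) (0ℚ ℚ.<? p)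

  transitions? : ∀ d C₁ C₂ → Dec (Transitions d C₁ C₂)
  transitions? zero    C₁ C₂ = assignment C₁ ≟ᵃ assignment C₂
  transitions? (suc d) C₁ C₂ = map′ (λ (A , p , q , r) → colouring A p , q , r)
    (λ (C , q , r) → assignment C , proper C , q , transitions-from d {colouring (assignment C) (proper C)} {C}
        {C₂} refl r) (anyVec? #E (λ A → step A (proper? A)))
    where
    Step : Assignment → Set
    Step A = Σ[ p ∈ Proper A ] (Transition C₁ (colouring A p) × Transitions d (colouring A p) C₂)
    step : ∀ A → Dec (Proper A) → Dec (Step A)
    step A (no ¬p) = no (λ (p , _) → ¬p p)
    step A (yes p) = map′ (p ,_) (λ (p′ , q , r) → q , transitions-from d {colouring A p} {colouring A p′} {C₂} refl r)
      (positive? (Pr (λ x → proj₁ x ≟ᵃ A) (propose (assignment C₁))) ×-dec transitions? d (colouring A p) C₂)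

  -- `Diameter≤` asks for an exact distance. Reachability in a fixed number of steps is decidable by
  -- running through all assignments, so the minimum can be found below any known walk length.
  distance-exists : ∀ C₁ C₂ n → Transitions n C₁ C₂ → ∃[ d ] (Distance C₁ C₂ d × d ℕ.≤ n)
  distance-exists C₁ C₂ n trs =
    let d , t , min , d≤n = least (λ d → transitions? d C₁ C₂) n trs in d , (t , min) , d≤n


-- The bound on the diameter

module Recolouring (G : BipartiteGraph) (k : ℕ) (regular : BipartiteGraph.Regular G k) (target : M.EdgeColouring
    G k) where

  open Cycles G k regular
  open Distances G k regular

  private
    D : Assignment
    D = assignment target

  open Targets G k D

  module _ (done : Colour → Set) (t : Colour) (t-open : ¬ done t) where

    open Preservation done

    Cleared : EdgeColouring → Set
    Cleared C = ∃[ C′ ] ∃[ d ] (Transitions d C C′ × Preserved (assignment C′) × (∀ e → lookup D e ≡ t →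
        lookup (assignment C′) e ≡ t) ×
                                d ℕ.≤ 3 * wrong t (assignment C))

    Descended : EdgeColouring → Set
    Descended C = ∃[ C′ ] ∃[ d ] (Transitions d C C′ × Preserved (assignment C′) × d ℕ.+ 3 * wrong t
        (assignment C′) ℕ.≤ 3 * wrong t (assignment C) ×
                                  wrong t (assignment C′) ℕ.< wrong t (assignment C))

    -- If the wrong colour of `e` were finished, the edge with this target colour at the left end of
    -- `e` would have it too. By properness it is `e`, whose target is `t`.
    current-open : ∀ C {e} → Preserved (assignment C) → lookup D e ≡ t → lookup (assignment C) e ≢ t →
        ¬ done (lookup (assignment C) e)
    current-open C {e} pres De Ce≢t d =
      let A = assignment C
          g , (i , Dg) , _ = count-1⁻ (λ g → incident? (endˡ e) g ×-dec (lookup D g Fin.≟ lookup A e))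
              (#at-1 D (proper target) (endˡ e) (lookup A e))
          Ag = trans (pres g (subst done (sym Dg) d)) Dg
          g≡e = proper-same A (proper C) i (inj₁ refl) Ag
      in Ce≢t (trans (sym Dg) (trans (cong (lookup D) g≡e) De))

    descended : ∀ C {e} → Preserved (assignment C) → lookup D e ≡ t → lookup (assignment C) e ≢ t → Descended C
    descended C {e} pres De Ce≢t = split (Fin.<-cmp t (lookup (assignment C) e))
      where
      o = lookup (assignment C) e
      o-open : ∀ {x} → x ≡ o → ¬ done x
      o-open eq d = current-open C pres De Ce≢t (subst done eq d)
      split : _ → Descended C
      split (tri< lt _ _) = Descent.descend G k regular t o lt D (proper target) done t (inj₁ refl) t-open
          (o-open (transposeˡ t o)) C pres De (sym (transposeˡ t o))
      split (tri≈ _ eq _) = contradiction (sym eq) Ce≢t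
      split (tri> _ _ gt) = Descent.descend G k regular o t gt D (proper target) done t (inj₂ refl) t-open
          (o-open (transposeʳ o t)) C pres De (sym (transposeʳ o t))

    clear : ∀ n C → wrong t (assignment C) ℕ.≤ n → Preserved (assignment C) → Cleared C
    clear n C le pres = split n le (Fin.any? (wrong? t (assignment C)))
      where
      split : ∀ n → wrong t (assignment C) ℕ.≤ n → Dec (∃[ e ] (lookup D e ≡ t × lookup (assignment C) e ≢ t)) →
          Cleared C
      split n le (no none) = C , 0 , refl , pres , (λ e De → agree e De (lookup (assignment C) e Fin.≟ t)) , ℕ.z≤n
        where
        agree : ∀ e → lookup D e ≡ t → Dec (lookup (assignment C) e ≡ t) → lookup (assignment C) e ≡ t
        agree e De (yes eq) = eq
        agree e De (no ne)  = contradiction (e , De , ne) none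
      split n le (yes (e , De , Ce)) = combine n le (descended C pres De Ce)
        where
        combine : ∀ n → wrong t (assignment C) ℕ.≤ n → Descended C → Cleared C
        combine zero    le (C₁ , d , trs , pres₁ , le₁ , less) = contradiction (ℕ.≤-trans less le) λ ()
        combine (suc n) le (C₁ , d , trs , pres₁ , le₁ , less) =
          let C₂ , d′ , trs′ , pres₂ , agree , le₂ = clear n C₁ (ℕ.≤-pred (ℕ.≤-trans less le)) pres₁
          in C₂ , d ℕ.+ d′ , transitions-++ d {d′} {C} {C₁} {C₂} trs trs′ , pres₂ , agree ,
              ℕ.≤-trans (ℕ.+-monoʳ-≤ d le₂) le₁

  later? : ∀ i e → Dec (i ℕ.≤ toℕ (lookup D e))
  later? i e = i ℕ.≤? toℕ (lookup D e)

  -- The finished colours are those below `i`. An edge is charged at most three transitions, and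
  -- only when its own target colour is treated, so the costs of all colours add up to at most three
  -- per edge.
  from-colour : ∀ r i → i ℕ.+ r ≡ k → ∀ C → (∀ e → toℕ (lookup D e) ℕ.< i → lookup (assignment C) e ≡ lookup D e) →
                ∃[ d ] (Transitions d C target × d ℕ.≤ 3 * count (later? i))
  from-colour zero i eq C agree =
    0 , lookup-ext (λ e → agree e (subst (toℕ (lookup D e) ℕ.<_) (sym (trans (sym (ℕ.+-identityʳ i)) eq))
        (Fin.toℕ<n (lookup D e)))) , ℕ.z≤n
  from-colour (suc r) i eq C agree =
    let C₁ , d , trs , pres , agree-t , le = clear (λ x → toℕ x ℕ.< i) t (λ lt → ℕ.<-irrefl toℕ-t lt)
            (wrong t (assignment C)) C ℕ.≤-refl agree
        d′ , trs′ , le′ = from-colour r (suc i) (trans (sym (ℕ.+-suc i r)) eq) C₁ (λ e lt →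
            extend {assignment C₁} pres agree-t e (ℕ.m≤n⇒m<n∨m≡n (ℕ.≤-pred lt)))
    in d ℕ.+ d′ , transitions-++ d {d′} {C} {C₁} {target} trs trs′ , total le le′
    where
    i<k : i ℕ.< k
    i<k = subst (suc i ℕ.≤_) (trans (sym (ℕ.+-suc i r)) eq) (ℕ.m≤m+n (suc i) r)
    t : Colour
    t = fromℕ< i<k
    toℕ-t : toℕ t ≡ i
    toℕ-t = Fin.toℕ-fromℕ< i<k
    is-t : ∀ {e} → toℕ (lookup D e) ≡ i → lookup D e ≡ t
    is-t eq = Fin.toℕ-injective (trans eq (sym toℕ-t))
    extend : ∀ {A} → (∀ e → toℕ (lookup D e) ℕ.< i → lookup A e ≡ lookup D e) → (∀ e → lookup D e ≡ t →
        lookup A e ≡ t) →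
             ∀ e → toℕ (lookup D e) ℕ.< i ⊎ toℕ (lookup D e) ≡ i → lookup A e ≡ lookup D e
    extend pres agree-t e (inj₁ lt) = pres e lt
    extend pres agree-t e (inj₂ eq) = trans (agree-t e (is-t eq)) (sym (is-t eq))
    total : ∀ {d d′} → d ℕ.≤ 3 * wrong t (assignment C) → d′ ℕ.≤ 3 * count (later? (suc i)) → d ℕ.+ d′ ℕ.≤ 3 *
        count (later? i)
    total {d} {d′} le le′ = begin
      d ℕ.+ d′                                                        ≤⟨ ℕ.+-mono-≤ le le′ ⟩
      3 * wrong t (assignment C) ℕ.+ 3 * count (later? (suc i))       ≡⟨ ℕ.*-distribˡ-+ 3 (wrong t (assignment C)) _ ⟨
      3 * (wrong t (assignment C) ℕ.+ count (later? (suc i)))         ≤⟨ ℕ.*-monoʳ-≤ 3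
          (count-+ (wrong? t (assignment C)) (later? (suc i)) (later? i)
                                                                           (λ e (De , _) → ℕ.≤-reflexive (sym
                                                                               (trans (cong toℕ De) toℕ-t))) (λ
                                                                               e → ℕ.<⇒≤)
                                                                           (λ e (De , _) lt → ℕ.<-irrefl (sym
                                                                               (trans (cong toℕ De) toℕ-t)) lt)) ⟩
      3 * count (later? i)                                            ∎
      where open ℕ.≤-Reasoning

  reach : ∀ C → ∃[ d ] (Transitions d C target × d ℕ.≤ 3 * BipartiteGraph.#E G)
  reach C =
    let d , trs , le = from-colour k 0 refl C (λ _ ())
    in d , trs , ℕ.≤-trans le (ℕ.*-monoʳ-≤ 3
        (ℕ.≤-trans (List.length-filter (later? 0) (allFin (BipartiteGraph.#E G)))
        (ℕ.≤-reflexive (length-allFin (BipartiteGraph.#E G)))))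

-- Constants and conclusion

open BipartiteGraph using (#V; #E; Regular; Balanced)

distinct⇒2≤ : ∀ {n} {x y : Fin n} → x ≢ y → 2 ℕ.≤ n
distinct⇒2≤ {suc zero} {zero} {zero} x≢y = contradiction refl x≢y
distinct⇒2≤ {suc (suc n)}            x≢y = ℕ.s≤s (ℕ.s≤s ℕ.z≤n)

-- Some vertex exists, and balance provides another on the opposite side. For |V| = 1 the claimed
-- bound would be 0.
balanced⇒2≤ : (G : BipartiteGraph) → .{{_ : NonZero (#V G)}} → Balanced G → 2 ℕ.≤ #V G
balanced⇒2≤ G balanced = split (side v) refl
  where
  open BipartiteGraph G using (side; Vertex)
  side? : ∀ s (v : Vertex) → Dec (side v ≡ s)
  side? s v = side v Bool.≟ s
  v : Vertex
  v = fromℕ< (ℕ.>-nonZero⁻¹ (#V G))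
  opposite : ∀ {s s′} → side v ≡ s → s ≢ s′ → count (side? s) ≡ count (side? s′) → 2 ℕ.≤ #V G
  opposite {s} {s′} sv s≢s′ eq = decide (Fin.any? (side? s′))
    where
    decide : Dec (∃[ w ] side w ≡ s′) → 2 ℕ.≤ #V G
    decide (yes (w , sw)) = distinct⇒2≤ {x = v} {w} (λ v≡w → s≢s′ (trans (sym sv) (trans (cong side v≡w) sw)))
    decide (no none)      = contradiction sv
        (count-0⁻ (side? s) (trans eq (count-0 (side? s′) (λ w sw → none (w , sw)))) v)
  split : ∀ s → side v ≡ s → 2 ℕ.≤ #V G
  split false sv = opposite sv (λ ()) balanced
  split true  sv = opposite sv (λ ()) (sym balanced)

-- From `n` ≤ 2(`n` - 1), with equality at `n` = 2.
square-bound : ∀ {n} → 2 ℕ.≤ n → 8 * (n * n) ℕ.≤ 16 * n * (n ∸ 1)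
square-bound {suc zero} (ℕ.s≤s ())
square-bound {suc (suc m)} _ = begin
  8 * (n * n)              ≤⟨ ℕ.*-monoʳ-≤ 8 (ℕ.*-monoʳ-≤ n n≤) ⟩
  8 * (n * (2 * suc m))    ≡⟨ cong (8 *_) (trans (sym (ℕ.*-assoc n 2 (suc m)))
      (trans (cong (_* suc m) (ℕ.*-comm n 2)) (ℕ.*-assoc 2 n (suc m)))) ⟩
  8 * (2 * (n * suc m))    ≡⟨ ℕ.*-assoc 8 2 (n * suc m) ⟨
  16 * (n * suc m)         ≡⟨ ℕ.*-assoc 16 n (suc m) ⟨
  16 * n * suc m           ∎
  where
  open ℕ.≤-Reasoning
  n = suc (suc m)
  n≤ : n ℕ.≤ 2 * suc m
  n≤ = ℕ.s≤s (ℕ.≤-trans (ℕ.≤-reflexive (ℕ.+-comm 1 m)) (ℕ.+-monoʳ-≤ m (ℕ.s≤s ℕ.z≤n)))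

theorem4p4 : (G : BipartiteGraph) (k : ℕ) → .{{_ : NonZero (#V G)}} → Regular G k → Balanced G → M.Diameter≤ G k (3 * #E G) × M.InverseAcceptance≤ G k (+ (16 * #V G * (#V G ∸ 1)) / 1)
theorem4p4 G k regular balanced =
  (λ C₁ C₂ →
    let n , trs , n≤ = Recolouring.reach G k regular C₂ C₁
        d , dist , d≤ = Distances.distance-exists G k regular C₁ C₂ n trs
    in d , dist , ℕ.≤-trans d≤ n≤) ,
  Ratio.inverse-acceptance G k regular (balanced⇒2≤ G balanced) (square-bound (balanced⇒2≤ G balanced))
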